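{- The problem \textsc{$(r,\ell)$wc-g} can be solved in polynomial time for $(r,\ell) \in \{(0,1),(0,2),(1,0),(1,1),(1,2),(2,0)\}$, and the problem \textsc{wc-$(r,\ell)$g} can be solved in polynomial time whenever $r \in \{0,1\}$ (for any fixed $\ell\ge 0$) or $(r,\ell)=(2,0)$.
   Context: All graphs are finite and simple. An $(r,\ell)$-partition of a graph $G$ is a partition of $V(G)$ into $r$ independent sets and $\ell$ cliques (parts may be empty); $G$ is an $(r,\ell)$-graph if it admits one. A graph is well-covered if all its maximal independent sets have the same cardinality; it is $(r,\ell)$-well-covered if it is both an $(r,\ell)$-graph and well-covered. For fixed $r,\ell$: \textsc{$(r,\ell)$wc-g} takes as input a graph $G$ and asks whether $G$ is $(r,\ell)$-well-covered; \textsc{wc-$(r,\ell)$g} takes as input an $(r,\ell)$-graph $G$ together with an $(r,\ell)$-partition of $V(G)$ and asks whether $G$ is well-covered. -}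

module Defs where

open import Data.Bool.Base using (Bool; true; false)
open import Data.Fin.Base using (Fin; zero; suc)
open import Data.Fin.Properties using (_≟_)
open import Data.Fin.Subset using (Subset; _∈_; _⊆_; ∣_∣)
open import Data.List.Base using (List; []; _∷_; _++_; length; map; concatMap; replicate; allFin)
open import Data.Maybe.Base using (Maybe; just; nothing)
open import Data.Nat.Base using (ℕ; suc; _+_; _*_; _^_)
open import Data.Nat.GeneralisedArithmetic using (iterate)
open import Data.Product.Base using (Σ; ∃; ∃-syntax; _×_; _,_; proj₁; proj₂)
open import Data.Sum.Base using (_⊎_; inj₁; inj₂)
open import Data.Sum.Properties using (≡-dec)
open import Data.Vec.Base as Vec using (Vec)
open import Function.Base using (_∘_)
open import Function.Bundles using (_↔_; _⇔_)
open import Level using (0ℓ)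
open import Relation.Binary.Definitions using (Symmetric)
open import Relation.Binary.PropositionalEquality using (_≡_; _≢_)
open import Relation.Nullary.Decidable.Core using (does)
open import Relation.Nullary.Negation.Core using (¬_)
open import Relation.Unary using (Pred)

record Graph : Set where
  field
    order : ℕ
    adj   : Fin order → Fin order → Bool

  Vertex : Set
  Vertex = Fin order

  Adj : Vertex → Vertex → Set
  Adj u v = adj u v ≡ true

  field
    adj-sym    : Symmetric Adj
    adj-irrefl : ∀ {v} → ¬ Adj v v

module _ (G : Graph) where
  open Graph G

  Independent : Pred Vertex 0ℓ → Set
  Independent P = ∀ {u v} → P u → P v → ¬ Adj u v

  Clique : Pred Vertex 0ℓ → Set
  Clique P = ∀ {u v} → P u → P v → u ≢ v → Adj u v

  MaximalIndependent : Subset order → Set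
  MaximalIndependent S =
    Independent (_∈ S) × (∀ T → Independent (_∈ T) → S ⊆ T → T ⊆ S)

  WellCovered : Set
  WellCovered = ∀ S T → MaximalIndependent S → MaximalIndependent T → ∣ S ∣ ≡ ∣ T ∣

  -- The parts are the fibres of `part`, so they may be empty.
  record Partition (r ℓ : ℕ) : Set where
    field
      part              : Vertex → Fin r ⊎ Fin ℓ
      independent-parts : ∀ i → Independent (λ v → part v ≡ inj₁ i)
      clique-parts      : ∀ j → Clique (λ v → part v ≡ inj₂ j)

-- Deterministic machines with suc k two-way infinite tapes; `nothing` is the
-- blank.  The first tape initially carries the input, with its head on the
-- first symbol.

Symbol : Set
Symbol = Maybe Bool

data Move : Set where
  left stay right : Move

-- The cells to the left of the head are listed from the head outwards, as
-- are those to the right; cells beyond the end of either list are blank.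
record Tape : Set where
  constructor tape
  field
    before : List Symbol
    head   : Symbol
    after  : List Symbol

fromWord : List Bool → Tape
fromWord []      = tape [] nothing []
fromWord (b ∷ w) = tape [] (just b) (map just w)

move : Move → Tape → Tape
move stay  t                    = t
move left  (tape []       a rs) = tape [] nothing (a ∷ rs)
move left  (tape (x ∷ ls) a rs) = tape ls x (a ∷ rs)
move right (tape ls a [])       = tape (a ∷ ls) nothing []
move right (tape ls a (x ∷ rs)) = tape (a ∷ ls) x rs

writeMove : Symbol × Move → Tape → Tape
writeMove (a , m) t = move m (record t { head = a })

record TuringMachine : Set₁ where
  field
    k       : ℕ
    State   : Set
    finite  : ∃[ n ] (State ↔ Fin n)
    start   : State
    -- `just b` marks a halting state with answer b.
    verdict : State → Maybe Bool
    δ       : State → Vec Symbol (suc k) → State × Vec (Symbol × Move) (suc k)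

  Config : Set
  Config = State × Vec Tape (suc k)

  initial : List Bool → Config
  initial w = start , fromWord w Vec.∷ Vec.replicate k (fromWord [])

  step : Config → Config
  step (q , ts) with verdict q
  ... | just _  = q , ts
  ... | nothing = let q′ , acts = δ q (Vec.map Tape.head ts)
                  in  q′ , Vec.zipWith writeMove acts ts

  -- The answer on input w if the machine halts within t steps.
  answerWithin : ℕ → List Bool → Maybe Bool
  answerWithin t w = verdict (proj₁ (iterate step (initial w) t))

record Problem : Set₁ where
  field
    Instance : Set
    encode   : Instance → List Bool
    Yes      : Instance → Set

-- Every polynomial in n is bounded by c * (1 + n) ^ d for some c and d.
PolynomialTime : Problem → Set₁
PolynomialTime P =
  Σ TuringMachine λ M → ∃[ c ] ∃[ d ] ∀ (x : Instance) →
    ∃[ b ] (TuringMachine.answerWithin M (c * suc (length (encode x)) ^ d) (encode x) ≡ just b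
            × (b ≡ true ⇔ Yes x))
  where open Problem P

-- The order in unary, closed by a 0, followed by the adjacency matrix row by row.
encodeGraph : Graph → List Bool
encodeGraph G =
  replicate order true ++ false ∷ concatMap (λ u → map (adj u) (allFin order)) (allFin order)
  where open Graph G

-- One indicator row over the vertices for each part, independent sets first.
encodePartition : ∀ {G r ℓ} → Partition G r ℓ → List Bool
encodePartition {G} {r} {ℓ} π =
  concatMap (row ∘ inj₁) (allFin r) ++ concatMap (row ∘ inj₂) (allFin ℓ)
  where
  open Partition π
  row : Fin r ⊎ Fin ℓ → List Bool
  row p = map (λ v → does (≡-dec _≟_ _≟_ (part v) p)) (allFin (Graph.order G))

[_,_]WC-G : ℕ → ℕ → Problem
[ r , ℓ ]WC-G = record
  { Instance = Graph
  ; encode   = encodeGraph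
  ; Yes      = λ G → Partition G r ℓ × WellCovered G
  }

WC-[_,_]G : ℕ → ℕ → Problem
WC-[ r , ℓ ]G = record
  { Instance = Σ Graph λ G → Partition G r ℓ
  ; encode   = λ (G , π) → encodeGraph G ++ encodePartition π
  ; Yes      = λ (G , _) → WellCovered G
  }

{-# OPTIONS --safe #-}
-- Let I be a greedily found maximal independent set.  If G is well-covered
-- and S is an independent set outside of which independent sets have at most
-- ℓ elements (as is the case outside a union of ℓ cliques), then |S| ≤ |I|
-- and |I ∖ S| ≤ ℓ, hence |I ⊖ S| ≤ 2ℓ and S is one of polynomially many
-- candidates.  Given S, a maximal independent set is determined by its at most
-- ℓ elements outside S, so all of them can be enumerated and compared with I.
-- No partition is read, so the same search serves both problems.
--
-- Call y a partner of x if xy is an edge and N(x) is completely joined to N(y).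
-- A bipartite graph is well-covered iff every non-isolated vertex has a partner
-- and partners have equally many partners; this is Ravindra's theorem with the
-- perfect matching replaced by counting.
--
-- The procedures are nested loops over vertices that act on finitely many
-- vertex sets.  Each set and each loop variable (as a singleton) occupies a
-- tape of its own, so no tape outgrows the input, and a loop costs a factor
-- linear in the number of vertices.
module Submission where

-- What makes the search sound is not that the candidate S comes from a partition, but two
-- properties that nested loops can test: S is independent, and no independent set of ℓ + 1 vertices
-- lies outside S. A partition only guarantees that, if G is well-covered, some candidate passes;
-- hence every ℓ is allowed when a partition is promised. Recognition must in addition split the
-- rest into ℓ cliques, that is, colour the complement graph on it with ℓ colours, which is where ℓ
-- ≤ 2 comes from. Merging all independent parts into the single independent set S forces r ≤ 1, so
-- (2,0) needs an argument of its own. For bipartite graphs a perfect matching would have to be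
-- computed and stored as a function on the vertices; comparing numbers of partners takes two vertex
-- sets at a time. Sufficiency is then a double count with fractional weights, and necessity an
-- exchange between maximum independent sets. Time bounds are read off the syntax: recursion on ℓ
-- unfolds into nested loops before the machine runs, so that the degree of the polynomial depends
-- on ℓ alone.

open import Defs
open import Data.Bool.Base using (Bool; true; false; if_then_else_; not; _∧_; _∨_; _xor_)
open import Data.Bool.Properties using (¬-not) renaming (_≟_ to _≟ᵇ_)
open import Data.Fin.Base using (Fin; zero; suc; toℕ; _↑ˡ_; _↑ʳ_)
open import Data.Fin.Patterns using (0F; 1F; 2F; 3F; 4F; 5F; 6F; 7F)
open import Data.Fin.Properties using (+↔⊎; 1↔⊤; 2↔Bool; _≟_; toℕ≤n; toℕ<n; ↑ˡ-injective; suc-injective; toℕ-injective; injective⇒≤; any?; all?)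
open import Data.Fin.Subset using (Subset; ⁅_⁆; ∣_∣) renaming (⊥ to ∅; ⊤ to full-set)
open import Data.Fin.Subset.Properties using (∣p∣≤n; ∣⊥∣≡0; ∣⊤∣≡n; anySubset?)
open import Data.List.Base as List using (List; []; _∷_; _++_; _ʳ++_; length; concatMap; allFin)
open import Data.List.Membership.Propositional using (_∈_)
open import Data.List.Properties using (ʳ++-ʳ++; ʳ++-defn; reverse-map; length-reverse; ++-assoc; length-map; length-++; map-++; length-replicate; ++-ʳ++; length-tabulate; map-tabulate; ++-identityʳ)
open import Data.List.Relation.Unary.All using (All; []; _∷_)
open import Data.List.Relation.Unary.Any using (here; there)
open import Data.Maybe.Base using (Maybe; just; nothing)
open import Data.Nat.Base using (ℕ; zero; suc; _+_; _*_; _^_; _≤_; z≤n; s≤s; _<_; _⊔_; _!)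
open import Data.Nat.DivMod using (_/_; m*[n/m]≡n)
open import Data.Nat.Divisibility using (m≤n⇒m!∣n!; ∣-trans; m∣m*n)
open import Data.Nat.GeneralisedArithmetic using (iterate; fold)
open import Data.Nat.Properties using (≤-refl; ≤-trans; +-comm; +-assoc; *-identityˡ; *-identityʳ; m≤m+n; m≤n+m; +-mono-≤; *-mono-≤; n≤1+n; +-suc; ≤-reflexive; +-monoˡ-≤; +-monoʳ-≤; *-monoˡ-≤; m⊔n≤o⇒m≤o; m⊔n≤o⇒n≤o; *-monoʳ-≤; ^-distribˡ-+-*; *-distribʳ-+; ^-monoˡ-≤; m≤m*n; m^n≢0; [m*n]*[o*p]≡[m*o]*[n*p]; module ≤-Reasoning; m≤n⇒m<n∨m≡n; +-cancelʳ-≤; ≤-antisym; ≰⇒>; _≤?_; <-irrefl; +-cancelˡ-≤; +-cancelʳ-≡; *-zeroʳ; *-cancelʳ-≡; _!≢0; +-*-semiring; n≤0⇒n≡0) renaming (suc-injective to sucℕ-injective)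
open import Data.Nat.Solver using (module +-*-Solver)
open import Data.Product.Base using (Σ; ∃; ∃-syntax; _×_; _,_; proj₁; proj₂; map₁)
open import Data.Sum.Base as Sum using (_⊎_; inj₁; inj₂)
open import Data.Sum.Function.Propositional using (_⊎-↔_)
open import Data.Sum.Properties using (inj₁-injective; inj₂-injective)
open import Data.Unit.Base using (⊤; tt)
open import Data.Vec.Base as Vec using (Vec; []; _∷_; lookup; _[_]≔_; toList; tabulate)
open import Data.Vec.Properties using (lookup-map; lookup∘update; lookup∘update′; []≔-idempotent; []≔-commutes; []≔-lookup; length-toList; map-[]≔; lookup-++ˡ; lookup-++ʳ; lookup-replicate; zipWith-replicate; lookup∘tabulate; tabulate∘lookup; tabulate-cong; []=⇒lookup; lookup⇒[]=) renaming (map-replicate to mapᵥ-replicate)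
open import Function.Base using (_∘_; id; const)
open import Function.Bundles using (_↔_; mk↔ₛ′; _⇔_; mk⇔; module Equivalence)
open import Function.Construct.Composition using (_↔-∘_; _⇔-∘_)
open import Function.Construct.Symmetry using (↔-sym)
open import Function.Definitions using (Injective)
open import Relation.Binary.PropositionalEquality using (_≡_; _≢_; refl; sym; trans; cong; cong₂; subst; module ≡-Reasoning; ≢-sym)
open import Relation.Nullary.Decidable.Core using (Dec; yes; no; does; proof; _×-dec_; ¬?; _→-dec_; _⊎-dec_; _because_)
open import Relation.Nullary.Negation.Core using (contradiction; ¬_)
open import Relation.Nullary.Reflects using (Reflects; ofʸ; ofⁿ)
open import Algebra.Properties.Semiring.Sum +-*-semiring using (sum; sum-cong-≗; ∑-comm; *-distribˡ-sum; *-distribʳ-sum)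

-- Structured programs for Turing machines

-- `Prog K e` is a program for K tapes with e exits.
data Prog (K : ℕ) : ℕ → Set where
  prim : ∀ {e} → (Vec Symbol K → Fin e × Vec (Symbol × Move) K) → Prog K e
  bind : ∀ {e e′} → Prog K e → (Fin e → Prog K e′) → Prog K e′
  -- Exit 0 of the body restarts it.
  loop : ∀ {e} → Prog K (suc e) → Prog K e

module _ {K : ℕ} where

  -- Exits are not states: the transition that leaves one part of a program already enters the next.
  -- So `bind` is a disjoint sum, `loop` adds nothing, and composition costs no extra steps.
  St : ∀ {e} → Prog K e → Set
  St (prim _)         = ⊤
  St (bind {e} p q)   = St p ⊎ Σ (Fin e) λ i → St (q i)
  St (loop p)         = St p

  start : ∀ {e} (p : Prog K e) → St p
  start (prim _)   = tt
  start (bind p q) = inj₁ (start p)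
  start (loop p)   = start p

  enter : ∀ {e e′} (p : Prog K e) (q : Fin e → Prog K e′) → St p ⊎ Fin e → St (bind p q) ⊎ Fin e′
  enter p q (inj₁ s) = inj₁ (inj₁ s)
  enter p q (inj₂ i) = inj₁ (inj₂ (i , start (q i)))

  restart : ∀ {e} (p : Prog K (suc e)) → St p ⊎ Fin (suc e) → St p ⊎ Fin e
  restart p (inj₁ s)       = inj₁ s
  restart p (inj₂ zero)    = inj₁ (start p)
  restart p (inj₂ (suc i)) = inj₂ i

  tr : ∀ {e} (p : Prog K e) → St p → Vec Symbol K → (St p ⊎ Fin e) × Vec (Symbol × Move) K
  tr (prim f)   _              v = inj₂ (proj₁ (f v)) , proj₂ (f v)
  tr (bind p q) (inj₁ s)       v = map₁ (enter p q) (tr p s v)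
  tr (bind p q) (inj₂ (i , s)) v = map₁ (Sum.map₁ (inj₂ ∘ (i ,_))) (tr (q i) s v)
  tr (loop p)   s              v = map₁ (restart p) (tr p s v)

  apply : Vec (Symbol × Move) K → Vec Tape K → Vec Tape K
  apply = Vec.zipWith writeMove

  heads : Vec Tape K → Vec Symbol K
  heads = Vec.map Tape.head

  -- `Steps p s ts t i us`: from state s and tapes ts, p leaves through exit i
  -- with tapes us after at most t steps.
  data Steps {e} (p : Prog K e) : St p → Vec Tape K → ℕ → Fin e → Vec Tape K → Set where
    exit : ∀ {s ts t} i acts → tr p s (heads ts) ≡ (inj₂ i , acts) → Steps p s ts (suc t) i (apply acts ts)
    next : ∀ {s ts t i us} s′ acts → tr p s (heads ts) ≡ (inj₁ s′ , acts) →
           Steps p s′ (apply acts ts) t i us → Steps p s ts (suc t) i us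

  Runs : ∀ {e} → Prog K e → Vec Tape K → ℕ → Fin e → Vec Tape K → Set
  Runs p = Steps p (start p)

  weaken : ∀ {e} {p : Prog K e} {s ts t t′ i us} → t ≤ t′ → Steps p s ts t i us → Steps p s ts t′ i us
  weaken (s≤s _) (exit i acts eq)    = exit i acts eq
  weaken (s≤s l) (next s acts eq st) = next s acts eq (weaken l st)

  run-prim : ∀ {e} (f : Vec Symbol K → Fin e × Vec (Symbol × Move) K) {ts t} →
             Runs (prim f) ts (suc t) (proj₁ (f (heads ts))) (apply (proj₂ (f (heads ts))) ts)
  run-prim f = exit _ _ refl

  private
    inside : ∀ {e e′} (p : Prog K e) (q : Fin e → Prog K e′) {i s ts t j us} →
             Steps (q i) s ts t j us → Steps (bind p q) (inj₂ (i , s)) ts t j us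
    inside p q (exit j acts eq)     = exit j acts (cong (map₁ (Sum.map₁ λ s → inj₂ (_ , s))) eq)
    inside p q (next s′ acts eq st) = next _ acts (cong (map₁ (Sum.map₁ λ s → inj₂ (_ , s))) eq) (inside p q st)

  run-bind : ∀ {e e′} {p : Prog K e} {q : Fin e → Prog K e′} {ts t t′ i us j vs} →
             Runs p ts t i us → Runs (q i) us t′ j vs → Runs (bind p q) ts (t + t′) j vs
  run-bind {p = p} {q} {t′ = t′} {j = j} {vs} = go
    where
    go : ∀ {s ts t i us} → Steps p s ts t i us → Runs (q i) us t′ j vs → Steps (bind p q) (inj₁ s) ts (t + t′) j vs
    -- `exit` is charged `suc t` but takes a single step; the surplus t goes to the continuation.
    go {t = suc t} (exit i acts eq) r = next _ acts (cong (map₁ (enter p q)) eq) (weaken (m≤n+m t′ t) (inside p q r))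
    go (next s′ acts eq st)         r = next _ acts (cong (map₁ (enter p q)) eq) (go st r)

  run-again : ∀ {e} {p : Prog K (suc e)} {ts t t′ us j vs} →
              Runs p ts t zero us → Runs (loop p) us t′ j vs → Runs (loop p) ts (t + t′) j vs
  run-again {p = p} {t′ = t′} {j = j} {vs} = go
    where
    go : ∀ {s ts t us} → Steps p s ts t zero us → Runs (loop p) us t′ j vs → Steps (loop p) s ts (t + t′) j vs
    go {t = suc t} (exit i acts eq) r = next _ acts (cong (map₁ (restart p)) eq) (weaken (m≤n+m t′ t) r)
    go (next s′ acts eq st)         r = next _ acts (cong (map₁ (restart p)) eq) (go st r)

  run-break : ∀ {e} {p : Prog K (suc e)} {ts t i us} →
              Runs p ts t (suc i) us → Runs (loop p) ts t i us
  run-break {p = p} = go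
    where
    go : ∀ {s ts t i us} → Steps p s ts t (suc i) us → Steps (loop p) s ts t i us
    go (exit i acts eq)     = exit _ acts (cong (map₁ (restart p)) eq)
    go (next s′ acts eq st) = next _ acts (cong (map₁ (restart p)) eq) (go st)

-- Compilation of programs to Turing machines

Finite : Set → Set
Finite A = ∃[ n ] (A ↔ Fin n)

finite-⊎ : ∀ {A B} → Finite A → Finite B → Finite (A ⊎ B)
finite-⊎ (m , f) (n , g) = m + n , ↔-sym (+↔⊎ {m} {n}) ↔-∘ (f ⊎-↔ g)

finite-Σ : ∀ n {B : Fin n → Set} → (∀ i → Finite (B i)) → Finite (Σ (Fin n) B)
finite-Σ zero    _ = 0 , mk↔ₛ′ proj₁ (λ ()) (λ ()) λ ()
finite-Σ (suc n) {B} f =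
  let m , g = finite-⊎ (f zero) (finite-Σ n (f ∘ suc)) in m , g ↔-∘ mk↔ₛ′ split join split-join join-split
  where
  split : Σ (Fin (suc n)) B → B zero ⊎ Σ (Fin n) (B ∘ suc)
  split (zero , b)  = inj₁ b
  split (suc i , b) = inj₂ (i , b)
  join : B zero ⊎ Σ (Fin n) (B ∘ suc) → Σ (Fin (suc n)) B
  join (inj₁ b)       = zero , b
  join (inj₂ (i , b)) = suc i , b
  split-join : ∀ x → split (join x) ≡ x
  split-join (inj₁ _) = refl
  split-join (inj₂ _) = refl
  join-split : ∀ x → join (split x) ≡ x
  join-split (zero , _)  = refl
  join-split (suc _ , _) = refl

finite-St : ∀ {K e} (p : Prog K e) → Finite (St p)
finite-St (prim _)       = 1 , ↔-sym 1↔⊤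
finite-St (bind {e} p q) = finite-⊎ (finite-St p) (finite-Σ e λ i → finite-St (q i))
finite-St (loop p)       = finite-St p

pattern yes! = zero
pattern no!  = suc zero

answer : Fin 2 → Bool
answer yes! = true
answer no!  = false

module _ {k : ℕ} (p : Prog (suc k) 2) where

  private
    Q : Set
    Q = St p ⊎ Bool

    halt : St p ⊎ Fin 2 → Q
    halt = Sum.map₂ answer

    δ : Q → Vec Symbol (suc k) → Q × Vec (Symbol × Move) (suc k)
    δ (inj₁ s) v = map₁ halt (tr p s v)
    δ (inj₂ b) v = inj₂ b , Vec.map (_, stay) v

    verdict : Q → Maybe Bool
    verdict (inj₁ _) = nothing
    verdict (inj₂ b) = just b

  machine : TuringMachine
  machine = record
    { k       = k
    ; State   = Q
    ; finite  = finite-⊎ (finite-St p) (2 , ↔-sym 2↔Bool)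
    ; start   = inj₁ (start p)
    ; verdict = verdict
    ; δ       = δ
    }

  open TuringMachine machine using (step; answerWithin; initial)

  private
    -- A run bounds the time only from above, whereas `answerWithin` iterates exactly that often;
    -- the surplus iterations are idle because a configuration with a verdict no longer changes.
    halted : ∀ b ts t → iterate step (inj₂ b , ts) t ≡ (inj₂ b , ts)
    halted b ts zero    = refl
    halted b ts (suc t) = halted b ts t

    simulate : ∀ {s ts t i us} → Steps p s ts t i us → iterate step (inj₁ s , ts) t ≡ (inj₂ (answer i) , us)
    simulate {s} {ts} {suc t} (exit i acts eq)     rewrite eq = halted (answer i) _ t
    simulate {s} {ts} {suc t} (next s′ acts eq st) rewrite eq = simulate st

  machine-answer : ∀ {w t i us} → Runs p (fromWord w ∷ Vec.replicate k (fromWord [])) t i us →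
                   answerWithin t w ≡ just (answer i)
  machine-answer r = cong (verdict ∘ proj₁) (simulate r)

-- Scanning tapes

private variable
  K e e′ : ℕ

to : ∀ {p : Prog K e} {ts us vs t i} → us ≡ vs → Runs p ts t i us → Runs p ts t i vs
to refl r = r

starting : ∀ {p : Prog K e} {ts us vs t i} → ts ≡ us → Runs p ts t i vs → Runs p us t i vs
starting refl r = r

infixr 5 _▸_

_▸_ : Prog K (suc e) → Prog K e′ → Prog K e′
p ▸ q = bind p (const q)

done : Fin e → Prog K e
done i = prim λ v → i , Vec.map (_, stay) v

on : Fin K → (Symbol → Fin e × Symbol × Move) → Prog K e
on τ g = prim λ v → proj₁ (g (lookup v τ)) , Vec.map (_, stay) v [ τ ]≔ proj₂ (g (lookup v τ))

nudge : Fin K → Move → Prog K 1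
nudge τ m = on τ λ a → zero , a , m

apply-stay : (ts : Vec Tape K) → apply (Vec.map (_, stay) (heads ts)) ts ≡ ts
apply-stay []       = refl
apply-stay (t ∷ ts) = cong (t ∷_) (apply-stay ts)

apply-one : ∀ τ x (ts : Vec Tape K) →
            apply (Vec.map (_, stay) (heads ts) [ τ ]≔ x) ts ≡ ts [ τ ]≔ writeMove x (lookup ts τ)
apply-one zero    x (t ∷ ts) = cong (writeMove x t ∷_) (apply-stay ts)
apply-one (suc τ) x (t ∷ ts) = cong (t ∷_) (apply-one τ x ts)

run-done : ∀ {i : Fin e} {ts : Vec Tape K} → Runs (done i) ts 1 i ts
run-done {i = i} {ts} = subst (Runs (done i) ts 1 i) (apply-stay ts) (run-prim _)

run-on : ∀ {τ} (g : Symbol → Fin e × Symbol × Move) {ts : Vec Tape K} {t i x} →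
         lookup ts τ ≡ t → g (Tape.head t) ≡ (i , x) → Runs (on τ g) ts 1 i (ts [ τ ]≔ writeMove x t)
run-on {τ = τ} g {ts} refl eq = helper (trans (cong g (lookup-map τ Tape.head ts)) eq)
  where
  helper : ∀ {i x} → g (lookup (heads ts) τ) ≡ (i , x) → Runs (on τ g) ts 1 i (ts [ τ ]≔ writeMove x (lookup ts τ))
  helper {i} {x} eq′ = subst (Runs (on τ g) ts 1 i) (apply-one τ x ts)
    (exit i (Vec.map (_, stay) (heads ts) [ τ ]≔ x)
      (cong (λ (j , y) → inj₂ j , Vec.map (_, stay) (heads ts) [ τ ]≔ y) eq′))

run-nudge : ∀ {τ m} {ts : Vec Tape K} {t} → lookup ts τ ≡ t → Runs (nudge τ m) ts 1 zero (ts [ τ ]≔ move m t)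
run-nudge eq = run-on _ eq refl

pass : Bool → Symbol → Fin 2 × Symbol × Move
pass b a = if b then (yes! , a , right) else (no! , a , stay)

along : Fin K → (Symbol → Bool) → Prog K 1 → Prog K 1
along τ while p = loop (bind (on τ λ a → pass (while a) a) λ { yes! → p ▸ done yes! ; no! → done no! })

-- The tape given by the word that starts under its head. It absorbs the case distinction that
-- `move right` makes at the end of the list.
from : List Symbol → List Symbol → Tape
from L []      = tape L nothing []
from L (x ∷ R) = tape L x R

move-right : ∀ L x R → move right (tape L x R) ≡ from (x ∷ L) R
move-right L x []      = refl
move-right L x (_ ∷ _) = refl

shift : ℕ → Tape → Tape
shift k t = fold t (move right) k

shift-+ : ∀ j k t → shift (j + k) t ≡ shift j (shift k t)
shift-+ zero    k t = refl
shift-+ (suc j) k t = cong (move right) (shift-+ j k t)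

shift-move : ∀ k t → shift k (move right t) ≡ shift (suc k) t
shift-move k t = trans (sym (shift-+ k 1 t)) (cong (λ m → shift m t) (+-comm k 1))

shift-from : ∀ xs L y R → shift (length xs) (from L (xs ++ y ∷ R)) ≡ tape (xs ʳ++ L) y R
shift-from []       L y R = refl
shift-from (x ∷ xs) L y R = begin
  shift (suc (length xs)) (tape L x (xs ++ y ∷ R))       ≡⟨ shift-move (length xs) _ ⟨
  shift (length xs) (move right (tape L x (xs ++ y ∷ R))) ≡⟨ cong (shift (length xs)) (move-right L x _) ⟩
  shift (length xs) (from (x ∷ L) (xs ++ y ∷ R))          ≡⟨ shift-from xs (x ∷ L) y R ⟩
  tape (xs ʳ++ x ∷ L) y R                                 ∎
  where open ≡-Reasoning

update-twice : ∀ (ts : Vec Tape K) τ {t u} → (ts [ τ ]≔ t) [ τ ]≔ u ≡ ts [ τ ]≔ u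
update-twice ts τ = []≔-idempotent ts τ

update-same : ∀ {ts : Vec Tape K} {τ t} → lookup ts τ ≡ t → ts [ τ ]≔ t ≡ ts
update-same {ts = ts} {τ} refl = []≔-lookup ts τ

-- `Φ k` describes the other tapes after k passes. The body has to work for every content t of tape
-- τ, so the head of τ keeps its place while the body runs. A pass costs the guard, the body and the
-- `done` that restarts the loop, hence `2 + T`.
run-along : ∀ {τ} {while : Symbol → Bool} {p : Prog K 1} {T} (Φ : ℕ → Vec Tape K) xs {L y R} →
            All (λ x → while x ≡ true) xs → while y ≡ false →
            (∀ k → k < length xs → ∀ t → Runs p (Φ k [ τ ]≔ t) T zero (Φ (suc k) [ τ ]≔ t)) →
            Runs (along τ while p) (Φ 0 [ τ ]≔ from L (xs ++ y ∷ R)) (suc (length xs) * (2 + T)) zero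
              (Φ (length xs) [ τ ]≔ tape (xs ʳ++ L) y R)
run-along {K = K} {τ = τ} {while} {p} {T} Φ [] {L} {y} {R} [] stop body =
  weaken (s≤s (s≤s z≤n))
    (run-break (run-bind (to (update-twice (Φ 0) τ) (run-on (λ a → pass (while a) a) (lookup∘update τ (Φ 0) _) eq)) run-done))
  where
  eq : pass (while y) y ≡ (no! , y , stay)
  eq = cong (λ b → pass b y) stop
run-along {K = K} {τ = τ} {while} {p} {T} Φ (x ∷ xs) {L} {y} {R} (ok ∷ oks) stop body =
  weaken (≤-reflexive (cong (λ m → suc m + suc (length xs) * (2 + T)) (+-comm T 1))) (run-again
    (run-bind (to step (run-on (λ a → pass (while a) a) (lookup∘update τ (Φ 0) _) eq))
      (run-bind (body 0 (s≤s z≤n) _) run-done))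
    (run-along (Φ ∘ suc) xs oks stop λ k lt → body (suc k) (s≤s lt)))
  where
  eq : pass (while x) x ≡ (yes! , x , right)
  eq = cong (λ b → pass b x) ok
  step : (Φ 0 [ τ ]≔ tape L x (xs ++ y ∷ R)) [ τ ]≔ move right (tape L x (xs ++ y ∷ R))
         ≡ Φ 0 [ τ ]≔ from (x ∷ L) (xs ++ y ∷ R)
  step = trans (update-twice (Φ 0) τ) (cong (Φ 0 [ τ ]≔_) (move-right L x _))

bits : List Bool → List Symbol
bits = List.map just

retreat : Symbol → Fin 2 × Symbol × Move
retreat (just b) = yes! , just b , left
retreat nothing  = no! , nothing , stay

-- The first step left is unconditional, so that `rewind` can start on any cell, even on the blank
-- behind a word; from then on the nearest blank marks the beginning.
rewind : Fin K → Prog K 1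
rewind τ = nudge τ left ▸ loop (on τ retreat)

-- `onto ls R` has the word ls, read from right to left, under and to the left of its head.
onto : List Symbol → List Symbol → Tape
onto []       R = tape [] nothing R
onto (a ∷ ls) R = tape ls a R

move-left : ∀ ls x R → move left (tape ls x R) ≡ onto ls (x ∷ R)
move-left []      x R = refl
move-left (_ ∷ _) x R = refl

run-retreat : ∀ {τ} (ts : Vec Tape K) bs {L} R →
  Runs (loop (on τ retreat)) (ts [ τ ]≔ onto (bits bs ++ nothing ∷ L) R) (suc (length bs)) zero
    (ts [ τ ]≔ tape L nothing (bits bs ʳ++ R))
run-retreat {τ = τ} ts [] R =
  run-break (to (update-twice ts τ) (run-on retreat (lookup∘update τ ts _) refl))
run-retreat {τ = τ} ts (b ∷ bs) R =
  run-again
    (to (trans (update-twice ts τ) (cong (ts [ τ ]≔_) (move-left (bits bs ++ _) (just b) R)))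
      (run-on retreat (lookup∘update τ ts _) refl))
    (run-retreat ts bs (just b ∷ R))

bits-ʳ++ : ∀ bs {ys} → bits bs ʳ++ ys ≡ bits (bs ʳ++ []) ++ ys
bits-ʳ++ bs {ys} = begin
  bits bs ʳ++ ys           ≡⟨ ʳ++-defn (bits bs) ⟩
  List.reverse (bits bs) ++ ys ≡⟨ cong (_++ ys) (reverse-map just bs) ⟨
  bits (List.reverse bs) ++ ys ∎
  where open ≡-Reasoning

run-rewind : ∀ {τ} {ts : Vec Tape K} bs {L x R} → lookup ts τ ≡ tape (bits bs ʳ++ nothing ∷ L) x R →
             Runs (rewind τ) ts (2 + length bs) zero (ts [ τ ]≔ tape L nothing (bits bs ++ x ∷ R))
run-rewind {K = K} {τ = τ} {ts} bs {L} {x} {R} at =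
  weaken (≤-reflexive (cong (2 +_) (length-reverse bs)))
    (run-bind
      (to (cong (ts [ τ ]≔_) left-eq) (run-nudge at))
      (to (cong (λ R → ts [ τ ]≔ tape L nothing R) right-eq)
        (run-retreat ts (List.reverse bs) (x ∷ R))))
  where
  left-eq : move left (tape (bits bs ʳ++ nothing ∷ L) x R) ≡ onto (bits (List.reverse bs) ++ nothing ∷ L) (x ∷ R)
  left-eq = trans (move-left (bits bs ʳ++ nothing ∷ L) x R) (cong (λ l → onto l (x ∷ R)) (bits-ʳ++ bs))
  right-eq : bits (List.reverse bs) ʳ++ x ∷ R ≡ bits bs ++ x ∷ R
  right-eq = begin
    bits (List.reverse bs) ʳ++ x ∷ R   ≡⟨ cong (_ʳ++ x ∷ R) (reverse-map just bs) ⟩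
    List.reverse (bits bs) ʳ++ x ∷ R   ≡⟨ ʳ++-ʳ++ (bits bs) ⟩
    bits bs ++ x ∷ R                   ∎
    where open ≡-Reasoning

-- A word is stored behind a blank cell, on which the head rests.
home : List Bool → Tape
home bs = tape [] nothing (bits bs ++ nothing ∷ [])

bits-++ : ∀ bs cs ys → bits (bs ++ cs) ++ ys ≡ bits bs ++ bits cs ++ ys
bits-++ bs cs ys = trans (cong (_++ ys) (map-++ just bs cs)) (++-assoc (bits bs) (bits cs) ys)

home-++ : ∀ bs c cs → tape [] nothing (bits bs ++ just c ∷ bits cs ++ nothing ∷ []) ≡ home (bs ++ c ∷ cs)
home-++ bs c cs = cong (tape [] nothing) (sym (bits-++ bs (c ∷ cs) _))

shift-to : ∀ {L} bs c {R} → shift (suc (length bs)) (tape L nothing (bits bs ++ just c ∷ R)) ≡ tape (bits bs ʳ++ nothing ∷ L) (just c) R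
shift-to {L} bs c {R} = begin
  shift (suc (length bs)) t₀                              ≡⟨ shift-move (length bs) t₀ ⟨
  shift (length bs) (move right t₀)                       ≡⟨ cong (shift (length bs)) (move-right L nothing _) ⟩
  shift (length bs) (from (nothing ∷ L) (bits bs ++ just c ∷ R))
    ≡⟨ cong (λ m → shift m (from (nothing ∷ L) (bits bs ++ just c ∷ R))) (length-map just bs) ⟨
  shift (length (bits bs)) (from (nothing ∷ L) (bits bs ++ just c ∷ R)) ≡⟨ shift-from (bits bs) (nothing ∷ L) (just c) R ⟩
  tape (bits bs ʳ++ nothing ∷ L) (just c) R               ∎
  where
  open ≡-Reasoning
  t₀ = tape L nothing (bits bs ++ just c ∷ R)

-- Two-tape states are kept in the form `(ts [ X ]≔ a) [ x ]≔ b`.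
module _ {x X : Fin K} (x≢X : x ≢ X) (ts : Vec Tape K) where

  lookup-inner : ∀ {a b} → lookup ((ts [ X ]≔ a) [ x ]≔ b) X ≡ a
  lookup-inner {a} {b} = trans (lookup∘update′ (≢-sym x≢X) (ts [ X ]≔ a) b) (lookup∘update X ts a)

  update-inner : ∀ {a b a′} → ((ts [ X ]≔ a) [ x ]≔ b) [ X ]≔ a′ ≡ (ts [ X ]≔ a′) [ x ]≔ b
  update-inner {a} {b} {a′} = trans ([]≔-commutes (ts [ X ]≔ a) x X x≢X) (cong (_[ x ]≔ b) (update-twice ts X))

  update-undo : ∀ {a b} → lookup ts x ≡ b → (ts [ X ]≔ a) [ x ]≔ b ≡ ts [ X ]≔ a
  update-undo {a} {b} at = update-same (trans (lookup∘update′ x≢X ts a) at)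

-- Addressing cells by vertices

isFalse : Symbol → Bool
isFalse (just false) = true
isFalse _            = false

isBit : Symbol → Bool
isBit (just _) = true
isBit nothing  = false

oneHot : ℕ → List Bool → List Bool
oneHot p us = List.replicate p false ++ true ∷ us

falses : ℕ → List Bool
falses p = List.replicate p false

-- Running p once for each zero ahead of the mark turns the position of a vertex into a repetition
-- count, without any arithmetic on the machine.
seek : Fin K → Prog K 1 → Prog K 1
seek x p = nudge x right ▸ along x isFalse p

seekTime : ℕ → ℕ → ℕ
seekTime N T = 1 + suc N * (2 + T)

sought : ℕ → List Bool → Tape
sought p us = tape (bits (falses p) ʳ++ nothing ∷ []) (just true) (bits us ++ nothing ∷ [])

all-false : ∀ p → All (λ a → isFalse a ≡ true) (bits (falses p))
all-false zero    = []
all-false (suc p) = refl ∷ all-false p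

length-falses : ∀ p → length (bits (falses p)) ≡ p
length-falses p = trans (length-map just (falses p)) (length-replicate p)

run-seek : ∀ {x} {p : Prog K 1} {T} {N} (Φ : ℕ → Vec Tape K) q us → q ≤ N →
           (∀ k t → Runs p (Φ k [ x ]≔ t) T zero (Φ (suc k) [ x ]≔ t)) →
           Runs (seek x p) (Φ 0 [ x ]≔ home (oneHot q us)) (seekTime N T) zero (Φ q [ x ]≔ sought q us)
run-seek {x = x} {p} {T} {N} Φ q us q≤N body =
  run-bind {t = 1}
    (to (trans (update-twice (Φ 0) x) (cong (Φ 0 [ x ]≔_) first)) (run-nudge (lookup∘update x (Φ 0) _)))
    (weaken (*-monoˡ-≤ (2 + T) (s≤s q≤N))
      (subst (λ m → Runs (along x isFalse p) (Φ 0 [ x ]≔ from (nothing ∷ []) (bits (falses q) ++ just true ∷ bits us ++ nothing ∷ []))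
                 (suc m * (2 + T)) zero (Φ m [ x ]≔ sought q us)) (length-falses q)
        (run-along Φ (bits (falses q)) (all-false q) refl λ k _ → body k)))
  where
  first : move right (home (oneHot q us)) ≡ from (nothing ∷ []) (bits (falses q) ++ just true ∷ bits us ++ nothing ∷ [])
  first = trans (move-right [] nothing _) (cong (from _) (bits-++ (falses q) (true ∷ us) _))

rewindTime : ℕ → ℕ
rewindTime N = 2 + N

run-home : ∀ {τ} {ts : Vec Tape K} {N} bs {b} cs → length bs ≤ N →
           lookup ts τ ≡ tape (bits bs ʳ++ nothing ∷ []) (just b) (bits cs ++ nothing ∷ []) →
           Runs (rewind τ) ts (rewindTime N) zero (ts [ τ ]≔ home (bs ++ b ∷ cs))
run-home {τ = τ} {ts} bs {b} cs le at =
  weaken (s≤s (s≤s le))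
    (to (cong (ts [ τ ]≔_) (home-++ bs b cs)) (run-rewind bs at))

run-unseek : ∀ {x} {ts : Vec Tape K} {N} q us → q ≤ N → lookup ts x ≡ sought q us →
             Runs (rewind x) ts (rewindTime N) zero (ts [ x ]≔ home (oneHot q us))
run-unseek q us q≤N at = run-home (falses q) us (≤-trans (≤-reflexive (length-replicate q)) q≤N) at

-- X keeps pace while x is walked to its mark, so its head stops at the cell indexed by the vertex
-- on x. As g chooses both the exit and the symbol written, one program serves for reading and
-- writing.
access : Fin K → Fin K → (Symbol → Fin e × Symbol) → Prog K e
access x X g =
  nudge X right ▸ seek x (nudge X right) ▸ bind (on X λ a → proj₁ (g a) , proj₂ (g a) , stay) λ i →
  rewind X ▸ rewind x ▸ done i

accessTime : ℕ → ℕ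
accessTime N = 1 + (seekTime N 1 + (1 + (rewindTime N + (rewindTime N + 1))))

run-access : ∀ {x X} (g : Symbol → Fin e × Symbol) {ts : Vec Tape K} {N} us bs {c} cs {i c′} → x ≢ X →
             length bs ≤ N →
             lookup ts x ≡ home (oneHot (length bs) us) →
             lookup ts X ≡ home (bs ++ c ∷ cs) →
             g (just c) ≡ (i , just c′) →
             Runs (access x X g) ts (accessTime N) i (ts [ X ]≔ home (bs ++ c′ ∷ cs))
run-access {K = K} {x = x} {X} g {ts} us bs {c} cs {i} {c′} x≢X le atx atX geq =
  run-bind {t = 1} (to (sym (update-undo x≢X ts atx)) (run-nudge atX))
  (run-bind (run-seek Φ q us le body)
  (run-bind (to (update-inner x≢X ts)
     (run-on (λ a → proj₁ (g a) , proj₂ (g a) , stay) (trans (lookup-inner x≢X ts) atc) (cong (λ (j , b) → j , b , stay) geq)))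
  (run-bind (to (update-inner x≢X ts) (run-home bs cs le (lookup-inner x≢X ts)))
  (run-bind (to (trans (update-twice (ts [ X ]≔ _) x) (update-undo x≢X ts atx))
     (run-unseek q us le (lookup∘update x (ts [ X ]≔ home _) (sought q us))))
  run-done))))
  where
  q = length bs
  Φ : ℕ → Vec Tape K
  Φ k = ts [ X ]≔ shift (suc k) (home (bs ++ c ∷ cs))
  body : ∀ k t → Runs (nudge X right) (Φ k [ x ]≔ t) 1 zero (Φ (suc k) [ x ]≔ t)
  body k t = to (update-inner x≢X ts) (run-nudge (lookup-inner x≢X ts))
  atc : shift (suc q) (home (bs ++ c ∷ cs)) ≡ tape (bits bs ʳ++ nothing ∷ []) (just c) (bits cs ++ nothing ∷ [])
  atc = trans (cong (shift (suc q)) (sym (home-++ bs c cs))) (shift-to bs c)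

-- R acts as a ruler: whatever its bits are, the body runs once per cell, thus n times if R stores a
-- set of vertices.
sweep : Fin K → Prog K 1 → Prog K 1
sweep R p = nudge R right ▸ along R isBit p ▸ rewind R

sweepTime : ℕ → ℕ → ℕ
sweepTime N T = 1 + (suc N * (2 + T) + rewindTime N)

all-bits : ∀ bs → All (λ a → isBit a ≡ true) (bits bs)
all-bits []       = []
all-bits (b ∷ bs) = refl ∷ all-bits bs

run-sweep : ∀ {R} {p : Prog K 1} {T} (Φ : ℕ → Vec Tape K) bs →
            (∀ k → lookup (Φ k) R ≡ home bs) →
            (∀ k t → Runs p (Φ k [ R ]≔ t) T zero (Φ (suc k) [ R ]≔ t)) →
            Runs (sweep R p) (Φ 0) (sweepTime (length bs) T) zero (Φ (length bs))
run-sweep {R = R} {p} {T} Φ bs at body =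
  run-bind {t = 1} (to (cong (Φ 0 [ R ]≔_) (move-right [] nothing _)) (run-nudge (at 0)))
  (run-bind
    (subst (λ m → Runs (along R isBit p) (Φ 0 [ R ]≔ from (nothing ∷ []) (bits bs ++ nothing ∷ []))
               (suc m * (2 + T)) zero (Φ m [ R ]≔ tape (bits bs ʳ++ nothing ∷ []) nothing [])) (length-map just bs)
      (run-along Φ (bits bs) (all-bits bs) refl λ k _ → body k))
    (to (trans (update-twice (Φ (length bs)) R) (update-same (at (length bs))))
      (run-rewind bs (lookup∘update R (Φ (length bs)) _))))

test : Symbol → Fin 2
test (just true) = yes!
test _           = no!

-- Row-major addressing: each zero ahead of the mark on x advances ι by a whole row, measured out on
-- R, and each one on y advances it by one cell. The two walks happen one after the other, so x and
-- y may be the same tape.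
entry : Fin K → Fin K → Fin K → Fin K → Prog K 2
entry ι x y R =
  nudge ι right ▸ seek x (sweep R (nudge ι right)) ▸ rewind x ▸
  seek y (nudge ι right) ▸ rewind y ▸
  bind (on ι λ a → test a , a , stay) λ i → rewind ι ▸ done i

entryTime : ℕ → ℕ
entryTime n =
  1 + (seekTime n (sweepTime n 1) + (rewindTime n + (seekTime n 1 + (rewindTime n + (1 + (rewindTime (n + n * n) + 1))))))

bit : Bool → Fin 2
bit true  = yes!
bit false = no!

run-entry : ∀ {ι x y R} {ts : Vec Tape K} {n} us vs rs bs {c cs L} p q → x ≢ ι → y ≢ ι → R ≢ ι → R ≢ x →
            p ≤ n → q ≤ n → length bs ≡ q + p * n → length rs ≡ n →
            lookup ts x ≡ home (oneHot p us) →
            lookup ts y ≡ home (oneHot q vs) →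
            lookup ts R ≡ home rs →
            lookup ts ι ≡ tape L nothing (bits bs ++ just c ∷ cs) →
            Runs (entry ι x y R) ts (entryTime n) (bit c) ts
run-entry {K = K} {ι = ι} {x} {y} {R} {ts} {n} us vs rs bs {c} {cs} {L} p q x≢ι y≢ι R≢ι R≢x p≤n q≤n len refl atx aty atR atι =
  run-bind {t = 1} (to (sym (update-undo x≢ι ts atx)) (run-nudge atι))
  (run-bind (run-seek Φ p us p≤n body)
  (run-bind (to (trans (update-twice (Φ p) x) (update-undo x≢ι ts atx))
     (run-unseek p us p≤n (lookup∘update x (Φ p) _)))
  (run-bind (starting (update-undo y≢ι ts aty) (run-seek Ψ q vs q≤n step))
  (run-bind (to (trans (update-twice (Ψ q) y) (update-undo y≢ι ts aty))
     (run-unseek q vs q≤n (lookup∘update y (Ψ q) _)))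
  (run-bind (to (update-twice ts ι) (run-on (λ a → test a , a , stay) atc (cong (λ i → i , just c , stay) (test-bit c))))
  (run-bind (weaken (s≤s (s≤s (≤-trans (≤-reflexive len) (+-mono-≤ q≤n (*-monoˡ-≤ n p≤n)))))
     (to (trans (update-twice ts ι) (update-same atι)) (run-rewind bs (lookup∘update ι ts _))))
  run-done))))))
  where
  m₁ : Tape
  m₁ = move right (tape L nothing (bits bs ++ just c ∷ cs))
  Φ Ψ : ℕ → Vec Tape K
  Φ k = ts [ ι ]≔ shift (k * n) m₁
  Ψ k = ts [ ι ]≔ shift (k + p * n) m₁
  step : ∀ k t → Runs (nudge ι right) (Ψ k [ y ]≔ t) 1 zero (Ψ (suc k) [ y ]≔ t)
  step k t = to (update-inner y≢ι ts) (run-nudge (lookup-inner y≢ι ts))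
  body : ∀ k t → Runs (sweep R (nudge ι right)) (Φ k [ x ]≔ t) (sweepTime n 1) zero (Φ (suc k) [ x ]≔ t)
  body k t = to (cong (λ m → (ts [ ι ]≔ m) [ x ]≔ t) (sym (shift-+ n (k * n) m₁)))
    (run-sweep X rs (λ j → trans (lookup∘update′ R≢x (ts [ ι ]≔ _) t) (trans (lookup∘update′ R≢ι ts _) atR)) inner)
    where
    X : ℕ → Vec Tape K
    X j = (ts [ ι ]≔ shift j (shift (k * n) m₁)) [ x ]≔ t
    inner : ∀ j s → Runs (nudge ι right) (X j [ R ]≔ s) 1 zero (X (suc j) [ R ]≔ s)
    inner j s = subst (Runs _ _ 1 zero)
      (trans ([]≔-commutes (X j) R ι R≢ι) (cong (_[ R ]≔ s) (update-inner x≢ι ts)))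
      (run-nudge (trans (lookup∘update′ (≢-sym R≢ι) (X j) s) (lookup-inner x≢ι ts)))
  test-bit : ∀ c → test (just c) ≡ bit c
  test-bit true  = refl
  test-bit false = refl
  atc : lookup (Ψ q) ι ≡ tape (bits bs ʳ++ nothing ∷ L) (just c) cs
  atc = begin
    lookup (Ψ q) ι                    ≡⟨ lookup∘update ι ts _ ⟩
    shift (q + p * n) m₁              ≡⟨ cong (λ j → shift j m₁) len ⟨
    shift (length bs) m₁              ≡⟨ shift-move (length bs) _ ⟩
    shift (suc (length bs)) (tape L nothing (bits bs ++ just c ∷ cs)) ≡⟨ shift-to bs c ⟩
    tape (bits bs ʳ++ nothing ∷ L) (just c) cs ∎
    where open ≡-Reasoning

-- Loops over the vertices

raise : Symbol → Fin 2 × Symbol × Move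
raise (just _) = yes! , just true , stay
raise nothing  = no! , nothing , stay

-- Hitting the blank behind the word means that no vertex is left. This is how a loop notices its
-- end, without a stored vertex count.
mark : Fin K → Prog K 2
mark x = bind (on x raise) λ i → rewind x ▸ done i

markTime : ℕ → ℕ
markTime N = 1 + (rewindTime N + 1)

run-mark-yes : ∀ {x} {ts : Vec Tape K} {N} bs b us → length bs ≤ N →
               lookup ts x ≡ tape (bits bs ʳ++ nothing ∷ []) (just b) (bits us ++ nothing ∷ []) →
               Runs (mark x) ts (markTime N) yes! (ts [ x ]≔ home (bs ++ true ∷ us))
run-mark-yes {x = x} {ts} bs b us le at =
  run-bind (run-on raise at refl)
  (run-bind (to (update-twice ts x) (run-home bs us le (lookup∘update x ts _))) run-done)

run-mark-no : ∀ {x} {ts : Vec Tape K} {N} bs → length bs ≤ N →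
              lookup ts x ≡ tape (bits bs ʳ++ nothing ∷ []) nothing [] →
              Runs (mark x) ts (markTime N) no! (ts [ x ]≔ home bs)
run-mark-no {x = x} {ts} bs le at =
  run-bind (run-on raise at refl)
  (run-bind (weaken (s≤s (s≤s le)) (to (update-twice ts x) (run-rewind bs (lookup∘update x ts _)))) run-done)

markFirst : Fin K → Prog K 2
markFirst x = nudge x right ▸ mark x

run-markFirst-yes : ∀ {x} {ts : Vec Tape K} {N} b us → lookup ts x ≡ home (b ∷ us) →
                Runs (markFirst x) ts (1 + markTime N) yes! (ts [ x ]≔ home (true ∷ us))
run-markFirst-yes {x = x} {ts} b us at =
  run-bind (run-nudge at) (to (update-twice ts x) (run-mark-yes [] b us z≤n (lookup∘update x ts _)))

run-markFirst-no : ∀ {x} {ts : Vec Tape K} {N} → lookup ts x ≡ home [] →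
               Runs (markFirst x) ts (1 + markTime N) no! ts
run-markFirst-no {x = x} {ts} at =
  run-bind (run-nudge at) (to (trans (update-twice ts x) (update-same at)) (run-mark-no [] z≤n (lookup∘update x ts _)))

find : Fin K → Prog K 1
find x = seek x (done zero)

run-find : ∀ {x} {ts : Vec Tape K} {N} q us → q ≤ N → lookup ts x ≡ home (oneHot q us) →
           Runs (find x) ts (seekTime N 1) zero (ts [ x ]≔ sought q us)
run-find {x = x} {ts} q us q≤N at =
  starting (update-same at) (run-seek (const ts) q us q≤N λ _ _ → run-done)

advance : Fin K → Prog K 2
advance x = find x ▸ on x (λ _ → zero {0} , just false , right) ▸ mark x

stepTime : ℕ → ℕ
stepTime N = seekTime N 1 + (1 + markTime N)

extend-falses : ∀ q {ys} → bits (falses q ++ false ∷ []) ʳ++ ys ≡ just false ∷ (bits (falses q) ʳ++ ys)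
extend-falses q {ys} = begin
  bits (falses q ++ false ∷ []) ʳ++ ys           ≡⟨ cong (_ʳ++ ys) (map-++ just (falses q) _) ⟩
  (bits (falses q) ++ just false ∷ []) ʳ++ ys    ≡⟨ ++-ʳ++ (bits (falses q)) ⟩
  just false ∷ (bits (falses q) ʳ++ ys)          ∎
  where open ≡-Reasoning

length-extend-falses : ∀ q → length (falses q ++ false ∷ []) ≡ suc q
length-extend-falses q = trans (length-++ (falses q)) (trans (+-comm _ 1) (cong suc (length-replicate q)))

run-advance-yes : ∀ {x} {ts : Vec Tape K} {N} q b us → suc q ≤ N → lookup ts x ≡ home (oneHot q (b ∷ us)) →
                  Runs (advance x) ts (stepTime N) yes! (ts [ x ]≔ home (falses q ++ false ∷ true ∷ us))
run-advance-yes {x = x} {ts} q b us lt at =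
  run-bind (run-find q (b ∷ us) (≤-trans (n≤1+n q) lt) at)
  (run-bind (to (update-twice ts x) (run-on (λ _ → zero , just false , right) (lookup∘update x ts _) refl))
    (to (trans (update-twice ts x) (cong (λ w → ts [ x ]≔ home w) (++-assoc (falses q) (false ∷ []) (true ∷ us))))
      (run-mark-yes (falses q ++ false ∷ []) b us (≤-trans (≤-reflexive (length-extend-falses q)) lt)
        (trans (lookup∘update x ts _) (cong (λ L → tape L (just b) _) (sym (extend-falses q)))))))

run-advance-no : ∀ {x} {ts : Vec Tape K} {N} q → suc q ≤ N → lookup ts x ≡ home (oneHot q []) →
                 Runs (advance x) ts (stepTime N) no! (ts [ x ]≔ home (falses q ++ false ∷ []))
run-advance-no {x = x} {ts} q lt at =
  run-bind (run-find q [] (≤-trans (n≤1+n q) lt) at)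
  (run-bind (to (update-twice ts x) (run-on (λ _ → zero , just false , right) (lookup∘update x ts _) refl))
    (to (update-twice ts x)
      (run-mark-no (falses q ++ false ∷ []) (≤-trans (≤-reflexive (length-extend-falses q)) lt)
        (trans (lookup∘update x ts _) (cong (λ L → tape L nothing []) (sym (extend-falses q)))))))

clear : Fin K → Prog K e′ → Prog K e′
clear x p = find x ▸ on x (λ _ → zero {0} , just false , stay) ▸ rewind x ▸ p

run-clear : ∀ {x} {p : Prog K e} {ts : Vec Tape K} {N t i us} q vs → q ≤ N → lookup ts x ≡ home (oneHot q vs) →
            Runs p (ts [ x ]≔ home (falses q ++ false ∷ vs)) t i us →
            Runs (clear x p) ts (seekTime N 1 + (1 + (rewindTime N + t))) i us
run-clear {x = x} {ts = ts} q vs le at r =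
  run-bind (run-find q vs le at)
  (run-bind (to (update-twice ts x) (run-on (λ _ → zero , just false , stay) (lookup∘update x ts _) refl))
  (run-bind (to (update-twice ts x)
    (run-home (falses q) vs (≤-trans (≤-reflexive (length-replicate q)) le) (lookup∘update x ts _))) r))

-- Exit 0 restarts the loop, and exits 1 and 2 become its answers yes and no. On both ways out the
-- tape x is all zeros again and can be reused by another loop.
iteration : Fin K → Prog K 2 → Prog K 3
iteration x p = bind p λ
  { yes! → bind (advance x) λ { yes! → done zero ; no! → done (suc zero) }
  ; no!  → clear x (done (suc (suc zero)))
  }

each : Fin K → Prog K 2 → Prog K 2
each x p = bind (markFirst x) λ { yes! → loop (iteration x p) ; no! → done yes! }

iterationTime : ℕ → ℕ → ℕ
iterationTime N T = T + (stepTime N + 1)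

eachTime : ℕ → ℕ → ℕ
eachTime N T = (1 + markTime N) + suc N * iterationTime N T

module _ {Store : Set} where
  -- The store of a failing iteration is kept, so failure doubles as a break whose effects persist.
  every : ∀ m → (Fin m → Store → Bool × Store) → Store → Bool × Store
  every zero    k σ = true , σ
  every (suc m) k σ = let b , σ′ = k zero σ in if b then every m (k ∘ suc) σ′ else (false , σ′)

arr : ∀ {n} → Subset n → Tape
arr w = home (toList w)

toList-∅ : ∀ n → toList (∅ {n}) ≡ falses n
toList-∅ zero    = refl
toList-∅ (suc n) = cong (false ∷_) (toList-∅ n)

module _ {Store : Set} {n : ℕ} (x : Fin K) (p : Prog K 2) (k : Fin n → Store → Bool × Store)
         (S : Subset n → Store → Vec Tape K)
         (S-at : ∀ w σ → lookup (S w σ) x ≡ arr w)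
         (S-set : ∀ w w′ σ → S w σ [ x ]≔ arr w′ ≡ S w′ σ)
         (T : ℕ)
         (body : ∀ u σ → Runs p (S ⁅ u ⁆ σ) T (bit (proj₁ (k u σ))) (S ⁅ u ⁆ (proj₂ (k u σ))))
         where

  private
    S-set′ : ∀ {w bs} w′ σ → toList w′ ≡ bs → S w σ [ x ]≔ home bs ≡ S w′ σ
    S-set′ w′ σ refl = S-set _ w′ σ

    -- f lists the vertices still to be visited, and q have been passed. Stating through `words`
    -- that the singleton of `f i` is that of i behind q zeros lets the recursion shift f by `suc`
    -- and avoids arithmetic in `Fin n`.
    loops : ∀ m q (f : Fin (suc m) → Fin n) → (∀ i → toList ⁅ f i ⁆ ≡ falses q ++ toList ⁅ i ⁆) → q + suc m ≡ n →
            ∀ σ → let b , σ′ = every (suc m) (k ∘ f) σ in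
            Runs (loop (iteration x p)) (S ⁅ f zero ⁆ σ) (suc m * iterationTime n T) (bit b) (S ∅ σ′)
    loops m q f words len σ with k (f zero) σ | body (f zero) σ
    ... | false , σ′ | r =
      weaken (≤-trans (+-monoʳ-≤ T (≤-trans (+-monoʳ-≤ (seekTime n 1) (n≤1+n _)) (m≤m+n (stepTime n) 1))) (m≤m+n _ (m * iterationTime n T)))
        (run-break (run-bind r (run-clear q (falses m) q≤n at (to emptied run-done))))
      where
      q≤n : q ≤ n
      q≤n = ≤-trans (m≤m+n q (suc m)) (≤-reflexive len)
      at : lookup (S ⁅ f zero ⁆ σ′) x ≡ home (oneHot q (falses m))
      at = trans (S-at _ σ′) (cong home (trans (words zero) (cong (λ ws → falses q ++ true ∷ ws) (toList-∅ m))))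
      emptied : S ⁅ f zero ⁆ σ′ [ x ]≔ home (falses q ++ false ∷ falses m) ≡ S ∅ σ′
      emptied = S-set′ ∅ σ′ (trans (toList-∅ n) (trans (cong falses (sym len)) (falses-+ q)))
        where
        falses-+ : ∀ q → falses (q + suc m) ≡ falses q ++ false ∷ falses m
        falses-+ zero    = refl
        falses-+ (suc q) = cong (false ∷_) (falses-+ q)
    loops zero q f words len σ | true , σ′ | r =
      weaken (m≤m+n _ 0) (run-break (run-bind r (run-bind (to emptied (run-advance-no q q<n at)) run-done)))
      where
      q<n : suc q ≤ n
      q<n = ≤-reflexive (trans (+-comm 1 q) len)
      at : lookup (S ⁅ f zero ⁆ σ′) x ≡ home (oneHot q [])
      at = trans (S-at _ σ′) (cong home (words zero))
      emptied : S ⁅ f zero ⁆ σ′ [ x ]≔ home (falses q ++ false ∷ []) ≡ S ∅ σ′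
      emptied = S-set′ ∅ σ′ (trans (toList-∅ n) (trans (cong falses (sym len)) (falses-+ q)))
        where
        falses-+ : ∀ q → falses (q + 1) ≡ falses q ++ false ∷ []
        falses-+ zero    = refl
        falses-+ (suc q) = cong (false ∷_) (falses-+ q)
    loops (suc m) q f words len σ | true , σ′ | r =
      run-again (run-bind r (run-bind (to moved (run-advance-yes q false (falses m) q<n at)) run-done))
        (loops m (suc q) (f ∘ suc) (λ i → trans (words (suc i)) (falses-suc q)) (trans (sym (+-suc q (suc m))) len) σ′)
      where
      q<n : suc q ≤ n
      q<n = ≤-trans (≤-trans (m≤m+n (suc q) (suc m)) (≤-reflexive (sym (+-suc q (suc m))))) (≤-reflexive len)
      at : lookup (S ⁅ f zero ⁆ σ′) x ≡ home (oneHot q (false ∷ falses m))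
      at = trans (S-at _ σ′) (cong home (trans (words zero) (cong (λ ws → falses q ++ true ∷ ws) (toList-∅ (suc m)))))
      moved : S ⁅ f zero ⁆ σ′ [ x ]≔ home (falses q ++ false ∷ true ∷ falses m) ≡ S ⁅ f (suc zero) ⁆ σ′
      moved = S-set′ _ σ′ (trans (words (suc zero)) (cong (λ ws → falses q ++ false ∷ true ∷ ws) (toList-∅ m)))
      falses-suc : ∀ q {ws} → falses q ++ false ∷ ws ≡ falses (suc q) ++ ws
      falses-suc zero    = refl
      falses-suc (suc q) = cong (false ∷_) (falses-suc q)

    start-loop : ∀ m → m ≡ n → (f : Fin m → Fin n) → (∀ i → toList ⁅ f i ⁆ ≡ toList ⁅ i ⁆) → ∀ σ →
                 let b , σ′ = every m (k ∘ f) σ in Runs (each x p) (S ∅ σ) (eachTime n T) (bit b) (S ∅ σ′)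
    start-loop zero refl f words σ =
      weaken (+-monoʳ-≤ (1 + markTime 0) (≤-trans (s≤s z≤n) (≤-trans (m≤n+m (stepTime 0 + 1) T) (m≤m+n _ 0))))
        (run-bind (run-markFirst-no {N = 0} (S-at ∅ σ)) run-done)
    start-loop (suc m) refl f words σ =
      weaken (+-monoʳ-≤ (1 + markTime n) (m≤n+m _ (iterationTime n T)))
        (run-bind (to (S-set′ _ σ (trans (words zero) (cong (true ∷_) (toList-∅ m))))
            (run-markFirst-yes {N = suc m} false (falses m) (trans (S-at ∅ σ) (cong home (toList-∅ (suc m))))))
          (loops m 0 f words refl σ))

  run-each : ∀ σ → let b , σ′ = every n k σ in Runs (each x p) (S ∅ σ) (eachTime n T) (bit b) (S ∅ σ′)
  run-each = start-loop n refl id λ _ → refl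

-- Commands on vertices and sets of vertices

-- Commands with suc s set variables and d bound vertices.  A loop `allᶜ c`
-- stops as soon as c answers false for some vertex.
data Cmd (s : ℕ) : ℕ → Set where
  adjᶜ  : ∀ {d} → Fin d → Fin d → Cmd s d
  memᶜ  : ∀ {d} → Fin d → Fin (suc s) → Cmd s d
  sameᶜ : ∀ {d} → Fin d → Fin d → Cmd s d
  putᶜ  : ∀ {d} → Fin d → Fin (suc s) → Bool → Cmd s d
  retᶜ  : ∀ {d} → Bool → Cmd s d
  condᶜ : ∀ {d} → Cmd s d → Cmd s d → Cmd s d → Cmd s d
  allᶜ  : ∀ {d} → Cmd s (suc d) → Cmd s d

depth : ∀ {s d} → Cmd s d → ℕ
depth (condᶜ c c₁ c₂) = depth c ⊔ (depth c₁ ⊔ depth c₂)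
depth (allᶜ c)        = suc (depth c)
depth _              = 0

cost : ∀ {s d} → Cmd s d → ℕ → ℕ
cost (adjᶜ _ _)      n = entryTime n
cost (memᶜ _ _)      n = accessTime n
cost (sameᶜ _ _)     n = accessTime n
cost (putᶜ _ _ _)    n = accessTime n
cost (retᶜ _)        n = 1
cost (condᶜ c c₁ c₂) n = cost c n + (cost c₁ n + cost c₂ n)
cost (allᶜ c)        n = eachTime n (cost c n)

-- Addition by pushing successors to the right, so that binding a vertex
-- turns a free tape into a bound one without changing the type.
infixl 6 _⊕_
_⊕_ : ℕ → ℕ → ℕ
zero  ⊕ m = m
suc a ⊕ m = a ⊕ suc m

after : ∀ a {m} → Fin m → Fin (a ⊕ m)
after zero    i = i
after (suc a) i = after a (suc i)

after-injective : ∀ a {m} {i j : Fin m} → after a i ≡ after a j → i ≡ j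
after-injective zero    eq = eq
after-injective (suc a) eq with after-injective a eq
... | refl = refl

pointer : ∀ a {s d} → Fin d → Fin (suc (a ⊕ (d + suc s)))
pointer a {s} i = suc (after a (i ↑ˡ suc s))

setTape : ∀ a {s d} → Fin (suc s) → Fin (suc (a ⊕ (d + suc s)))
setTape a {d = d} X = suc (after a (d ↑ʳ X))

peek : Symbol → Fin 2 × Symbol
peek a = test a , a

compile : ∀ {s d} a → Cmd s d → Prog (suc (a ⊕ (d + suc s))) 2
-- Set variable 0 always exists; its tape is the ruler for the rows of the matrix.
compile a (adjᶜ i j)      = entry zero (pointer a i) (pointer a j) (setTape a zero)
compile a (memᶜ i X)      = access (pointer a i) (setTape a X) peek
compile a (sameᶜ i j) with i ≟ j
-- `access` needs two distinct tapes, so comparing a variable with itself is settled during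
-- compilation.
... | yes _              = done yes!
... | no _               = access (pointer a i) (pointer a j) peek
compile a (putᶜ i X b)    = access (pointer a i) (setTape a X) λ _ → yes! , just b
compile a (retᶜ b)        = done (bit b)
compile a (condᶜ c c₁ c₂) = bind (compile a c) λ { yes! → compile a c₁ ; no! → compile a c₂ }
-- Out of free tapes, which does not happen if depth c ≤ a.
compile zero (allᶜ c)     = done yes!
compile (suc a) (allᶜ {d} c) = each (suc (after a {suc d + _} zero)) (compile a c)

-- Semantics of commands and correctness of their compilation

module Semantics {s : ℕ} (G : Graph) where
  open Graph G using () renaming (order to n; adj to adjacent)

  Store : Set
  Store = Vec (Subset n) (suc s)

  ⟦_⟧ : ∀ {d} → Cmd s d → Vec (Fin n) d → Store → Bool × Store
  ⟦ adjᶜ i j ⟧      ρ σ = adjacent (lookup ρ i) (lookup ρ j) , σ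
  ⟦ memᶜ i X ⟧      ρ σ = lookup (lookup σ X) (lookup ρ i) , σ
  ⟦ sameᶜ i j ⟧     ρ σ = does (lookup ρ i ≟ lookup ρ j) , σ
  ⟦ putᶜ i X b ⟧    ρ σ = true , σ [ X ]≔ (lookup σ X [ lookup ρ i ]≔ b)
  ⟦ retᶜ b ⟧        ρ σ = b , σ
  ⟦ condᶜ c c₁ c₂ ⟧ ρ σ = let b , σ′ = ⟦ c ⟧ ρ σ in if b then ⟦ c₁ ⟧ ρ σ′ else ⟦ c₂ ⟧ ρ σ′
  ⟦ allᶜ c ⟧        ρ σ = every n (λ u → ⟦ c ⟧ (u ∷ ρ)) σ

pad : ∀ {n} a {m} → Vec (Subset n) m → Vec (Subset n) (a ⊕ m)
pad zero    v = v
pad (suc a) v = pad a (∅ ∷ v)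

lookup-pad : ∀ {n} a {m} (v : Vec (Subset n) m) i → lookup (pad a v) (after a i) ≡ lookup v i
lookup-pad zero    v i = refl
lookup-pad (suc a) v i = lookup-pad a (∅ ∷ v) (suc i)

pad-[]≔ : ∀ {n} a {m} (v : Vec (Subset n) m) i {w} → pad a v [ after a i ]≔ w ≡ pad a (v [ i ]≔ w)
pad-[]≔ zero    v i = refl
pad-[]≔ (suc a) v i = pad-[]≔ a (∅ ∷ v) (suc i)

splitAt-vertex : ∀ {n} (v : Subset n) u → ∃[ bs ] ∃[ cs ] length bs ≡ toℕ u ×
                 toList v ≡ bs ++ lookup v u ∷ cs × ∀ b → toList (v [ u ]≔ b) ≡ bs ++ b ∷ cs
splitAt-vertex (c ∷ v) zero    = [] , toList v , refl , refl , λ _ → refl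
splitAt-vertex (c ∷ v) (suc u) =
  let bs , cs , len , eq , eq′ = splitAt-vertex v u
  in c ∷ bs , cs , cong suc len , cong (c ∷_) eq , λ b → cong (c ∷_) (eq′ b)

toList-⁅⁆ : ∀ {n} (u : Fin n) → ∃[ us ] toList ⁅ u ⁆ ≡ oneHot (toℕ u) us
toList-⁅⁆ {suc n} zero = falses n , cong (true ∷_) (toList-∅ n)
toList-⁅⁆ (suc u) = let us , eq = toList-⁅⁆ u in us , cong (false ∷_) eq

lookup-⁅⁆ : ∀ {n} (u v : Fin n) → lookup ⁅ v ⁆ u ≡ does (u ≟ v)
lookup-⁅⁆ zero    zero    = refl
lookup-⁅⁆ zero    (suc v) = refl
lookup-⁅⁆ {suc n} (suc u) zero = lookup-∅ u
  where
  lookup-∅ : ∀ {n} (u : Fin n) → lookup ∅ u ≡ false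
  lookup-∅ zero    = refl
  lookup-∅ (suc u) = lookup-∅ u
lookup-⁅⁆ (suc u) (suc v) = lookup-⁅⁆ u v

row-split : ∀ {A : Set} {n} (h : Fin n → A) v → ∃[ xs ] ∃[ ys ] length xs ≡ toℕ v × List.tabulate h ≡ xs ++ h v ∷ ys
row-split h zero    = [] , _ , refl , refl
row-split h (suc v) =
  let xs , ys , len , eq = row-split (h ∘ suc) v in h zero ∷ xs , ys , cong suc len , cong (h zero ∷_) eq

rows-split : ∀ {A : Set} {m n} {f : Fin n → List A} {k} → (∀ u → length (f u) ≡ k) → (g : Fin m → Fin n) → ∀ u →
             ∃[ xs ] ∃[ ys ] length xs ≡ toℕ u * k × concatMap f (List.tabulate g) ≡ xs ++ f (g u) ++ ys
rows-split {f = f} len g zero    = [] , _ , refl , refl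
rows-split {f = f} len g (suc u) =
  let xs , ys , l , eq = rows-split len (g ∘ suc) u
  in f (g zero) ++ xs , ys , trans (length-++ (f (g zero))) (cong₂ _+_ (len _) l) ,
     trans (cong (f (g zero) ++_) eq) (sym (++-assoc (f (g zero)) xs _))

module _ (G : Graph) where
  open Graph G renaming (adj to adjacent)

  matrix : List Bool
  matrix = concatMap (λ u → List.map (adjacent u) (allFin order)) (allFin order)

  matrix-split : ∀ u v → ∃[ bs ] ∃[ cs ] length bs ≡ toℕ v + toℕ u * order × matrix ≡ bs ++ adjacent u v ∷ cs
  matrix-split u v =
    let xs , ys , len , eq = rows-split {f = row} (λ w → trans (length-map (adjacent w) (allFin order)) (length-tabulate id)) id u
        bs , cs , len′ , eq′ = row-split (adjacent u) v
    in xs ++ bs , cs ++ ys , trans (length-++ xs) (trans (+-comm (length xs) _) (cong₂ _+_ len′ len)) ,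
       (begin
         matrix                               ≡⟨ eq ⟩
         xs ++ row u ++ ys                    ≡⟨ cong (λ r → xs ++ r ++ ys) (trans (map-tabulate id (adjacent u)) eq′) ⟩
         xs ++ (bs ++ adjacent u v ∷ cs) ++ ys ≡⟨ cong (xs ++_) (++-assoc bs _ ys) ⟩
         xs ++ bs ++ adjacent u v ∷ cs ++ ys  ≡⟨ ++-assoc xs bs _ ⟨
         (xs ++ bs) ++ adjacent u v ∷ cs ++ ys ∎)
    where
    open ≡-Reasoning
    row : Vertex → List Bool
    row u = List.map (adjacent u) (allFin order)

-- L and rest surround the matrix on the input tape. They are arbitrary and left unchanged, so the
-- code of a partition may follow the matrix.
module Correctness {s : ℕ} (G : Graph) (L rest : List Symbol) where
  open Graph G using () renaming (order to n; adj to adjacent)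
  open Semantics {s} G

  input : Tape
  input = tape L nothing (bits (matrix G) ++ rest)

  state : ∀ {m} → Vec (Subset n) m → Vec Tape (suc m)
  state v = input ∷ Vec.map arr v

  arrays : ∀ {d} → Vec (Fin n) d → Store → Vec (Subset n) (d + suc s)
  arrays ρ σ = Vec.map ⁅_⁆ ρ Vec.++ σ

  lookup-arr : ∀ a {m} (v : Vec (Subset n) m) i → lookup (state (pad a v)) (suc (after a i)) ≡ arr (lookup v i)
  lookup-arr a v i = trans (lookup-map (after a i) arr (pad a v)) (cong arr (lookup-pad a v i))

  set-arr : ∀ a {m} (v : Vec (Subset n) m) i {w} → state (pad a v) [ suc (after a i) ]≔ arr w ≡ state (pad a (v [ i ]≔ w))
  set-arr a v i = cong (input ∷_) (trans (sym (map-[]≔ arr (pad a v) (after a i))) (cong (Vec.map arr) (pad-[]≔ a v i)))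

  module _ (a : ℕ) {d : ℕ} (ρ : Vec (Fin n) d) (σ : Store) where

    pointer-at : ∀ i → lookup (state (pad a (arrays ρ σ))) (pointer a i) ≡ arr ⁅ lookup ρ i ⁆
    pointer-at i = trans (lookup-arr a (arrays ρ σ) (i ↑ˡ suc s))
      (cong arr (trans (lookup-++ˡ (Vec.map ⁅_⁆ ρ) σ i) (lookup-map i ⁅_⁆ ρ)))

    set-at : ∀ X → lookup (state (pad a (arrays ρ σ))) (setTape a X) ≡ arr (lookup σ X)
    set-at X = trans (lookup-arr a (arrays ρ σ) (d ↑ʳ X)) (cong arr (lookup-++ʳ (Vec.map ⁅_⁆ ρ) σ X))

    pointer≢set : ∀ {i X} → pointer a i ≢ setTape a {d = d} X
    pointer≢set {i} {X} eq = ↑ˡ≢↑ʳ i (after-injective a (suc-injective eq))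
      where
      ↑ˡ≢↑ʳ : ∀ {d} (i : Fin d) → i ↑ˡ suc s ≢ d ↑ʳ X
      ↑ˡ≢↑ʳ zero ()
      ↑ˡ≢↑ʳ (suc i) eq = ↑ˡ≢↑ʳ i (suc-injective eq)

    pointer≢pointer : ∀ {i j} → i ≢ j → pointer a {s} {d} i ≢ pointer a j
    pointer≢pointer i≢j eq = i≢j (↑ˡ-injective (suc s) _ _ (after-injective a (suc-injective eq)))

    run-access-at : ∀ {e} (g : Symbol → Fin e × Symbol) i {X} w → pointer a i ≢ X →
                    lookup (state (pad a (arrays ρ σ))) X ≡ arr w →
                    ∀ {k b} → g (just (lookup w (lookup ρ i))) ≡ (k , just b) →
                    Runs (access (pointer a i) X g) (state (pad a (arrays ρ σ))) (accessTime n) k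
                      (state (pad a (arrays ρ σ)) [ X ]≔ arr (w [ lookup ρ i ]≔ b))
    run-access-at g i {X} w i≢X at {b = b} eq =
      let bs , cs , len , split , split′ = splitAt-vertex w (lookup ρ i)
          us , hot = toList-⁅⁆ (lookup ρ i)
      in to (cong (λ v → state (pad a (arrays ρ σ)) [ X ]≔ home v) (sym (split′ b)))
           (run-access g us bs cs i≢X (≤-trans (≤-reflexive len) (toℕ≤n (lookup ρ i)))
             (trans (pointer-at i) (cong home (trans hot (cong (λ q → oneHot q us) (sym len)))))
             (trans at (cong home split)) eq)

    run-read : ∀ i {X} w → pointer a i ≢ X → lookup (state (pad a (arrays ρ σ))) X ≡ arr w →
               Runs (access (pointer a i) X peek) (state (pad a (arrays ρ σ))) (accessTime n)
                 (bit (lookup w (lookup ρ i))) (state (pad a (arrays ρ σ)))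
    run-read i {X} w i≢X at =
      to (trans (cong (λ v → state (pad a (arrays ρ σ)) [ X ]≔ arr v) ([]≔-lookup w (lookup ρ i))) (update-same at))
        (run-access-at peek i w i≢X at (cong (_, just (lookup w (lookup ρ i))) (test-just (lookup w (lookup ρ i)))))
      where
      test-just : ∀ b → test (just b) ≡ bit b
      test-just true  = refl
      test-just false = refl

  run-compile : ∀ {d} (c : Cmd s d) a → depth c ≤ a → ∀ ρ σ → let b , σ′ = ⟦ c ⟧ ρ σ in
                Runs (compile a c) (state (pad a (arrays ρ σ))) (cost c n) (bit b) (state (pad a (arrays ρ σ′)))
  run-compile (adjᶜ i j) a _ ρ σ =
    let bs , cs , len , eq = matrix-split G (lookup ρ i) (lookup ρ j)
        us , hot₁ = toList-⁅⁆ (lookup ρ i)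
        vs , hot₂ = toList-⁅⁆ (lookup ρ j)
    in run-entry us vs (toList (lookup σ zero)) bs (toℕ (lookup ρ i)) (toℕ (lookup ρ j)) (λ ()) (λ ()) (λ ())
         (≢-sym (pointer≢set a ρ σ)) (toℕ≤n _) (toℕ≤n _) len (length-toList (lookup σ zero))
         (trans (pointer-at a ρ σ i) (cong home hot₁)) (trans (pointer-at a ρ σ j) (cong home hot₂)) (set-at a ρ σ zero)
         (cong (tape L nothing) (trans (cong (λ m → bits m ++ rest) eq) (bits-++ bs (_ ∷ cs) rest)))
  run-compile (memᶜ i X) a _ ρ σ = run-read a ρ σ i (lookup σ X) (pointer≢set a ρ σ) (set-at a ρ σ X)
  run-compile (sameᶜ i j) a _ ρ σ with i ≟ j
  ... | yes refl with lookup ρ i ≟ lookup ρ i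
  ...   | yes _ = weaken (s≤s z≤n) run-done
  ...   | no ≢  = contradiction refl ≢
  run-compile (sameᶜ i j) a _ ρ σ | no i≢j =
    subst (λ b → Runs (access (pointer a i) (pointer a j) peek) (state (pad a (arrays ρ σ))) (accessTime n) (bit b) (state (pad a (arrays ρ σ)))) (lookup-⁅⁆ (lookup ρ i) (lookup ρ j))
      (run-read a ρ σ i ⁅ lookup ρ j ⁆ (pointer≢pointer a ρ σ i≢j) (pointer-at a ρ σ j))
  run-compile {d} (putᶜ i X b) a _ ρ σ =
    to (trans (set-arr a (arrays ρ σ) (d ↑ʳ X)) (cong (state ∘ pad a) (update-++ (Vec.map ⁅_⁆ ρ) σ X)))
      (run-access-at a ρ σ (λ _ → yes! , just b) i (lookup σ X) (pointer≢set a ρ σ) (set-at a ρ σ X) refl)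
    where
    update-++ : ∀ {m} (xs : Vec (Subset n) m) (ys : Store) X {w} → (xs Vec.++ ys) [ m ↑ʳ X ]≔ w ≡ xs Vec.++ (ys [ X ]≔ w)
    update-++ []       ys X = refl
    update-++ (x ∷ xs) ys X = cong (x ∷_) (update-++ xs ys X)
  run-compile (retᶜ b) a _ ρ σ = run-done
  run-compile (condᶜ c c₁ c₂) a le ρ σ with ⟦ c ⟧ ρ σ | run-compile c a (m⊔n≤o⇒m≤o _ _ le) ρ σ
  ... | true , σ′  | r = run-bind r (weaken (m≤m+n _ _) (run-compile c₁ a (m⊔n≤o⇒m≤o _ _ (m⊔n≤o⇒n≤o (depth c) _ le)) ρ σ′))
  ... | false , σ′ | r = run-bind r (weaken (m≤n+m _ (cost c₁ n)) (run-compile c₂ a (m⊔n≤o⇒n≤o (depth c₁) _ (m⊔n≤o⇒n≤o (depth c) _ le)) ρ σ′))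
  -- `pad (suc a) v` unfolds to `pad a (∅ ∷ v)`: a free tape becomes that of the loop variable, and
  -- putting `⁅ u ⁆` on it yields `arrays (u ∷ ρ) σ`, all by definition.
  run-compile (allᶜ {d} c) (suc a) (s≤s le) ρ σ =
    run-each (suc (after a {suc d + suc s} zero)) (compile a c) (λ u → ⟦ c ⟧ (u ∷ ρ))
      (λ w σ → state (pad a (w ∷ arrays ρ σ)))
      (λ w σ → lookup-arr a (w ∷ arrays ρ σ) zero)
      (λ w w′ σ → set-arr a (w ∷ arrays ρ σ) zero)
      (cost c n) (λ u σ → run-compile c a le (u ∷ ρ) σ) σ

-- Preparing the tapes; polynomial bounds

module _ {k : ℕ} (τ : Fin k) where

  uniform : Tape → Tape → Vec Tape (suc k)
  uniform t u = t ∷ Vec.replicate k u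

  -- All tapes but the first are kept equal, so that τ stands for each of them.
  both : ∀ {e} → (Symbol → Symbol → Fin e × (Symbol × Move) × (Symbol × Move)) → Prog (suc k) e
  both f = prim λ v → let i , x , y = f (Vec.head v) (lookup (Vec.tail v) τ) in i , x ∷ Vec.replicate k y

  run-both : ∀ {e} (f : Symbol → Symbol → Fin e × (Symbol × Move) × (Symbol × Move)) {t u i x y} →
             f (Tape.head t) (Tape.head u) ≡ (i , x , y) →
             Runs (both f) (uniform t u) 1 i (uniform (writeMove x t) (writeMove y u))
  run-both f {t} {u} {i} {x} {y} eq =
    to (cong (writeMove x t ∷_) (zipWith-replicate writeMove y u))
      (exit i (x ∷ Vec.replicate k y) (cong (λ (j , z , w) → inj₂ j , z ∷ Vec.replicate k w) eq′))
    where
    eq′ : f (Tape.head t) (lookup (heads (Vec.replicate k u)) τ) ≡ (i , x , y)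
    eq′ = trans (cong (f (Tape.head t)) (trans (lookup-map τ Tape.head (Vec.replicate k u)) (cong Tape.head (lookup-replicate τ u)))) eq

  depart : Symbol → Symbol → Fin 1 × (Symbol × Move) × (Symbol × Move)
  depart a _ = zero , (a , stay) , (nothing , right)

  measure : Symbol → Symbol → Fin 2 × (Symbol × Move) × (Symbol × Move)
  measure (just true) _ = yes! , (just true , right) , (just false , right)
  -- The zero behind the unary order turns into the blank at which `rewind` later stops in front of
  -- the matrix.
  measure _           _ = no! , (nothing , stay) , (nothing , stay)

  leave : Symbol → Symbol → Fin 1 × (Symbol × Move) × (Symbol × Move)
  leave a _ = zero , (a , stay) , (nothing , left)

  homeward : Symbol → Symbol → Fin 2 × (Symbol × Move) × (Symbol × Move)
  homeward a (just b) = yes! , (a , stay) , (just b , left)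
  homeward a nothing  = no! , (a , stay) , (nothing , stay)

  -- Turns all tapes but the first into words of n zeros, where the input
  -- begins with n ones and a zero, and blanks this zero.
  init : Prog (suc k) 1
  init = both depart ▸ loop (both measure) ▸ both leave ▸ loop (both homeward)

  initTime : ℕ → ℕ
  initTime n = 1 + (suc n + (1 + suc n))

  run-measure : ∀ m L A R →
    Runs (loop (both measure)) (uniform (from L (bits (List.replicate m true) ++ just false ∷ R)) (tape A nothing [])) (suc m) zero
      (uniform (tape (bits (List.replicate m true) ʳ++ L) nothing R) (tape (bits (falses m) ʳ++ A) nothing []))
  run-measure zero    L A R = run-break (run-both measure refl)
  run-measure (suc m) L A R =
    run-again (to (cong (λ t → uniform t _) (move-right L (just true) _)) (run-both measure refl))
      (run-measure m (just true ∷ L) (just false ∷ A) R)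

  run-homeward : ∀ t bs {L} R → Runs (loop (both homeward)) (uniform t (onto (bits bs ++ nothing ∷ L) R)) (suc (length bs)) zero
    (uniform t (tape L nothing (bits bs ʳ++ R)))
  run-homeward t [] {L} R   = run-break (run-both homeward {t} {tape L nothing R} refl)
  run-homeward t (b ∷ bs) {L} R =
    run-again (to (cong (uniform t) (move-left (bits bs ++ nothing ∷ L) (just b) R)) (run-both homeward {t} {tape (bits bs ++ nothing ∷ L) (just b) R} refl)) (run-homeward t bs (just b ∷ R))

  run-init : ∀ n w → Runs init (uniform (fromWord (List.replicate n true ++ false ∷ w)) (fromWord [])) (initTime n) zero
    (uniform (tape (bits (List.replicate n true) ʳ++ []) nothing (bits w)) (home (falses n)))
  run-init n w =
    run-bind (run-both depart refl)
    (run-bind (starting (cong (λ t → uniform t _) (from-word n)) (run-measure n [] (nothing ∷ []) (bits w)))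
    (run-bind (run-both leave refl)
    (starting (cong (uniform t) (sym (trans (move-left (bits (falses n) ʳ++ nothing ∷ []) nothing []) (cong (λ l → onto l (nothing ∷ [])) (ʳ++-falses n (nothing ∷ []))))))
      (to (cong (λ r → uniform t (tape [] nothing r)) (ʳ++-falses n (nothing ∷ [])))
        (subst (λ m → Runs (loop (both homeward)) (uniform t (onto (bits (falses n) ++ nothing ∷ []) (nothing ∷ []))) (suc m) zero
            (uniform t (tape [] nothing (bits (falses n) ʳ++ nothing ∷ [])))) (length-replicate n)
          (run-homeward t (falses n) (nothing ∷ [])))))))
    where
    t = tape (bits (List.replicate n true) ʳ++ []) nothing (bits w)
    from-word : ∀ n → from [] (bits (List.replicate n true) ++ just false ∷ bits w) ≡ fromWord (List.replicate n true ++ false ∷ w)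
    from-word zero    = refl
    from-word (suc n) = cong (tape [] (just true)) (sym (map-++ just (List.replicate n true) _))
    ʳ++-falses : ∀ n ys → bits (falses n) ʳ++ ys ≡ bits (falses n) ++ ys
    ʳ++-falses zero    ys = refl
    ʳ++-falses (suc n) ys = trans (ʳ++-falses n (just false ∷ ys)) (shuffle n)
      where
      shuffle : ∀ n → bits (falses n) ++ just false ∷ ys ≡ just false ∷ bits (falses n) ++ ys
      shuffle zero    = refl
      shuffle (suc n) = cong (just false ∷_) (shuffle n)

-- Polynomial bounds

Polynomial : (ℕ → ℕ) → Set
Polynomial f = ∃[ c ] ∃[ d ] ∀ n → f n ≤ c * suc n ^ d

poly-const : ∀ c → Polynomial λ _ → c
poly-const c = c , 0 , λ n → ≤-reflexive (sym (*-identityʳ c))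

poly-id : Polynomial id
poly-id = 1 , 1 , λ n → ≤-trans (n≤1+n n) (≤-reflexive (sym (trans (*-identityˡ _) (*-identityʳ _))))

poly-+ : ∀ {f g} → Polynomial f → Polynomial g → Polynomial λ n → f n + g n
poly-+ {f} {g} (c , d , le) (c′ , d′ , le′) = c + c′ , d + d′ , λ n → begin
  f n + g n                                     ≤⟨ +-mono-≤ (le n) (le′ n) ⟩
  c * suc n ^ d + c′ * suc n ^ d′               ≤⟨ +-mono-≤ (*-monoʳ-≤ c (grow n d d′)) (*-monoʳ-≤ c′ (grow′ n)) ⟩
  c * suc n ^ (d + d′) + c′ * suc n ^ (d + d′)  ≡⟨ *-distribʳ-+ (suc n ^ (d + d′)) c c′ ⟨
  (c + c′) * suc n ^ (d + d′)                   ∎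
  where
  open ≤-Reasoning
  grow : ∀ n d d′ → suc n ^ d ≤ suc n ^ (d + d′)
  grow n d d′ = ≤-trans (m≤m*n (suc n ^ d) (suc n ^ d′) {{m^n≢0 (suc n) d′}}) (≤-reflexive (sym (^-distribˡ-+-* (suc n) d d′)))
  grow′ : ∀ n → suc n ^ d′ ≤ suc n ^ (d + d′)
  grow′ n = ≤-trans (grow n d′ d) (≤-reflexive (cong (suc n ^_) (+-comm d′ d)))

poly-* : ∀ {f g} → Polynomial f → Polynomial g → Polynomial λ n → f n * g n
poly-* {f} {g} (c , d , le) (c′ , d′ , le′) = c * c′ , d + d′ , λ n → begin
  f n * g n                            ≤⟨ *-mono-≤ (le n) (le′ n) ⟩
  (c * suc n ^ d) * (c′ * suc n ^ d′)  ≡⟨ [m*n]*[o*p]≡[m*o]*[n*p] c (suc n ^ d) c′ (suc n ^ d′) ⟩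
  (c * c′) * (suc n ^ d * suc n ^ d′)  ≡⟨ cong (c * c′ *_) (^-distribˡ-+-* (suc n) d d′) ⟨
  (c * c′) * suc n ^ (d + d′)          ∎
  where open ≤-Reasoning

poly-suc : ∀ {f} → Polynomial f → Polynomial λ n → suc (f n)
poly-suc p = poly-+ (poly-const 1) p

poly-rewind : ∀ {f} → Polynomial f → Polynomial λ n → rewindTime (f n)
poly-rewind p = poly-+ (poly-const 2) p

poly-seek : ∀ {f} → Polynomial f → Polynomial λ n → seekTime n (f n)
poly-seek p = poly-suc (poly-* (poly-suc poly-id) (poly-+ (poly-const 2) p))

poly-access : Polynomial accessTime
poly-access = poly-suc (poly-+ (poly-seek (poly-const 1)) (poly-suc (poly-+ rew (poly-+ rew (poly-const 1)))))
  where rew = poly-rewind poly-id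

poly-entry : Polynomial entryTime
poly-entry =
  poly-suc (poly-+ (poly-seek sweep-time) (poly-+ rew (poly-+ (poly-seek (poly-const 1)) (poly-+ rew
    (poly-suc (poly-+ (poly-rewind (poly-+ poly-id (poly-* poly-id poly-id))) (poly-const 1)))))))
  where
  rew = poly-rewind poly-id
  sweep-time : Polynomial λ n → sweepTime n 1
  sweep-time = poly-suc (poly-+ (poly-* (poly-suc poly-id) (poly-const 3)) rew)

poly-each : ∀ {f} → Polynomial f → Polynomial λ n → eachTime n (f n)
poly-each p =
  poly-+ (poly-suc mark-time)
    (poly-* (poly-suc poly-id) (poly-+ p (poly-+ (poly-+ (poly-seek (poly-const 1)) (poly-suc mark-time)) (poly-const 1))))
  where
  mark-time : Polynomial markTime
  mark-time = poly-suc (poly-+ (poly-rewind poly-id) (poly-const 1))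

poly-cost : ∀ {s d} (c : Cmd s d) → Polynomial (cost c)
poly-cost (adjᶜ _ _)      = poly-entry
poly-cost (memᶜ _ _)      = poly-access
poly-cost (sameᶜ _ _)     = poly-access
poly-cost (putᶜ _ _ _)    = poly-access
poly-cost (retᶜ _)        = poly-const 1
poly-cost (condᶜ c c₁ c₂) = poly-+ (poly-cost c) (poly-+ (poly-cost c₁) (poly-cost c₂))
poly-cost (allᶜ c)        = poly-each (poly-cost c)

answer-bit : ∀ b → answer (bit b) ≡ b
answer-bit true  = refl
answer-bit false = refl

outcome : ∀ {s} → Cmd s 0 → Graph → Bool
outcome {s} c G = proj₁ (⟦ c ⟧ [] (Vec.replicate (suc s) ∅))
  where open Semantics {s} G

pad-replicate : ∀ {n} a m → pad {n} a (Vec.replicate m ∅) ≡ Vec.replicate (a ⊕ m) ∅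
pad-replicate zero    m = refl
pad-replicate (suc a) m = pad-replicate a (suc m)

-- The code begins with the order in unary, so a bound that is polynomial in the number of vertices
-- is also polynomial in the length of the input. From here on only commands and their outcomes on
-- graphs matter.
polynomial-time : ∀ (P : Problem) → let open Problem P in
  (graph : Instance → Graph) (suffix : Instance → List Bool) →
  (∀ x → encode x ≡ encodeGraph (graph x) ++ suffix x) →
  ∀ {s} (c : Cmd s 0) → (∀ x → outcome c (graph x) ≡ true ⇔ Yes x) → PolynomialTime P
polynomial-time P graph suffix encoding {s} c correct =
  machine prog , C , D , λ x → outcome c (graph x) ,
    trans (machine-answer prog (weaken (bound x) (starting (cong₂ (λ w u → fromWord w ∷ u) (word x) refl) (run x))))
      (cong just (answer-bit (outcome c (graph x)))) ,
    correct x
  where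
  open Problem P
  a = depth c
  prog : Prog (suc (a ⊕ suc s)) 2
  prog = init (after a zero) ▸ compile a c
  time-poly : Polynomial λ n → initTime (after a {suc s} zero) n + cost c n
  time-poly = poly-+ (poly-suc (poly-+ (poly-suc poly-id) (poly-suc (poly-suc poly-id)))) (poly-cost c)
  C = proj₁ time-poly
  D = proj₁ (proj₂ time-poly)
  module _ (x : Instance) where
    G = graph x
    n = Graph.order G
    code : List Bool
    code = matrix G ++ suffix x
    word : List.replicate n true ++ false ∷ code ≡ encode x
    word = sym (trans (encoding x) (++-assoc (List.replicate n true) (false ∷ matrix G) (suffix x)))
    open Correctness {s} G (bits (List.replicate n true) ʳ++ []) (bits (suffix x))
    run : Runs prog (fromWord (List.replicate n true ++ false ∷ code) ∷ Vec.replicate (a ⊕ suc s) (fromWord []))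
            (initTime (after a {suc s} zero) n + cost c n) (bit (outcome c G)) _
    run = run-bind (run-init (after a zero) n code)
      (starting (cong₂ _∷_ (cong (tape _ nothing) (sym (map-++ just (matrix G) (suffix x)))) arrays-empty)
        (run-compile c a ≤-refl [] (Vec.replicate (suc s) ∅)))
      where
      arrays-empty : Vec.map arr (pad a (Vec.replicate (suc s) ∅)) ≡ Vec.replicate (a ⊕ suc s) (home (falses n))
      arrays-empty = begin
        Vec.map arr (pad a (Vec.replicate (suc s) ∅))    ≡⟨ cong (Vec.map arr) (pad-replicate a (suc s)) ⟩
        Vec.map arr (Vec.replicate (a ⊕ suc s) ∅)        ≡⟨ mapᵥ-replicate arr ∅ (a ⊕ suc s) ⟩
        Vec.replicate (a ⊕ suc s) (arr ∅)                ≡⟨ cong (Vec.replicate _ ∘ home) (toList-∅ n) ⟩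
        Vec.replicate (a ⊕ suc s) (home (falses n))      ∎
        where open ≡-Reasoning
    order≤length : n ≤ length (encode x)
    order≤length = begin
      n                                                  ≡⟨ length-replicate n ⟨
      length (List.replicate n true)                     ≤⟨ m≤m+n _ _ ⟩
      length (List.replicate n true) + length (false ∷ code) ≡⟨ length-++ (List.replicate n true) ⟨
      length (List.replicate n true ++ false ∷ code)     ≡⟨ cong length word ⟩
      length (encode x)                                  ∎
      where open ≤-Reasoning
    bound : initTime (after a {suc s} zero) n + cost c n ≤ C * suc (length (encode x)) ^ D
    bound = ≤-trans (proj₂ (proj₂ time-poly) n) (*-monoʳ-≤ C (^-monoˡ-≤ D (s≤s order≤length)))

-- Correctness rules for commands

infix 4 _∊_
_∊_ : ∀ {n} → Fin n → Subset n → Set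
u ∊ A = lookup A u ≡ true

reflects-≡ : ∀ b → Reflects (b ≡ true) b
reflects-≡ true  = ofʸ refl
reflects-≡ false = ofⁿ λ ()

reflects-⇔ : ∀ {P Q : Set} {b} → P ⇔ Q → Reflects P b → Reflects Q b
reflects-⇔ eq (ofʸ p)  = ofʸ (Equivalence.to eq p)
reflects-⇔ eq (ofⁿ ¬p) = ofⁿ (¬p ∘ Equivalence.from eq)

infixr 3 _∧ᶜ_
infixr 2 _⇒ᶜ_
infixr 1 _∨ᶜ_

notᶜ : ∀ {s d} → Cmd s d → Cmd s d
notᶜ c = condᶜ c (retᶜ false) (retᶜ true)

-- With a first component that always answers true this is sequencing.
_∧ᶜ_ _∨ᶜ_ _⇒ᶜ_ : ∀ {s d} → Cmd s d → Cmd s d → Cmd s d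
c ∧ᶜ c′ = condᶜ c c′ (retᶜ false)
c ∨ᶜ c′ = condᶜ c (retᶜ true) c′
c ⇒ᶜ c′ = condᶜ c c′ (retᶜ true)

anyᶜ : ∀ {s d} → Cmd s (suc d) → Cmd s d
anyᶜ c = notᶜ (allᶜ (notᶜ c))

module Logic {s : ℕ} (G : Graph) where
  open Graph G using (Adj) renaming (order to n; adj to adjacent)
  open Semantics {s} G public

  Assertion : Set₁
  Assertion = Store → Set

  -- Hoare triples whose postcondition sees the answer. The record keeps F, c, ρ and Q recoverable
  -- by unification, which would be lost once the semantics of c unfolds.
  record Triple {d} (F : Assertion) (c : Cmd s d) (ρ : Vec (Fin n) d) (Q : Bool → Assertion) : Set where
    constructor triple
    field run : ∀ σ → F σ → Q (proj₁ (⟦ c ⟧ ρ σ)) (proj₂ (⟦ c ⟧ ρ σ))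

  open Triple public

  Decides : ∀ {d} → Assertion → Assertion → Cmd s d → Vec (Fin n) d → Set → Set
  Decides F F′ c ρ P = Triple F c ρ λ b σ → F′ σ × Reflects P b

  Does : ∀ {d} → Assertion → Cmd s d → Vec (Fin n) d → Assertion → Set
  Does F c ρ F′ = Triple F c ρ λ b σ → b ≡ true × F′ σ

  module _ {d : ℕ} {ρ : Vec (Fin n) d} where

    triple-cond : ∀ {c c₁ c₂} {F : Assertion} (M : Bool → Assertion) {Q : Bool → Assertion} →
                  Triple F c ρ M → Triple (M true) c₁ ρ Q → Triple (M false) c₂ ρ Q → Triple F (condᶜ c c₁ c₂) ρ Q
    triple-cond {c} {c₁} {c₂} {F} M {Q} t t₁ t₂ = triple go
      where
      go : ∀ σ → F σ → Q (proj₁ (⟦ condᶜ c c₁ c₂ ⟧ ρ σ)) (proj₂ (⟦ condᶜ c c₁ c₂ ⟧ ρ σ))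
      go σ f with ⟦ c ⟧ ρ σ | run t σ f
      ... | true , σ′  | m = run t₁ σ′ m
      ... | false , σ′ | m = run t₂ σ′ m

    does-then : ∀ {c c′} {F F′ : Assertion} {Q : Bool → Assertion} →
                Does F c ρ F′ → Triple F′ c′ ρ Q → Triple F (c ∧ᶜ c′) ρ Q
    does-then dc t = triple-cond _ dc (triple λ σ (_ , f) → run t σ f) (triple λ _ ())

    triple-∃ : ∀ {c} {A : Set} {F : A → Assertion} {Q : Bool → Assertion} →
               (∀ x → Triple (F x) c ρ Q) → Triple (λ σ → ∃[ x ] F x σ) c ρ Q
    triple-∃ t = triple λ σ (x , f) → run (t x) σ f

    triple-× : ∀ {c} {A : Set} {F : Assertion} {Q : Bool → Assertion} →
               (A → Triple F c ρ Q) → Triple (λ σ → F σ × A) c ρ Q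
    triple-× t = triple λ σ (f , x) → run (t x) σ f

    decides-⇔ : ∀ {c} {F F′ : Assertion} {P Q : Set} → P ⇔ Q → Decides F F′ c ρ P → Decides F F′ c ρ Q
    decides-⇔ eq dc = triple λ σ f → let f′ , r = run dc σ f in f′ , reflects-⇔ eq r

    decides-post : ∀ {c} {F F′ F″ : Assertion} {P : Set} → (∀ {σ} → F′ σ → F″ σ) → Decides F F′ c ρ P → Decides F F″ c ρ P
    decides-post g dc = triple λ σ f → let f′ , r = run dc σ f in g f′ , r

    decides-adj : ∀ {F : Assertion} i j → Decides F F (adjᶜ i j) ρ (Adj (lookup ρ i) (lookup ρ j))
    decides-adj i j = triple λ σ f → f , reflects-≡ _

    decides-same : ∀ {F : Assertion} i j → Decides F F (sameᶜ i j) ρ (lookup ρ i ≡ lookup ρ j)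
    decides-same i j = triple λ σ f → f , proof (lookup ρ i ≟ lookup ρ j)

    decides-not : ∀ {c} {F F′ : Assertion} {P : Set} → Decides F F′ c ρ P → Decides F F′ (notᶜ c) ρ (¬ P)
    decides-not dc = triple-cond _ dc (triple λ { σ (f , ofʸ p) → f , ofⁿ λ ¬p → ¬p p }) (triple λ { σ (f , ofⁿ ¬p) → f , ofʸ ¬p })

    -- When the first command answers false the second does not run; the argument of type
    -- `F′ σ → F″ σ` then carries the intermediate store to the final assertion.
    decides-∧ : ∀ {c c′} {F F′ F″ : Assertion} {P Q : Set} → (∀ {σ} → F′ σ → F″ σ) →
                Decides F F′ c ρ P → (P → Decides F′ F″ c′ ρ Q) → Decides F F″ (c ∧ᶜ c′) ρ (P × Q)
    decides-∧ g dc dc′ = triple-cond _ dc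
      (triple λ { σ (f , ofʸ p) → let f′ , r = run (dc′ p) σ f in f′ , reflects-⇔ (mk⇔ (p ,_) proj₂) r })
      (triple λ { σ (f , ofⁿ ¬p) → g f , ofⁿ (¬p ∘ proj₁) })

    decides-∨ : ∀ {c c′} {F : Assertion} {P Q : Set} →
                Decides F F c ρ P → Decides F F c′ ρ Q → Decides F F (c ∨ᶜ c′) ρ (P ⊎ Q)
    decides-∨ dc dc′ = triple-cond _ dc
      (triple λ { σ (f , ofʸ p) → f , ofʸ (inj₁ p) })
      (triple λ { σ (f , ofⁿ ¬p) → let f′ , r = run dc′ σ f in f′ , reflects-⇔ (mk⇔ inj₂ Sum.[ (λ p → contradiction p ¬p) , id ]) r })

    decides-⇒ : ∀ {c c′} {F F′ F″ : Assertion} {P Q : Set} → (∀ {σ} → F′ σ → F″ σ) →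
                Decides F F′ c ρ P → (P → Decides F′ F″ c′ ρ Q) → Decides F F″ (c ⇒ᶜ c′) ρ (P → Q)
    decides-⇒ g dc dc′ = triple-cond _ dc
      (triple λ { σ (f , ofʸ p) → let f′ , r = run (dc′ p) σ f in f′ , reflects-⇔ (mk⇔ const λ q → q p) r })
      (triple λ { σ (f , ofⁿ ¬p) → g f , ofʸ λ p → contradiction p ¬p })

    private
      every-rule : (Q : Bool → Assertion) (Inv : ℕ → Assertion) → ∀ m {k : Fin m → Store → Bool × Store} →
                   (∀ u σ → Inv (toℕ u) σ → let b , σ′ = k u σ in if b then Inv (suc (toℕ u)) σ′ else Q false σ′) →
                   (∀ {σ} → Inv m σ → Q true σ) →
                   ∀ σ → Inv 0 σ → let b , σ′ = every m k σ in Q b σ′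
      every-rule Q Inv zero step fin σ inv = fin inv
      every-rule Q Inv (suc m) {k} step fin σ inv with k zero σ | step zero σ inv
      ... | false , σ′ | q = q
      ... | true , σ′  | i = every-rule Q (Inv ∘ suc) m (λ u → step (suc u)) fin σ′ i

    -- The invariant counts the visited vertices. A failing body has to establish the final
    -- postcondition itself, because the loop ends there.
    triple-all : ∀ {c} {F : Assertion} {Q : Bool → Assertion} (Inv : ℕ → Assertion) → (∀ {σ} → F σ → Inv 0 σ) →
                 (∀ u → Triple (Inv (toℕ u)) c (u ∷ ρ) λ b σ → if b then Inv (suc (toℕ u)) σ else Q false σ) →
                 (∀ {σ} → Inv n σ → Q true σ) → Triple F (allᶜ c) ρ Q
    triple-all {Q = Q} Inv init step fin = triple λ σ f → every-rule Q Inv n (λ u → run (step u)) fin σ (init f)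

    does-all : ∀ {c} {F F′ : Assertion} (Inv : ℕ → Assertion) → (∀ {σ} → F σ → Inv 0 σ) →
               (∀ u → Does (Inv (toℕ u)) c (u ∷ ρ) (Inv (suc (toℕ u)))) →
               (∀ {σ} → Inv n σ → F′ σ) → Does F (allᶜ c) ρ F′
    does-all Inv init step fin =
      triple-all Inv init (λ u → triple λ σ i → continue (run (step u) σ i)) λ i → refl , fin i
      where
      continue : ∀ {b A B} → b ≡ true × A → if b then A else B
      continue (refl , a) = a

  below-suc : ∀ {P : Fin n → Set} u → (∀ v → toℕ v < toℕ u → P v) → P u → ∀ v → toℕ v < suc (toℕ u) → P v
  below-suc {P} u h p v (s≤s le) with m≤n⇒m<n∨m≡n le
  ... | inj₁ lt = h v lt
  ... | inj₂ eq = subst P (sym (toℕ-injective eq)) p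

  -- The rule for loops used as searches: F is restored by every iteration that goes on, and E is
  -- what the one that breaks leaves behind.
  triple-each : ∀ {d} {ρ : Vec (Fin n) d} {c} {F E : Assertion} {P : Fin n → Set} →
                (∀ u → Triple F c (u ∷ ρ) λ b σ → if b then F σ × P u else E σ) →
                Triple F (allᶜ c) ρ λ b σ → if b then F σ × (∀ u → P u) else E σ
  triple-each {F = F} {E} {P} t =
    triple-all (λ k σ → F σ × ∀ u → toℕ u < k → P u) (_, λ _ ())
      (λ u → triple λ σ (f , h) → continue u h (run (t u) σ f))
      (λ (f , h) → f , λ u → h u (toℕ<n u))
    where
    continue : ∀ u {b σ} → (∀ v → toℕ v < toℕ u → P v) → (if b then F σ × P u else E σ) →
               if b then F σ × (∀ v → toℕ v < suc (toℕ u) → P v) else E σ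
    continue u {true}  h (f , p) = f , below-suc u h p
    continue u {false} h e       = e

  decides-all : ∀ {d} {ρ : Vec (Fin n) d} {c} {F : Assertion} {P : Fin n → Set} →
                (∀ u → Decides F F c (u ∷ ρ) (P u)) → Decides F F (allᶜ c) ρ (∀ u → P u)
  decides-all {ρ = ρ} {c} {F} {P} dc = triple λ σ f →
    finish (run (triple-each {ρ = ρ} {c} {E = λ σ → F σ × ∃[ u ] ¬ P u} λ u → triple λ σ f → branch u (run (dc u) σ f)) σ f)
    where
    branch : ∀ u {b σ} → F σ × Reflects (P u) b → if b then F σ × P u else (F σ × ∃[ u ] ¬ P u)
    branch u (f , ofʸ p)  = f , p
    branch u (f , ofⁿ ¬p) = f , u , ¬p
    finish : ∀ {b σ} → (if b then F σ × (∀ u → P u) else (F σ × ∃[ u ] ¬ P u)) → F σ × Reflects (∀ u → P u) b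
    finish {true}  (f , p)      = f , ofʸ p
    finish {false} (f , u , ¬p) = f , ofⁿ λ p → ¬p (p u)

  decides-any : ∀ {d} {ρ : Vec (Fin n) d} {c} {F : Assertion} {P : Fin n → Set} →
                (∀ u → Decides F F c (u ∷ ρ) (P u)) → Decides F F (anyᶜ c) ρ (∃ P)
  decides-any {F = F} {P} dc =
    triple-cond (λ b σ → if b then F σ × (∀ u → ¬ P u) else (F σ × ∃ P))
      (triple-each λ u → triple-cond _ (dc u)
        (triple λ { σ (f , ofʸ p) → f , u , p })
        (triple λ { σ (f , ofⁿ ¬p) → f , ¬p }))
      (triple λ σ (f , none) → f , ofⁿ λ (u , p) → none u p) (triple λ σ (f , p) → f , ofʸ p)

  -- `nothing` marks a variable of unknown content.
  Known : Set
  Known = Vec (Maybe (Subset n)) (suc s)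

  knows : ∀ {m} → Vec (Maybe (Subset n)) m → Vec (Subset n) m → Set
  knows []            []      = ⊤
  knows (nothing ∷ κ) (_ ∷ σ) = knows κ σ
  knows (just A ∷ κ)  (B ∷ σ) = B ≡ A × knows κ σ

  Knows : Known → Assertion
  Knows = knows

  knows-lookup : ∀ {m} (κ : Vec (Maybe (Subset n)) m) {σ} X {A} → lookup κ X ≡ just A → knows κ σ → lookup σ X ≡ A
  knows-lookup (just A ∷ κ)  {_ ∷ _} zero    refl (eq , _) = eq
  knows-lookup (just _ ∷ κ)  {_ ∷ _} (suc X) eq   (_ , k)  = knows-lookup κ X eq k
  knows-lookup (nothing ∷ κ) {_ ∷ _} (suc X) eq   k        = knows-lookup κ X eq k

  knows-set : ∀ {m} (κ : Vec (Maybe (Subset n)) m) {σ} X {A} → knows κ σ → knows (κ [ X ]≔ just A) (σ [ X ]≔ A)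
  knows-set (just _ ∷ κ)  {_ ∷ _} zero    (_ , k)  = refl , k
  knows-set (nothing ∷ κ) {_ ∷ _} zero    k        = refl , k
  knows-set (just _ ∷ κ)  {_ ∷ _} (suc X) (eq , k) = eq , knows-set κ X k
  knows-set (nothing ∷ κ) {_ ∷ _} (suc X) k        = knows-set κ X k

  knows-forget : ∀ {m} (κ : Vec (Maybe (Subset n)) m) {σ} X → knows κ σ → knows (κ [ X ]≔ nothing) σ
  knows-forget (just _ ∷ κ)  {_ ∷ _} zero    (_ , k)  = k
  knows-forget (nothing ∷ κ) {_ ∷ _} zero    k        = k
  knows-forget (just _ ∷ κ)  {_ ∷ _} (suc X) (eq , k) = eq , knows-forget κ X k
  knows-forget (nothing ∷ κ) {_ ∷ _} (suc X) k        = knows-forget κ X k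

  knows-reset : ∀ {m} (κ : Vec (Maybe (Subset n)) m) {σ} X {B A} → knows (κ [ X ]≔ just B) σ →
                knows (κ [ X ]≔ just A) (σ [ X ]≔ A)
  knows-reset κ X {B} {A} k = subst (λ κ → knows κ _) ([]≔-idempotent κ X) (knows-set (κ [ X ]≔ just B) X k)

  knows-learn : ∀ {m} (κ : Vec (Maybe (Subset n)) m) {σ} X → knows κ σ → knows (κ [ X ]≔ just (lookup σ X)) σ
  knows-learn κ {σ} X k = subst (knows (κ [ X ]≔ just (lookup σ X))) ([]≔-lookup σ X) (knows-set κ X k)

  module _ {d : ℕ} {ρ : Vec (Fin n) d} (κ : Known) where

    decides-mem : ∀ i X {A} → lookup κ X ≡ just A → Decides (Knows κ) (Knows κ) (memᶜ i X) ρ (lookup ρ i ∊ A)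
    decides-mem i X eq = triple λ σ k → k , subst (λ A → Reflects (lookup ρ i ∊ A) _) (knows-lookup κ X eq k) (reflects-≡ _)

    does-put : ∀ i X {A} b → Does (Knows (κ [ X ]≔ just A)) (putᶜ i X b) ρ (Knows (κ [ X ]≔ just (A [ lookup ρ i ]≔ b)))
    does-put i X {A} b = triple λ σ k → refl ,
      subst (λ B → knows (κ [ X ]≔ just (B [ lookup ρ i ]≔ b)) _)
        (knows-lookup (κ [ X ]≔ just A) X (lookup∘update X κ (just A)) k) (knows-reset κ X k)

-- Sets of vertices, and the search for the independent part

private variable
  ν : ℕ

_∊?_ : (u : Fin ν) (A : Subset ν) → Dec (u ∊ A)
u ∊? A = lookup A u ≟ᵇ true

subset-ext : {A B : Subset ν} → (∀ u → lookup A u ≡ lookup B u) → A ≡ B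
subset-ext {A = A} {B} eq = trans (sym (tabulate∘lookup A)) (trans (tabulate-cong eq) (tabulate∘lookup B))

bit-ext : ∀ {a b} → (a ≡ true → b ≡ true) → (b ≡ true → a ≡ true) → a ≡ b
bit-ext {true}          f g = sym (f refl)
bit-ext {false} {true}  f g = g refl
bit-ext {false} {false} f g = refl

subset-antisym : {A B : Subset ν} → (∀ u → u ∊ A → u ∊ B) → (∀ u → u ∊ B → u ∊ A) → A ≡ B
subset-antisym A⊆B B⊆A = subset-ext λ u → bit-ext (A⊆B u) (B⊆A u)

comprehension : {P : Fin ν → Set} → (∀ u → Dec (P u)) → Subset ν
comprehension P? = tabulate (does ∘ P?)

module _ {P : Fin ν → Set} (P? : ∀ u → Dec (P u)) where

  ∊-comprehension : ∀ {u} → P u → u ∊ comprehension P?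
  ∊-comprehension {u} p with P? u | lookup∘tabulate (does ∘ P?) u
  ... | yes _ | eq = eq
  ... | no ¬p | _  = contradiction p ¬p

  comprehension-∊ : ∀ {u} → u ∊ comprehension P? → P u
  comprehension-∊ {u} mem with P? u | lookup∘tabulate (does ∘ P?) u
  ... | yes p | _  = p
  ... | no _  | eq = contradiction (trans (sym mem) eq) λ ()

∉∅ : (u : Fin ν) → ¬ u ∊ ∅
∉∅ u mem = contradiction (trans (sym mem) (lookup-replicate u false)) λ ()

module _ {A : Subset ν} {u : Fin ν} where

  ∊-insert-same : u ∊ A [ u ]≔ true
  ∊-insert-same = lookup∘update u A true

  ∊-insert : ∀ {v} → v ∊ A → v ∊ A [ u ]≔ true
  ∊-insert {v} mem with v ≟ u
  ... | yes refl = ∊-insert-same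
  ... | no v≢u   = trans (lookup∘update′ v≢u A true) mem

  insert-∊ : ∀ {v} → v ∊ A [ u ]≔ true → v ≡ u ⊎ v ∊ A
  insert-∊ {v} mem with v ≟ u
  ... | yes eq = inj₁ eq
  ... | no v≢u = inj₂ (trans (sym (lookup∘update′ v≢u A true)) mem)

  remove-∊ : ∀ {v} → v ∊ A [ u ]≔ false → v ≢ u × v ∊ A
  remove-∊ {v} mem with v ≟ u
  ... | yes refl = contradiction (trans (sym mem) (lookup∘update u A false)) λ ()
  ... | no v≢u   = v≢u , trans (sym (lookup∘update′ v≢u A false)) mem

  remove-insert : ¬ u ∊ A → (A [ u ]≔ true) [ u ]≔ false ≡ A
  remove-insert u∉A = trans ([]≔-idempotent A u) (trans (cong (A [ u ]≔_) (sym (¬-not u∉A))) ([]≔-lookup A u))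

size-remove : {A : Subset ν} {u : Fin ν} → u ∊ A → ∣ A ∣ ≡ suc ∣ A [ u ]≔ false ∣
size-remove {A = true ∷ A}  {zero}  mem = refl
size-remove {A = true ∷ A}  {suc u} mem = cong suc (size-remove {A = A} mem)
size-remove {A = false ∷ A} {suc u} mem = size-remove {A = A} mem

size-insert : {A : Subset ν} {u : Fin ν} → ¬ u ∊ A → ∣ A [ u ]≔ true ∣ ≡ suc ∣ A ∣
size-insert {A = A} {u} u∉A =
  trans (size-remove {A = A [ u ]≔ true} (∊-insert-same {A = A})) (cong (suc ∘ ∣_∣) (remove-insert {A = A} u∉A))

size-mono : {A B : Subset ν} → (∀ u → u ∊ A → u ∊ B) → ∣ A ∣ ≤ ∣ B ∣
size-mono {A = []}        {[]}        sub = z≤n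
size-mono {A = true ∷ A}  {true ∷ B}  sub = s≤s (size-mono {A = A} {B} (sub ∘ suc))
size-mono {A = true ∷ A}  {false ∷ B} sub = contradiction (sub zero refl) λ ()
size-mono {A = false ∷ A} {true ∷ B}  sub = ≤-trans (size-mono {A = A} {B} (sub ∘ suc)) (n≤1+n _)
size-mono {A = false ∷ A} {false ∷ B} sub = size-mono {A = A} {B} (sub ∘ suc)

size-full : {A : Subset ν} → ν ≤ ∣ A ∣ → ∀ u → u ∊ A
size-full {A = true ∷ A}  (s≤s le) zero    = refl
size-full {A = true ∷ A}  (s≤s le) (suc u) = size-full {A = A} le u
size-full {A = false ∷ A} le       u       = contradiction (≤-trans le (∣p∣≤n A)) (<-irrefl refl)

indicator : Bool → ℕ
indicator b = if b then 1 else 0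

size-∷ : ∀ b (A : Subset ν) → ∣ b ∷ A ∣ ≡ indicator b + ∣ A ∣
size-∷ true  A = refl
size-∷ false A = refl

-- Reduces identities between sizes to a truth table at a single vertex; ∅ fills a slot when only
-- three sets occur.
size-balance : (A B C D : Subset ν) →
               (∀ u → indicator (lookup A u) + indicator (lookup B u) ≡ indicator (lookup C u) + indicator (lookup D u)) →
               ∣ A ∣ + ∣ B ∣ ≡ ∣ C ∣ + ∣ D ∣
size-balance []      []      []      []      eq = refl
size-balance (a ∷ A) (b ∷ B) (c ∷ C) (d ∷ D) eq = begin
  ∣ a ∷ A ∣ + ∣ b ∷ B ∣                                   ≡⟨ cong₂ _+_ (size-∷ a A) (size-∷ b B) ⟩
  (indicator a + ∣ A ∣) + (indicator b + ∣ B ∣)           ≡⟨ swap (indicator a) (∣ A ∣) (indicator b) (∣ B ∣) ⟩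
  (indicator a + indicator b) + (∣ A ∣ + ∣ B ∣)           ≡⟨ cong₂ _+_ (eq zero) (size-balance A B C D (eq ∘ suc)) ⟩
  (indicator c + indicator d) + (∣ C ∣ + ∣ D ∣)           ≡⟨ swap (indicator c) (∣ C ∣) (indicator d) (∣ D ∣) ⟨
  (indicator c + ∣ C ∣) + (indicator d + ∣ D ∣)           ≡⟨ cong₂ _+_ (size-∷ c C) (size-∷ d D) ⟨
  ∣ c ∷ C ∣ + ∣ d ∷ D ∣                                   ∎
  where
  open ≡-Reasoning
  swap : ∀ x X y Y → (x + X) + (y + Y) ≡ (x + y) + (X + Y)
  swap = +-*-Solver.solve 4 (λ x X y Y → (x :+ X) :+ (y :+ Y) := (x :+ y) :+ (X :+ Y)) refl
    where open +-*-Solver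

infixl 6 _⊖_
_⊖_ : Subset ν → Subset ν → Subset ν
A ⊖ B = tabulate λ u → lookup A u xor lookup B u

infixl 6 _∖_
_∖_ : Subset ν → Subset ν → Subset ν
A ∖ B = comprehension λ u → (u ∊? A) ×-dec ¬? (u ∊? B)

⊖-cancel : (A B : Subset ν) → A ⊖ (A ⊖ B) ≡ B
⊖-cancel A B = subset-ext λ u → begin
  lookup (A ⊖ (A ⊖ B)) u                    ≡⟨ lookup∘tabulate _ u ⟩
  lookup A u xor lookup (A ⊖ B) u           ≡⟨ cong (lookup A u xor_) (lookup∘tabulate _ u) ⟩
  lookup A u xor (lookup A u xor lookup B u) ≡⟨ xor-cancel (lookup A u) (lookup B u) ⟩
  lookup B u                                ∎
  where
  open ≡-Reasoning
  xor-cancel : ∀ a b → a xor (a xor b) ≡ b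
  xor-cancel true  true  = refl
  xor-cancel true  false = refl
  xor-cancel false b     = refl

lookup-∖ : (A B : Subset ν) → ∀ u → lookup (A ∖ B) u ≡ lookup A u ∧ not (lookup B u)
lookup-∖ A B u = trans (lookup∘tabulate _ u) (on-bits (lookup A u) (lookup B u))
  where
  on-bits : ∀ a b → does ((a ≟ᵇ true) ×-dec ¬? (b ≟ᵇ true)) ≡ a ∧ not b
  on-bits true  true  = refl
  on-bits true  false = refl
  on-bits false b     = refl

-- |A ⊖ B| + |A| = |A ∪ B| + |A ∖ B| and |A ∪ B| = |B| + |A ∖ B|. Keeping |A| on the left avoids
-- truncated subtraction.
size-⊖ : (A B : Subset ν) → ∣ A ⊖ B ∣ + ∣ A ∣ ≡ ∣ B ∣ + (∣ A ∖ B ∣ + ∣ A ∖ B ∣)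
size-⊖ {ν} A B = trans (size-balance (A ⊖ B) A B∪A (A ∖ B) first) (trans (+-comm _ ∣ A ∖ B ∣)
  (trans (cong (∣ A ∖ B ∣ +_) size-∪) (trans (+-comm ∣ A ∖ B ∣ _) (+-assoc ∣ B ∣ _ _))))
  where
  B∪A = tabulate λ u → lookup B u ∨ lookup A u
  first : ∀ u → indicator (lookup (A ⊖ B) u) + indicator (lookup A u) ≡ indicator (lookup B∪A u) + indicator (lookup (A ∖ B) u)
  first u rewrite lookup-∖ A B u | lookup∘tabulate (λ u → lookup A u xor lookup B u) u | lookup∘tabulate (λ u → lookup B u ∨ lookup A u) u
    with lookup A u | lookup B u
  ... | true  | true  = refl
  ... | true  | false = refl
  ... | false | true  = refl
  ... | false | false = refl
  size-∪ : ∣ B∪A ∣ ≡ ∣ B ∣ + ∣ A ∖ B ∣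
  size-∪ = trans (sym (trans (cong (∣ B∪A ∣ +_) (∣⊥∣≡0 ν)) (+-comm _ 0))) (size-balance B∪A ∅ B (A ∖ B) second)
    where
    second : ∀ u → indicator (lookup B∪A u) + indicator (lookup ∅ u) ≡ indicator (lookup B u) + indicator (lookup (A ∖ B) u)
    second u rewrite lookup-∖ A B u | lookup-replicate u false | lookup∘tabulate (λ u → lookup B u ∨ lookup A u) u
      with lookup A u | lookup B u
    ... | true  | true  = refl
    ... | true  | false = refl
    ... | false | true  = refl
    ... | false | false = refl

shrink : ∀ m (K : Subset ν) → m ≤ ∣ K ∣ → ∃[ B ] (∀ u → u ∊ B → u ∊ K) × ∣ B ∣ ≡ m
shrink {ν} zero K          le       = ∅ , (λ u mem → contradiction mem (∉∅ u)) , ∣⊥∣≡0 ν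
shrink (suc m) (true ∷ K)  (s≤s le) =
  let B , sub , eq = shrink m K le in true ∷ B , (λ { zero mem → mem ; (suc u) mem → sub u mem }) , cong suc eq
shrink (suc m) (false ∷ K) le       =
  let B , sub , eq = shrink (suc m) K le in false ∷ B , (λ { zero mem → mem ; (suc u) mem → sub u mem }) , eq

elements : (A : Subset ν) → ∃[ e ] Injective {A = Fin ∣ A ∣} {B = Fin ν} _≡_ _≡_ e × ∀ i → e i ∊ A
elements []          = (λ ()) , (λ { {()} }) , λ ()
elements (false ∷ A) =
  let e , inj , mem = elements A in suc ∘ e , (λ eq → inj (suc-injective eq)) , mem
elements (true ∷ A) =
  let e , inj , mem = elements A in
  (λ { zero → zero ; (suc i) → suc (e i) }) ,
  (λ { {zero} {zero} _ → refl ; {suc i} {suc j} eq → cong suc (inj (suc-injective eq)) }) ,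
  λ { zero → refl ; (suc i) → mem i }

size-injection : ∀ {m} (A : Subset ν) (f : ∀ u → u ∊ A → Fin m) →
                 (∀ {u v} p q → f u p ≡ f v q → u ≡ v) → ∣ A ∣ ≤ m
size-injection A f inj =
  let e , e-inj , mem = elements A in injective⇒≤ {f = λ i → f (e i) (mem i)} λ eq → e-inj (inj _ _ eq)

-- `Pick m A B`: B arises from A by adding m new elements one after the other.
Pick : ℕ → Subset ν → Subset ν → Set
Pick zero    A B = A ≡ B
Pick (suc m) A B = ∃[ u ] ¬ u ∊ A × Pick m (A [ u ]≔ true) B

pick-size : ∀ m {A B : Subset ν} → Pick m A B → ∣ B ∣ ≡ m + ∣ A ∣
pick-size zero    refl                = refl
pick-size (suc m) {A} (u , u∉A , pk) = trans (pick-size m pk) (trans (cong (m +_) (size-insert {A = A} u∉A)) (+-suc m _))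

pick-complete : ∀ m {A B : Subset ν} → (∀ u → u ∊ A → u ∊ B) → ∣ B ∣ ≡ m + ∣ A ∣ → Pick m A B
pick-complete zero {A} {B} sub eq = subset-antisym sub back
  where
  back : ∀ u → u ∊ B → u ∊ A
  back u u∊B with u ∊? A
  ... | yes u∊A = u∊A
  ... | no u∉A  = contradiction
    (≤-trans (≤-reflexive (sym (size-insert {A = A} {u} u∉A)))
      (≤-trans (size-mono {A = A [ u ]≔ true} {B} λ v mem → Sum.[ (λ { refl → u∊B }) , sub v ] (insert-∊ {A = A} mem)) (≤-reflexive eq)))
    (<-irrefl refl)
pick-complete (suc m) {A} {B} sub eq with any? (λ u → (u ∊? B) ×-dec ¬? (u ∊? A))
... | yes (u , u∊B , u∉A) =
  u , u∉A , pick-complete m (λ v mem → Sum.[ (λ { refl → u∊B }) , sub v ] (insert-∊ {A = A} mem))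
    (trans eq (trans (sym (+-suc m _)) (cong (m +_) (sym (size-insert {A = A} {u} u∉A)))))
... | no none = contradiction
    (≤-trans (s≤s (m≤n+m ∣ A ∣ m)) (≤-trans (≤-reflexive (sym eq)) (size-mono {A = B} {A} back)))
    (<-irrefl refl)
  where
  back : ∀ u → u ∊ B → u ∊ A
  back u u∊B with u ∊? A
  ... | yes u∊A = u∊A
  ... | no u∉A  = contradiction (u , u∊B , u∉A) none

pick-∅ : ∀ m {B : Subset ν} → Pick m ∅ B ⇔ ∣ B ∣ ≡ m
pick-∅ {ν} m = mk⇔ (λ pk → trans (pick-size m pk) zero-size)
  λ eq → pick-complete m (λ u mem → contradiction mem (∉∅ u)) (trans eq (sym zero-size))
  where
  zero-size : m + ∣ ∅ {ν} ∣ ≡ m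
  zero-size = trans (cong (m +_) (∣⊥∣≡0 ν)) (+-comm m 0)

-- Maximal independent sets and candidates for the independent part

module _ (G : Graph) where
  open Graph G using (Adj; adj-sym; adj-irrefl) renaming (order to n; adj to adjacent)

  adj? : ∀ u v → Dec (Adj u v)
  adj? u v = adjacent u v ≟ᵇ true

  Indep : Subset n → Set
  Indep A = ∀ u v → u ∊ A → v ∊ A → ¬ Adj u v

  Dominated : Subset n → Fin n → Set
  Dominated A v = v ∊ A ⊎ ∃[ w ] w ∊ A × Adj v w

  -- Maximal independent sets are the independent dominating ones. This form quantifies over
  -- vertices instead of subsets, so loops can test it.
  MaxInd : Subset n → Set
  MaxInd A = Indep A × ∀ v → Dominated A v

  indep-insert : ∀ {A u} → Indep A → ¬ (∃[ w ] w ∊ A × Adj u w) → Indep (A [ u ]≔ true)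
  indep-insert {A} {u} ind none v w v∊ w∊ vw with insert-∊ {A = A} v∊ | insert-∊ {A = A} w∊
  ... | inj₁ refl | inj₁ refl = adj-irrefl vw
  ... | inj₁ refl | inj₂ w∊A  = none (w , w∊A , vw)
  ... | inj₂ v∊A  | inj₁ refl = none (v , v∊A , adj-sym vw)
  ... | inj₂ v∊A  | inj₂ w∊A  = ind v w v∊A w∊A vw

  private
    extend-over : ∀ m (f : Fin m → Fin n) A → Indep A →
                  ∃[ B ] (∀ u → u ∊ A → u ∊ B) × Indep B × ∀ i → Dominated B (f i)
    extend-over zero    f A ind = A , (λ _ → id) , ind , λ ()
    extend-over (suc m) f A ind with any? (λ w → (w ∊? A) ×-dec adj? (f zero) w)
    ... | yes (w , w∊A , vw) =
      let B , sub , indB , dom = extend-over m (f ∘ suc) A ind in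
      B , sub , indB , λ { zero → inj₂ (w , sub w w∊A , vw) ; (suc i) → dom i }
    ... | no none =
      let B , sub , indB , dom = extend-over m (f ∘ suc) (A [ f zero ]≔ true) (indep-insert {A} ind none) in
      B , (λ u u∊A → sub u (∊-insert {A = A} u∊A)) , indB ,
      λ { zero → inj₁ (sub _ (∊-insert-same {A = A})) ; (suc i) → dom i }

  extend : ∀ A → Indep A → ∃[ B ] (∀ u → u ∊ A → u ∊ B) × MaxInd B
  extend A ind = let B , sub , indB , dom = extend-over n id A ind in B , sub , indB , dom

  maximal⇒MaxInd : ∀ {A} → MaximalIndependent G A → MaxInd A
  maximal⇒MaxInd {A} (ind , max) = ind′ , dom
    where
    ind′ : Indep A
    ind′ u v p q = ind (lookup⇒[]= u A p) (lookup⇒[]= v A q)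
    dom : ∀ v → Dominated A v
    dom v with any? (λ w → (w ∊? A) ×-dec adj? v w)
    ... | yes w   = inj₂ w
    ... | no none = inj₁ ([]=⇒lookup (max (A [ v ]≔ true)
            (λ {x} {y} p q → indep-insert {A} ind′ none x y ([]=⇒lookup p) ([]=⇒lookup q))
            (λ {x} p → lookup⇒[]= x _ (∊-insert {A = A} ([]=⇒lookup p)))
            (lookup⇒[]= v _ (∊-insert-same {A = A}))))

  MaxInd⇒maximal : ∀ {A} → MaxInd A → MaximalIndependent G A
  MaxInd⇒maximal {A} (ind , dom) =
    (λ {u} {v} p q → ind u v ([]=⇒lookup p) ([]=⇒lookup q)) ,
    λ T indT A⊆T {v} v∈T → Sum.[ lookup⇒[]= v A , (λ (w , w∊A , vw) → contradiction vw (indT v∈T (A⊆T (lookup⇒[]= w A w∊A)))) ] (dom v)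

  Uniform : Set
  Uniform = ∀ A B → MaxInd A → MaxInd B → ∣ A ∣ ≡ ∣ B ∣

  uniform⇔well-covered : Uniform ⇔ WellCovered G
  uniform⇔well-covered = mk⇔ (λ un S T p q → un S T (maximal⇒MaxInd p) (maximal⇒MaxInd q))
    λ wc A B p q → wc A B (MaxInd⇒maximal p) (MaxInd⇒maximal q)

  indep-size : Uniform → ∀ {I A} → MaxInd I → Indep A → ∣ A ∣ ≤ ∣ I ∣
  indep-size un {I} {A} maxI indA =
    let B , sub , maxB = extend A indA in ≤-trans (size-mono {A = A} {B} sub) (≤-reflexive (un B I maxB maxI))

  -- Excluding the single size ℓ + 1 excludes all larger ones, as subsets of independent sets are
  -- independent; so ℓ + 1 nested loops can test it.
  Sparse : ℕ → Subset n → Set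
  Sparse ℓ S = ∀ B → ∣ B ∣ ≡ suc ℓ → ¬ (Indep B × ∀ u → u ∊ B → ¬ u ∊ S)

  sparse-size : ∀ {ℓ S B} → Sparse ℓ S → Indep B → (∀ u → u ∊ B → ¬ u ∊ S) → ∣ B ∣ ≤ ℓ
  sparse-size {ℓ} {S} {B} sp ind dis with ∣ B ∣ ≤? ℓ
  ... | yes le = le
  ... | no ≰   =
    let C , sub , eq = shrink (suc ℓ) B (≰⇒> ≰) in
    contradiction ((λ u v p q → ind u v (sub u p) (sub v q)) , λ u p → dis u (sub u p)) (sp C eq)

  -- The only candidate for a maximal independent set that meets the complement of S in K.
  completion? : (S K : Subset n) → ∀ v → Dec (v ∊ K ⊎ v ∊ S × ∀ w → w ∊ K → ¬ Adj w v)
  completion? S K v = (v ∊? K) ⊎-dec ((v ∊? S) ×-dec all? λ w → (w ∊? K) →-dec ¬? (adj? w v))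

  completion : Subset n → Subset n → Subset n
  completion S K = comprehension (completion? S K)

  -- K ranges over all small sets, independent or not; a completion that is not a maximal
  -- independent set is passed over.
  Checked : ℕ → Subset n → Subset n → Set
  Checked ℓ I S = ∀ K → ∣ K ∣ ≤ ℓ → MaxInd (completion S K) → ∣ completion S K ∣ ≡ ∣ I ∣

  -- A maximal independent set M is the completion of M ∖ S: a vertex of S without neighbours in M ∖
  -- S has none in M ∩ S either, since S is independent, and so lies in M by domination. Sparsity
  -- bounds |M ∖ S| by ℓ.
  checked⇒uniform : ∀ {ℓ I S} → Indep S → Sparse ℓ S → Checked ℓ I S → Uniform
  checked⇒uniform {ℓ} {I} {S} indS sp ch A B maxA maxB = trans (size A maxA) (sym (size B maxB))
    where
    size : ∀ M → MaxInd M → ∣ M ∣ ≡ ∣ I ∣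
    size M maxM@(indM , domM) = subst (λ M → ∣ M ∣ ≡ ∣ I ∣) eq (ch Z small (subst MaxInd (sym eq) maxM))
      where
      outside? : ∀ u → Dec (u ∊ M × ¬ u ∊ S)
      outside? u = (u ∊? M) ×-dec ¬? (u ∊? S)
      Z = M ∖ S
      Z∊M : ∀ {u} → u ∊ Z → u ∊ M
      Z∊M p = proj₁ (comprehension-∊ outside? p)
      small : ∣ Z ∣ ≤ ℓ
      small = sparse-size {S = S} {Z} sp (λ u v p q → indM u v (Z∊M p) (Z∊M q)) λ u p → proj₂ (comprehension-∊ outside? p)
      to-M : ∀ u → u ∊ completion S Z → u ∊ M
      to-M u p with comprehension-∊ (completion? S Z) p
      ... | inj₁ u∊Z         = Z∊M u∊Z
      ... | inj₂ (u∊S , free) with domM u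
      ...   | inj₁ u∊M            = u∊M
      ...   | inj₂ (w , w∊M , uw) with w ∊? S
      ...     | yes w∊S = contradiction uw (indS u w u∊S w∊S)
      ...     | no w∉S  = contradiction (adj-sym uw) (free w (∊-comprehension outside? (w∊M , w∉S)))
      from-M : ∀ u → u ∊ M → u ∊ completion S Z
      from-M u u∊M = ∊-comprehension (completion? S Z) (by-side (u ∊? S))
        where
        by-side : Dec (u ∊ S) → u ∊ Z ⊎ u ∊ S × ∀ w → w ∊ Z → ¬ Adj w u
        by-side (yes u∊S) = inj₂ (u∊S , λ w w∊Z → indM w u (Z∊M w∊Z) u∊M)
        by-side (no u∉S)  = inj₁ (∊-comprehension outside? (u∊M , u∉S))
      eq : completion S Z ≡ M
      eq = subset-antisym to-M from-M

  uniform⇒near : ∀ {ℓ I S} → Uniform → MaxInd I → Indep S → Sparse ℓ S → ∣ I ⊖ S ∣ ≤ ℓ + ℓ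
  uniform⇒near {ℓ} {I} {S} un maxI indS sp =
    ≤-trans (+-cancelʳ-≤ (∣ I ∣) (∣ I ⊖ S ∣) (∣ I ∖ S ∣ + ∣ I ∖ S ∣) (≤-trans (≤-reflexive (size-⊖ I S))
        (≤-trans (+-monoˡ-≤ (∣ I ∖ S ∣ + ∣ I ∖ S ∣) (indep-size un {I} {S} maxI indS)) (≤-reflexive (+-comm (∣ I ∣) _)))))
      (+-mono-≤ small small)
    where
    I∖S? : ∀ u → Dec (u ∊ I × ¬ u ∊ S)
    I∖S? u = (u ∊? I) ×-dec ¬? (u ∊? S)
    small : ∣ I ∖ S ∣ ≤ ℓ
    small = sparse-size {S = S} {I ∖ S} sp
      (λ u v p q → proj₁ maxI u v (proj₁ (comprehension-∊ I∖S? p)) (proj₁ (comprehension-∊ I∖S? q)))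
      λ u p → proj₂ (comprehension-∊ I∖S? p)

-- Well-covered bipartite graphs

size-sum : ∀ {n} (A : Subset n) → ∣ A ∣ ≡ sum λ u → indicator (lookup A u)
size-sum []      = refl
size-sum (a ∷ A) = trans (size-∷ a A) (cong (indicator a +_) (size-sum A))

∨-true : ∀ a {b} → a ∨ b ≡ true → a ≡ true ⊎ b ≡ true
∨-true true  eq = inj₁ refl
∨-true false eq = inj₂ eq

∧-true : ∀ a {b} → a ∧ b ≡ true → a ≡ true × b ≡ true
∧-true true  eq = refl , eq
∧-true false ()

infixl 6 _∪_
_∪_ : ∀ {n} → Subset n → Subset n → Subset n
A ∪ B = tabulate λ u → lookup A u ∨ lookup B u

module _ {n : ℕ} {A B : Subset n} {u : Fin n} where

  ∪-∊ : u ∊ A ∪ B → u ∊ A ⊎ u ∊ B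
  ∪-∊ mem = ∨-true (lookup A u) (trans (sym (lookup∘tabulate _ u)) mem)

  ∊-∪ˡ : u ∊ A → u ∊ A ∪ B
  ∊-∪ˡ mem = trans (lookup∘tabulate _ u) (cong (_∨ lookup B u) mem)

  ∊-∪ʳ : u ∊ B → u ∊ A ∪ B
  ∊-∪ʳ mem = trans (lookup∘tabulate _ u) (trans (cong (lookup A u ∨_) mem) (or-true (lookup A u)))
    where
    or-true : ∀ a → a ∨ true ≡ true
    or-true true  = refl
    or-true false = refl

size-disjoint-∪ : ∀ {n} (A B : Subset n) → (∀ u → u ∊ A → ¬ u ∊ B) → ∣ A ∪ B ∣ ≡ ∣ A ∣ + ∣ B ∣
size-disjoint-∪ {n} A B dis =
  trans (sym (trans (cong (∣ A ∪ B ∣ +_) (∣⊥∣≡0 n)) (+-comm _ 0))) (size-balance (A ∪ B) ∅ A B pointwise)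
  where
  pointwise : ∀ u → indicator (lookup (A ∪ B) u) + indicator (lookup ∅ u) ≡ indicator (lookup A u) + indicator (lookup B u)
  pointwise u rewrite lookup-replicate u false | lookup∘tabulate (λ u → lookup A u ∨ lookup B u) u
    with lookup A u | lookup B u | dis u
  ... | true  | true  | d = contradiction refl (d refl)
  ... | true  | false | _ = refl
  ... | false | true  | _ = refl
  ... | false | false | _ = refl

module _ (G : Graph) where
  open Graph G using (Adj; adj-sym; adj-irrefl) renaming (order to n; adj to adjacent)

  Good : Fin n → Fin n → Set
  Good x y = Adj x y × ∀ a b → Adj x a × Adj y b → Adj a b

  good? : ∀ x y → Dec (Good x y)
  good? x y = adj? G x y ×-dec all? λ a → all? λ b → (adj? G x a ×-dec adj? G y b) →-dec adj? G a b

  good-sym : ∀ {x y} → Good x y → Good y x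
  good-sym (xy , h) = adj-sym xy , λ a b (ya , xb) → adj-sym (h b a (xb , ya))

  partners : Fin n → Subset n
  partners x = comprehension (good? x)

  Covered : Set
  Covered = ∀ x → (∃[ y ] Adj x y) → ∃[ y ] Good x y

  Balanced : Set
  Balanced = ∀ x y → Good x y → ∣ partners x ∣ ≡ ∣ partners y ∣

  -- Every good edge from I ∖ J leads to J ∖ I and conversely, and its ends
  -- have equally many partners f.  Giving each good edge the weight n! / f
  -- therefore counts both n! |I ∖ J| and n! |J ∖ I|.
  module _ (covered : Covered) (balanced : Balanced) where

    -- If y were outside J, then x and y would have neighbours a and b in J, and the complete join
    -- of N(x) and N(y) would put the edge ab inside J.
    crossing : ∀ {I J x y} → MaxInd G I → MaxInd G J → x ∊ I × ¬ x ∊ J → Good x y → y ∊ J × ¬ y ∊ I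
    crossing {I} {J} {x} {y} (indI , _) (indJ , domJ) (x∊I , x∉J) (xy , join) = y∊J (domJ x) (domJ y) , λ y∊I → indI x y x∊I y∊I xy
      where
      y∊J : Dominated G J x → Dominated G J y → y ∊ J
      y∊J _               (inj₁ y∊J)          = y∊J
      y∊J (inj₁ x∊J)      _                   = contradiction x∊J x∉J
      y∊J (inj₂ (a , a∊J , xa)) (inj₂ (b , b∊J , yb)) = contradiction (join a b (xa , yb)) (indJ a b a∊J b∊J)

    -- Every number from 1 to n divides n!, so the shares are exact quotients. The value at 0 is
    -- arbitrary, as `share-*` is stated for positive degrees.
    share : ℕ → ℕ
    share zero    = 0
    share (suc k) = n ! / suc k

    share-* : ∀ {k} → 1 ≤ k → k ≤ n → k * share k ≡ n !
    share-* {suc k} _ le = m*[n/m]≡n (∣-trans (m∣m*n (k !)) (m≤n⇒m!∣n! le))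

    degree : Fin n → ℕ
    degree x = ∣ partners x ∣

    good : Fin n → Fin n → Bool
    good x y = does (good? x y)

    weight : Subset n → Subset n → Fin n → Fin n → ℕ
    weight I J x y = indicator (lookup (I ∖ J) x) * (indicator (good x y) * share (degree x))

    diff? : ∀ (I J : Subset n) u → Dec (u ∊ I × ¬ u ∊ J)
    diff? I J u = (u ∊? I) ×-dec ¬? (u ∊? J)

    module _ (I J : Subset n) (maxI : MaxInd G I) (maxJ : MaxInd G J) where

      -- A vertex x of I ∖ J is dominated by J but not in it, so it has a neighbour and, by
      -- `Covered`, a partner. Its degree is then positive and its equal shares add up to n!.
      weight-row : ∀ x → sum (weight I J x) ≡ indicator (lookup (I ∖ J) x) * n !
      weight-row x = trans (sym (*-distribˡ-sum (indicator (lookup (I ∖ J) x)) (λ y → indicator (good x y) * share (degree x)))) (row (lookup (I ∖ J) x) refl)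
        where
        row : ∀ b → lookup (I ∖ J) x ≡ b →
              indicator b * sum (λ y → indicator (good x y) * share (degree x)) ≡ indicator b * n !
        row false _  = refl
        row true mem = cong (1 *_) (begin
          sum (λ y → indicator (good x y) * share (degree x))  ≡⟨ *-distribʳ-sum (share (degree x)) (indicator ∘ good x) ⟨
          sum (indicator ∘ good x) * share (degree x)
            ≡⟨ cong (_* share (degree x)) (trans (sum-cong-≗ λ y → cong indicator (sym (lookup∘tabulate (good x) y))) (sym (size-sum (partners x)))) ⟩
          degree x * share (degree x)                          ≡⟨ share-* positive (∣p∣≤n (partners x)) ⟩
          n !                                                  ∎)
          where
          open ≡-Reasoning
          x∊I,x∉J = comprehension-∊ (diff? I J) mem
          partner : ∃[ y ] Good x y
          partner = Sum.[ (λ x∊J → contradiction x∊J (proj₂ x∊I,x∉J)) , (λ (w , _ , xw) → covered x (w , xw)) ] (proj₂ maxJ x)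
          positive : 1 ≤ degree x
          positive = ≤-trans (s≤s z≤n) (≤-reflexive (sym (size-remove {A = partners x} (∊-comprehension (good? x) (proj₂ partner)))))

      weight-total : sum (λ x → sum (weight I J x)) ≡ ∣ I ∖ J ∣ * n !
      weight-total = begin
        sum (λ x → sum (weight I J x))                       ≡⟨ sum-cong-≗ weight-row ⟩
        sum (λ x → indicator (lookup (I ∖ J) x) * n !)       ≡⟨ *-distribʳ-sum (n !) (λ x → indicator (lookup (I ∖ J) x)) ⟨
        sum (λ x → indicator (lookup (I ∖ J) x)) * n !       ≡⟨ cong (_* n !) (size-sum (I ∖ J)) ⟨
        ∣ I ∖ J ∣ * n !                                      ∎
        where open ≡-Reasoning

    weight-sym : ∀ {I J} → MaxInd G I → MaxInd G J → ∀ x y → weight I J x y ≡ weight J I y x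
    weight-sym {I} {J} maxI maxJ x y = cases (good? x y) (good? y x)
      where
      cases : (d : Dec (Good x y)) (d′ : Dec (Good y x)) →
              indicator (lookup (I ∖ J) x) * (indicator (does d) * share (degree x)) ≡
              indicator (lookup (J ∖ I) y) * (indicator (does d′) * share (degree y))
      cases (no _)  (no _)   = trans (*-zeroʳ (indicator (lookup (I ∖ J) x))) (sym (*-zeroʳ (indicator (lookup (J ∖ I) y))))
      cases (yes g) (no ¬g)  = contradiction (good-sym g) ¬g
      cases (no ¬g) (yes g)  = contradiction (good-sym g) ¬g
      cases (yes g) (yes g′) = cong₂ (λ b k → indicator b * (1 * share k)) (bit-ext forth back) (balanced x y g)
        where
        forth : x ∊ I ∖ J → y ∊ J ∖ I
        forth mem = ∊-comprehension (diff? J I) (crossing {I} {J} maxI maxJ (comprehension-∊ (diff? I J) mem) g)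
        back : y ∊ J ∖ I → x ∊ I ∖ J
        back mem = ∊-comprehension (diff? I J) (crossing {J} {I} maxJ maxI (comprehension-∊ (diff? J I) mem) g′)

    covered∧balanced⇒uniform : Uniform G
    covered∧balanced⇒uniform I J maxI maxJ = +-cancelʳ-≡ (∣ J ∖ I ∣) (∣ I ∣) (∣ J ∣)
      (trans (size-balance I (J ∖ I) J (I ∖ J) pointwise) (cong (∣ J ∣ +_) equal))
      where
      equal : ∣ I ∖ J ∣ ≡ ∣ J ∖ I ∣
      equal = *-cancelʳ-≡ (∣ I ∖ J ∣) (∣ J ∖ I ∣) (n !) {{n !≢0}} (begin
        ∣ I ∖ J ∣ * n !                          ≡⟨ weight-total I J maxI maxJ ⟨
        sum (λ x → sum (weight I J x))           ≡⟨ ∑-comm (weight I J) ⟩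
        sum (λ y → sum (λ x → weight I J x y))   ≡⟨ sum-cong-≗ (λ y → sum-cong-≗ λ x → weight-sym {I} {J} maxI maxJ x y) ⟩
        sum (λ y → sum (weight J I y))           ≡⟨ weight-total J I maxJ maxI ⟩
        ∣ J ∖ I ∣ * n !                          ∎)
        where open ≡-Reasoning
      pointwise : ∀ u → indicator (lookup I u) + indicator (lookup (J ∖ I) u) ≡ indicator (lookup J u) + indicator (lookup (I ∖ J) u)
      pointwise u rewrite lookup-∖ I J u | lookup-∖ J I u
        with lookup I u | lookup J u
      ... | true  | true  = refl
      ... | true  | false = refl
      ... | false | true  = refl
      ... | false | false = refl

  -- Necessity: exchanging maximum independent sets in a bipartite graph

  module _ (side : Fin n → Bool) (crosses : ∀ {u v} → Adj u v → side u ≢ side v) (uniform : Uniform G) where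

    other-side : ∀ {a b c : Bool} → a ≢ c → b ≢ c → a ≡ b
    other-side {true}  {true}  _ _ = refl
    other-side {false} {false} _ _ = refl
    other-side {true}  {false} {true}  p _ = contradiction refl p
    other-side {true}  {false} {false} _ q = contradiction refl q
    other-side {false} {true}  {true}  _ q = contradiction refl q
    other-side {false} {true}  {false} p _ = contradiction refl p

    -- The maximum independent sets of a bipartite graph form a lattice, with
    -- join `merge s` and meet `merge (not s)`.
    module _ (s : Bool) where

      merge : Subset n → Subset n → Subset n
      merge I J = tabulate λ u → if does (side u ≟ᵇ s) then lookup I u ∨ lookup J u else lookup I u ∧ lookup J u

      merge-near : ∀ {I J u} → side u ≡ s → u ∊ merge I J → u ∊ I ⊎ u ∊ J
      merge-near {I} {J} {u} su mem with side u ≟ᵇ s | lookup∘tabulate (λ u → if does (side u ≟ᵇ s) then lookup I u ∨ lookup J u else lookup I u ∧ lookup J u) u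
      ... | yes _ | eq = ∨-true (lookup I u) (trans (sym eq) mem)
      ... | no ¬p | _  = contradiction su ¬p

      near-merge : ∀ {I J u} → side u ≡ s → u ∊ I ⊎ u ∊ J → u ∊ merge I J
      near-merge {I} {J} {u} su mem with side u ≟ᵇ s | lookup∘tabulate (λ u → if does (side u ≟ᵇ s) then lookup I u ∨ lookup J u else lookup I u ∧ lookup J u) u
      ... | yes _ | eq = trans eq (true-∨ (lookup I u) mem)
        where
        true-∨ : ∀ a {b} → a ≡ true ⊎ b ≡ true → a ∨ b ≡ true
        true-∨ true  _           = refl
        true-∨ false (inj₂ refl) = refl
      ... | no ¬p | _  = contradiction su ¬p

      merge-far : ∀ {I J u} → side u ≢ s → u ∊ merge I J → u ∊ I × u ∊ J
      merge-far {I} {J} {u} su mem with side u ≟ᵇ s | lookup∘tabulate (λ u → if does (side u ≟ᵇ s) then lookup I u ∨ lookup J u else lookup I u ∧ lookup J u) u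
      ... | yes p | _  = contradiction p su
      ... | no _  | eq = ∧-true (lookup I u) (trans (sym eq) mem)

      merge-indep : ∀ {I J} → Indep G I → Indep G J → Indep G (merge I J)
      merge-indep {I} {J} indI indJ u v u∊ v∊ uv with side u ≟ᵇ s | side v ≟ᵇ s
      ... | yes p | yes q = crosses uv (trans p (sym q))
      ... | no p  | no q  = crosses uv (other-side p q)
      ... | yes p | no q  =
        let v∊I , v∊J = merge-far {I} {J} q v∊ in Sum.[ (λ u∊I → indI u v u∊I v∊I uv) , (λ u∊J → indJ u v u∊J v∊J uv) ] (merge-near {I} {J} p u∊)
      ... | no p  | yes q =
        let u∊I , u∊J = merge-far {I} {J} p u∊ in Sum.[ (λ v∊I → indI u v u∊I v∊I uv) , (λ v∊J → indJ u v u∊J v∊J uv) ] (merge-near {I} {J} q v∊)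

    -- At each vertex one merge takes the union and the other the intersection.
    size-merge : ∀ I J s → ∣ merge s I J ∣ + ∣ merge (not s) I J ∣ ≡ ∣ I ∣ + ∣ J ∣
    size-merge I J s = size-balance (merge s I J) (merge (not s) I J) I J pointwise
      where
      pointwise : ∀ u → indicator (lookup (merge s I J) u) + indicator (lookup (merge (not s) I J) u) ≡ indicator (lookup I u) + indicator (lookup J u)
      pointwise u rewrite lookup∘tabulate (λ u → if does (side u ≟ᵇ s) then lookup I u ∨ lookup J u else lookup I u ∧ lookup J u) u
                        | lookup∘tabulate (λ u → if does (side u ≟ᵇ not s) then lookup I u ∨ lookup J u else lookup I u ∧ lookup J u) u
        = on-bits (side u) s (lookup I u) (lookup J u)
        where
        pick : Bool → Bool → Bool → Bool → ℕ
        pick a s i j = indicator (if does (a ≟ᵇ s) then i ∨ j else i ∧ j)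
        swap : ∀ i j → indicator (i ∨ j) + indicator (i ∧ j) ≡ indicator i + indicator j
        swap true  true  = refl
        swap true  false = refl
        swap false true  = refl
        swap false false = refl
        on-bits : ∀ a s i j → pick a s i j + pick a (not s) i j ≡ indicator i + indicator j
        on-bits true  true  i j = swap i j
        on-bits true  false i j = trans (+-comm (indicator (i ∧ j)) _) (swap i j)
        on-bits false true  i j = trans (+-comm (indicator (i ∧ j)) _) (swap i j)
        on-bits false false i j = swap i j

    large⇒MaxInd : ∀ {I A} → MaxInd G I → Indep G A → ∣ I ∣ ≤ ∣ A ∣ → MaxInd G A
    large⇒MaxInd {I} {A} maxI indA le = indA , dom
      where
      dom : ∀ v → Dominated G A v
      dom v with v ∊? A | any? (λ w → (w ∊? A) ×-dec adj? G v w)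
      ... | yes v∊A | _       = inj₁ v∊A
      ... | no _    | yes w   = inj₂ w
      ... | no v∉A  | no none = contradiction
        (≤-trans (≤-trans (s≤s le) (≤-reflexive (sym (size-insert {A = A} v∉A))))
          (indep-size G uniform {I} {A [ v ]≔ true} maxI (indep-insert G {A} indA none)))
        (<-irrefl refl)

    -- The two merges have |I| + |J| vertices in total, and the opposite one, being independent, has
    -- at most |J|. That leaves at least |I| for this one, the largest possible size.
    merge-MaxInd : ∀ s {I J} → MaxInd G I → MaxInd G J → MaxInd G (merge s I J)
    merge-MaxInd s {I} {J} maxI@(indI , _) maxJ@(indJ , _) = large⇒MaxInd {I} {merge s I J} maxI (merge-indep s {I} {J} indI indJ)
      (+-cancelʳ-≤ (∣ J ∣) (∣ I ∣) (∣ merge s I J ∣) (≤-trans (≤-reflexive (sym (size-merge I J s)))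
        (+-monoʳ-≤ (∣ merge s I J ∣) (indep-size G uniform {J} {merge (not s) I J} maxJ (merge-indep (not s) {I} {J} indI indJ)))))

    -- The merge over all neighbours y of x of maximal independent sets
    -- containing y and all vertices on the side of x outside N(y) avoids x,
    -- so it contains a neighbour of x, which is a partner of x.
    uniform⇒covered : Covered
    uniform⇒covered x (y₀ , xy₀) = partner (proj₂ maxM x)
      where
      s = side x
      apart? : ∀ y u → Dec (u ≡ y ⊎ side u ≡ s × ¬ Adj u y)
      apart? y u = (u ≟ y) ⊎-dec ((side u ≟ᵇ s) ×-dec ¬? (adj? G u y))
      apart : Fin n → Subset n
      apart y = comprehension (apart? y)
      apart-indep : ∀ y → Indep G (apart y)
      apart-indep y u v p q uv with comprehension-∊ (apart? y) p | comprehension-∊ (apart? y) q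
      ... | inj₁ refl       | inj₁ refl       = adj-irrefl uv
      ... | inj₁ refl       | inj₂ (_ , ¬vy)  = ¬vy (adj-sym uv)
      ... | inj₂ (_ , ¬uy)  | inj₁ refl       = ¬uy uv
      ... | inj₂ (su , _)   | inj₂ (sv , _)   = crosses uv (trans su (sym sv))
      Avoids : Subset n → Set
      Avoids I = MaxInd G I × ¬ x ∊ I
      Holds : Subset n → Fin n → Set
      Holds I y = Adj x y → ∀ b → side b ≡ s → ¬ Adj b y → b ∊ I
      single : ∀ y → Adj x y → ∃[ I ] Avoids I × Holds I y
      single y xy =
        let I , sub , maxI = extend G (apart y) (apart-indep y) in
        I , (maxI , λ x∊I → proj₁ maxI x y x∊I (sub y (∊-comprehension (apart? y) (inj₁ refl))) xy) ,
        λ _ b sb ¬by → sub b (∊-comprehension (apart? y) (inj₂ (sb , ¬by)))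
      join : ∀ m (f : Fin m → Fin n) → ∃[ I ] Avoids I × ∀ i → Holds I (f i)
      -- At the start any maximal independent set avoiding x will do; y₀ provides one.
      join zero    f = let I , avoids , _ = single y₀ xy₀ in I , avoids , λ ()
      join (suc m) f with join m (f ∘ suc) | adj? G x (f zero)
      ... | I , avoids , holds | no ¬adj = I , avoids , λ { zero xf → contradiction xf ¬adj ; (suc i) → holds i }
      ... | I , (maxI , x∉I) , holds | yes xf =
        let J , (maxJ , x∉J) , holdJ = single (f zero) xf in
        merge s I J , (merge-MaxInd s {I} {J} maxI maxJ , λ x∊ → Sum.[ x∉I , x∉J ] (merge-near s {I} {J} refl x∊)) ,
        λ { zero    xf b sb ¬by → near-merge s {I} {J} sb (inj₂ (holdJ xf b sb ¬by))
          ; (suc i) xf b sb ¬by → near-merge s {I} {J} sb (inj₁ (holds i xf b sb ¬by)) }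
      M = proj₁ (join n id)
      maxM = proj₁ (proj₁ (proj₂ (join n id)))
      x∉M = proj₂ (proj₁ (proj₂ (join n id)))
      holdsM = proj₂ (proj₂ (join n id))
      partner : Dominated G M x → ∃[ y ] Good x y
      partner (inj₁ x∊M)            = contradiction x∊M x∉M
      partner (inj₂ (y , y∊M , xy)) = y , xy , complete
        where
        complete : ∀ a b → Adj x a × Adj y b → Adj a b
        -- Without the edge ab, the set chosen for a would contain b, and hence M would; but M
        -- contains y, which is adjacent to b.
        complete a b (xa , yb) with adj? G b a
        ... | yes ba = adj-sym ba
        ... | no ¬ba = contradiction (adj-sym yb) (proj₁ maxM b y
          (holdsM a xa b (other-side (λ sb → crosses yb (sym sb)) (crosses xy)) ¬ba) y∊M)

    -- The partners of x are exactly the vertices with the same neighbourhood as y. J collects the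
    -- vertices on the side of x not adjacent to y, and those on the other side whose neighbourhood
    -- is a proper subset of N(y). Adding the partners of x to J gives a maximal independent set,
    -- adding those of y an independent one; well-coveredness compares the two.
    partners-≤ : ∀ x y → Good x y → ∣ partners y ∣ ≤ ∣ partners x ∣
    partners-≤ x y (xy , join) =
      +-cancelˡ-≤ (∣ J ∣) (∣ partners y ∣) (∣ partners x ∣)
        (≤-trans (≤-reflexive (sym (size-disjoint-∪ J (partners y) J∩py)))
          (≤-trans (indep-size G uniform {J ∪ partners x} {J ∪ partners y} (indx , domx) indy)
            (≤-reflexive (size-disjoint-∪ J (partners x) J∩px))))
      where
      s = side x
      below? : ∀ v → Dec (∀ b → Adj v b → Adj y b)
      below? v = all? λ b → adj? G v b →-dec adj? G y b
      miss? : ∀ v → Dec (∃[ b ] Adj y b × ¬ Adj v b)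
      miss? v = any? λ b → adj? G y b ×-dec ¬? (adj? G v b)
      J? : ∀ v → Dec (side v ≡ s × ¬ Adj v y ⊎ side v ≢ s × (∀ b → Adj v b → Adj y b) × ∃[ b ] Adj y b × ¬ Adj v b)
      J? v = ((side v ≟ᵇ s) ×-dec ¬? (adj? G v y)) ⊎-dec (¬? (side v ≟ᵇ s) ×-dec (below? v ×-dec miss? v))
      J : Subset n
      J = comprehension J?
      partner-x : ∀ {z} → z ∊ partners x → side z ≢ s × (∀ b → Adj z b → Adj y b) × (∀ b → Adj y b → Adj z b)
      partner-x p = let xz , h = comprehension-∊ (good? x) p in
        (λ eq → crosses xz (sym eq)) , (λ b zb → h y b (xy , zb)) , λ b yb → join _ b (xz , yb)
      partner-y : ∀ {w} → w ∊ partners y → side w ≡ s × Adj y w × (∀ a → Adj w a → Adj x a)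
      partner-y p = let yw , h = comprehension-∊ (good? y) p in
        other-side (λ eq → crosses yw (sym eq)) (crosses xy) , yw , λ a wa → h x a (adj-sym xy , wa)
      J∩px : ∀ u → u ∊ J → ¬ u ∊ partners x
      J∩px u p q with comprehension-∊ J? p | partner-x q
      ... | inj₁ (su , _)               | ¬su , _     = ¬su su
      ... | inj₂ (_ , _ , b , yb , ¬ub) | _ , _ , all = ¬ub (all b yb)
      J∩py : ∀ u → u ∊ J → ¬ u ∊ partners y
      J∩py u p q with comprehension-∊ J? p | partner-y q
      ... | inj₁ (_ , ¬uy) | _ , yu , _ = ¬uy (adj-sym yu)
      ... | inj₂ (¬su , _) | su , _     = ¬su su
      J-J : ∀ u v → u ∊ J → v ∊ J → ¬ Adj u v
      J-J u v p q uv with comprehension-∊ J? p | comprehension-∊ J? q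
      ... | inj₁ (su , _)        | inj₁ (sv , _)         = crosses uv (trans su (sym sv))
      ... | inj₁ (_ , ¬uy)       | inj₂ (_ , below , _)  = ¬uy (adj-sym (below u (adj-sym uv)))
      ... | inj₂ (_ , below , _) | inj₁ (_ , ¬vy)        = ¬vy (adj-sym (below v uv))
      ... | inj₂ (¬su , _)       | inj₂ (¬sv , _)        = crosses uv (other-side ¬su ¬sv)
      J-px : ∀ u v → u ∊ J → v ∊ partners x → ¬ Adj u v
      J-px u v p q uv with comprehension-∊ J? p | partner-x q
      ... | inj₁ (_ , ¬uy) | _ , below , _ = ¬uy (adj-sym (below u (adj-sym uv)))
      ... | inj₂ (¬su , _) | ¬sv , _       = crosses uv (other-side ¬su ¬sv)
      J-py : ∀ u v → u ∊ J → v ∊ partners y → ¬ Adj u v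
      J-py u v p q uv with comprehension-∊ J? p | partner-y q
      ... | inj₁ (su , _)               | sv , _ , _    = crosses uv (trans su (sym sv))
      -- The partner v has N(v) inside N(x), so the edge uv puts u into N(x); the join with N(y)
      -- would then give the missing edge ub.
      ... | inj₂ (_ , _ , b , yb , ¬ub) | _ , _ , below = ¬ub (join u b (below u (adj-sym uv) , yb))
      union-indep : ∀ {X} → (∀ u v → u ∊ J → v ∊ X → ¬ Adj u v) → (∀ u v → u ∊ X → v ∊ X → ¬ Adj u v) → Indep G (J ∪ X)
      union-indep {X} J-X X-X u v p q uv with ∪-∊ {A = J} {X} p | ∪-∊ {A = J} {X} q
      ... | inj₁ u∊J | inj₁ v∊J = J-J u v u∊J v∊J uv
      ... | inj₁ u∊J | inj₂ v∊X = J-X u v u∊J v∊X uv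
      ... | inj₂ u∊X | inj₁ v∊J = J-X v u v∊J u∊X (adj-sym uv)
      ... | inj₂ u∊X | inj₂ v∊X = X-X u v u∊X v∊X uv
      indx : Indep G (J ∪ partners x)
      indx = union-indep {partners x} J-px λ u v p q uv → crosses uv (other-side (proj₁ (partner-x p)) (proj₁ (partner-x q)))
      indy : Indep G (J ∪ partners y)
      indy = union-indep {partners y} J-py λ u v p q uv → crosses uv (trans (proj₁ (partner-y p)) (sym (proj₁ (partner-y q))))
      in-J : ∀ {v} → _ → v ∊ J ∪ partners x
      in-J {v} p = ∊-∪ˡ {A = J} {partners x} {v} (∊-comprehension J? p)
      in-px : ∀ {v} → Good x v → v ∊ J ∪ partners x
      in-px {v} g = ∊-∪ʳ {A = J} {partners x} {v} (∊-comprehension (good? x) g)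
      domx : ∀ v → Dominated G (J ∪ partners x) v
      domx v with side v ≟ᵇ s
      domx v | yes sv with adj? G v y
      ... | yes vy = inj₂ (y , in-px (xy , join) , vy)
      ... | no ¬vy = inj₁ (in-J (inj₁ (sv , ¬vy)))
      domx v | no ¬sv with any? (λ b → adj? G v b ×-dec ¬? (adj? G y b)) | miss? v
      ... | yes (b , vb , ¬yb) | _ =
        inj₂ (b , in-J (inj₁ (other-side (λ eq → crosses vb (sym eq)) (λ eq → ¬sv (sym eq)) , λ by → ¬yb (adj-sym by))) , vb)
      ... | no below | yes miss = inj₁ (in-J (inj₂ (¬sv , below′ , miss)))
        where
        below′ : ∀ b → Adj v b → Adj y b
        below′ b vb with adj? G y b
        ... | yes yb = yb
        ... | no ¬yb = contradiction (b , vb , ¬yb) below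
      -- Here N(v) = N(y), which makes v a partner of x.
      ... | no below | no ¬miss = inj₁ (in-px (adj-sym (above x (adj-sym xy)) , λ a b (xa , vb) → join a b (xa , below′ b vb)))
        where
        below′ : ∀ b → Adj v b → Adj y b
        below′ b vb with adj? G y b
        ... | yes yb = yb
        ... | no ¬yb = contradiction (b , vb , ¬yb) below
        above : ∀ b → Adj y b → Adj v b
        above b yb with adj? G v b
        ... | yes vb = vb
        ... | no ¬vb = contradiction (b , yb , ¬vb) ¬miss

    uniform⇒balanced : Balanced
    uniform⇒balanced x y g = ≤-antisym (partners-≤ y x (good-sym g)) (partners-≤ x y g)

-- The decision procedures

module _ {s : ℕ} where

  indepᶜ maxIndᶜ greedy pop : ∀ {d} → Fin (suc s) → Cmd s d
  indepᶜ X  = allᶜ (allᶜ (memᶜ 1F X ∧ᶜ memᶜ 0F X ⇒ᶜ notᶜ (adjᶜ 1F 0F)))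
  maxIndᶜ X = indepᶜ X ∧ᶜ allᶜ (memᶜ 0F X ∨ᶜ anyᶜ (memᶜ 0F X ∧ᶜ adjᶜ 1F 0F))
  greedy X  = allᶜ (condᶜ (anyᶜ (memᶜ 0F X ∧ᶜ adjᶜ 1F 0F)) (retᶜ true) (putᶜ 0F X true))
  -- The loop breaks at the first member, having deleted it; negating its answer reports whether
  -- something was removed.
  pop X     = notᶜ (allᶜ (condᶜ (memᶜ 0F X) (putᶜ 0F X false ∧ᶜ retᶜ false) (retᶜ true)))

  assign : ∀ {d} → Fin (suc s) → Cmd s (suc d) → Cmd s d
  assign X c = allᶜ (condᶜ c (putᶜ 0F X true) (putᶜ 0F X false))

  -- Compares the sizes of X and Y, destroying both.
  balance : ∀ {d} → Fin (suc s) → Fin (suc s) → Cmd s d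
  balance X Y = allᶜ (condᶜ (memᶜ 0F X) (putᶜ 0F X false ∧ᶜ pop Y) (retᶜ true)) ∧ᶜ allᶜ (notᶜ (memᶜ 0F Y))

  -- m nested loops add one new vertex each and take it back on both ways out, so X is restored even
  -- after a failure. The recursion on m happens while the command is built, and c is polymorphic in
  -- d because it runs below all these loops.
  pick within : ℕ → Fin (suc s) → (∀ {d} → Cmd s d) → ∀ {d} → Cmd s d
  pick zero    X c = c
  pick (suc m) X c = allᶜ (condᶜ (memᶜ 0F X) (retᶜ true)
    (putᶜ 0F X true ∧ᶜ condᶜ (pick m X c) (putᶜ 0F X false) (putᶜ 0F X false ∧ᶜ retᶜ false)))

  within zero    X c = pick zero X c
  within (suc m) X c = within m X c ∧ᶜ pick (suc m) X c

  -- Colours the vertices along e, one per round: C holds the coloured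
  -- vertices and D those of the first colour.
  module _ (e : ∀ {d} → Fin d → Fin d → Cmd s d) (C D : Fin (suc s)) where

    frontier paint : ∀ {d} → Cmd s (suc (suc d))
    frontier = e 1F 0F ∧ᶜ memᶜ 1F C ∧ᶜ notᶜ (memᶜ 0F C)
    -- The final false ends both loops of the round, so that at most one vertex is painted per round
    -- and the frontier is determined afresh.
    paint    = condᶜ (memᶜ 1F D) (putᶜ 0F D false) (putᶜ 0F D true) ∧ᶜ putᶜ 0F C true ∧ᶜ retᶜ false

    -- The new vertex keeps the bit that D happens to hold: when no edge leaves C, either colour is
    -- good.
    seed : ∀ {d} → Cmd s (suc d)
    seed = condᶜ (memᶜ 0F C) (retᶜ true) (putᶜ 0F C true ∧ᶜ retᶜ false)

    round properᶜ colourableᶜ : ∀ {d} → Cmd s d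
    round       = condᶜ (allᶜ (allᶜ (condᶜ frontier paint (retᶜ true)))) (condᶜ (allᶜ seed) (retᶜ true) (retᶜ true)) (retᶜ true)
    properᶜ     = allᶜ (allᶜ (e 1F 0F ⇒ᶜ condᶜ (memᶜ 1F D) (notᶜ (memᶜ 0F D)) (memᶜ 0F D)))
    -- The loop over all vertices acts as a counter of n rounds, enough to colour everything. D may
    -- start with any content, since only its bits on C are meaningful.
    colourableᶜ = assign C (retᶜ false) ∧ᶜ allᶜ round ∧ᶜ properᶜ

  goodᶜ : ∀ {d} → Fin d → Fin d → Cmd s d
  goodᶜ i j = adjᶜ i j ∧ᶜ allᶜ (allᶜ (adjᶜ (suc (suc i)) 1F ∧ᶜ adjᶜ (suc (suc j)) 0F ⇒ᶜ adjᶜ 1F 0F))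

-- Correctness of the basic procedures

module _ {s : ℕ} (G : Graph) where
  open Graph G using (Adj; adj-sym; adj-irrefl) renaming (order to n; adj to adjacent)
  open Logic {s} G

  module _ {d : ℕ} {ρ : Vec (Fin n) d} (κ : Known) (X : Fin (suc s)) where

    decides-indep : ∀ {A} → lookup κ X ≡ just A → Decides (Knows κ) (Knows κ) (indepᶜ X) ρ (Indep G A)
    decides-indep at = decides-⇔ (mk⇔ (λ h u v p q → h u v (p , q)) λ h u v (p , q) → h u v p q)
      (decides-all λ u → decides-all λ v → decides-⇒ id
        (decides-∧ id (decides-mem κ 1F X at) λ _ → decides-mem κ 0F X at) λ _ → decides-not (decides-adj 1F 0F))

    decides-maxInd : ∀ {A} → lookup κ X ≡ just A → Decides (Knows κ) (Knows κ) (maxIndᶜ X) ρ (MaxInd G A)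
    decides-maxInd at = decides-∧ id (decides-indep at) λ _ → decides-all λ v →
      decides-∨ (decides-mem κ 0F X at) (decides-any λ w → decides-∧ id (decides-mem κ 0F X at) λ _ → decides-adj 1F 0F)

    -- c is evaluated while X is only partly rewritten, so it must give the right answer whatever B
    -- the variable X holds.
    does-assign : ∀ {c A} → (∀ B u → Decides (Knows (κ [ X ]≔ just B)) (Knows (κ [ X ]≔ just B)) c (u ∷ ρ) (u ∊ A)) →
                  Does (Knows κ) (assign X c) ρ (Knows (κ [ X ]≔ just A))
    does-assign {c} {A} dc = does-all
      (λ k σ → ∃[ B ] Knows (κ [ X ]≔ just B) σ × ∀ u → toℕ u < k → lookup B u ≡ lookup A u)
      (λ {σ} k → lookup σ X , knows-learn κ X k , λ _ ())
      (λ u → triple-∃ λ B → triple-× λ h → triple-cond _ (dc B u)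
        (triple λ { σ (k , ofʸ p) → let eq , k′ = run (does-put {ρ = u ∷ ρ} κ 0F X true) σ k in eq , B [ u ]≔ true , k′ , agree B u h (sym p) })
        (triple λ { σ (k , ofⁿ ¬p) → let eq , k′ = run (does-put {ρ = u ∷ ρ} κ 0F X false) σ k in eq , B [ u ]≔ false , k′ , agree B u h (sym (¬-not ¬p)) }))
      λ (B , k , h) → subst (λ B → Knows (κ [ X ]≔ just B) _) (subset-ext λ u → h u (toℕ<n u)) k
      where
      agree : ∀ B u {b} → (∀ v → toℕ v < toℕ u → lookup B v ≡ lookup A v) → b ≡ lookup A u →
              ∀ v → toℕ v < suc (toℕ u) → lookup (B [ u ]≔ b) v ≡ lookup A v
      agree B u {b} h eq = below-suc u (λ v lt → trans (lookup∘update′ (λ { refl → <-irrefl refl lt }) B b) (h v lt))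
        (trans (lookup∘update u B b) eq)

    does-greedy : Does (Knows (κ [ X ]≔ just ∅)) (greedy X) ρ (λ σ → ∃[ A ] Knows (κ [ X ]≔ just A) σ × MaxInd G A)
    does-greedy = does-all
      (λ k σ → ∃[ A ] Knows (κ [ X ]≔ just A) σ × Indep G A × ∀ u → toℕ u < k → Dominated G A u)
      (λ k → ∅ , k , (λ u v p _ _ → ∉∅ u p) , λ _ ())
      (λ u → triple-∃ λ A → triple-× λ (ind , dom) → triple-cond _
          (decides-any λ w → decides-∧ id (decides-mem (κ [ X ]≔ just A) 0F X (lookup∘update X κ _)) λ _ → decides-adj 1F 0F)
          (triple λ { σ (k , ofʸ p) → refl , A , k , ind , below-suc u dom (inj₂ p) })
          (triple λ { σ (k , ofⁿ ¬p) → let eq , k′ = run (does-put {ρ = u ∷ ρ} κ 0F X true) σ k in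
            eq , A [ u ]≔ true , k′ , indep-insert G {A} ind ¬p ,
            below-suc u (λ v lt → Sum.map (∊-insert {A = A}) (λ (w , w∊A , vw) → w , ∊-insert {A = A} w∊A , vw) (dom v lt)) (inj₁ (∊-insert-same {A = A})) }))
      λ (A , k , ind , dom) → A , k , ind , λ v → dom v (toℕ<n v)

    triple-pop : ∀ {B} → Triple (Knows (κ [ X ]≔ just B)) (pop X) ρ
      λ b σ → if b then (∃[ u ] u ∊ B × Knows (κ [ X ]≔ just (B [ u ]≔ false)) σ) else (Knows (κ [ X ]≔ just B) σ × ∀ u → ¬ u ∊ B)
    triple-pop {B} = triple-cond
      (λ b σ → if b then (Knows (κ [ X ]≔ just B) σ × ∀ u → ¬ u ∊ B) else (∃[ u ] u ∊ B × Knows (κ [ X ]≔ just (B [ u ]≔ false)) σ))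
      (triple-each λ u → triple-cond (λ b σ → Knows (κ [ X ]≔ just B) σ × Reflects (u ∊ B) b)
        (decides-mem (κ [ X ]≔ just B) 0F X (lookup∘update X κ _))
        (does-then {F′ = λ σ → ∃[ u ] u ∊ B × Knows (κ [ X ]≔ just (B [ u ]≔ false)) σ}
          (triple λ { σ (k , ofʸ p) → let eq , k′ = run (does-put {ρ = u ∷ ρ} κ 0F X false) σ k in eq , u , p , k′ })
          (triple λ σ → id))
        (triple λ { σ (k , ofⁿ ¬p) → k , ¬p }))
      (triple λ σ → id) (triple λ σ → id)

  module _ (κ : Known) (X : Fin (suc s)) {c : ∀ {d} → Cmd s d} {P : Subset n → Set}
           (dc : ∀ {d} (ρ : Vec (Fin n) d) B → Decides (Knows (κ [ X ]≔ just B)) (Knows (κ [ X ]≔ just B)) c ρ (P B)) where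

    decides-pick : ∀ m {d} {ρ : Vec (Fin n) d} A →
                   Decides (Knows (κ [ X ]≔ just A)) (Knows (κ [ X ]≔ just A)) (pick m X c) ρ (∀ B → Pick m A B → P B)
    decides-pick zero    A = decides-⇔ (mk⇔ (λ p B → λ { refl → p }) λ h → h A refl) (dc _ A)
    decides-pick (suc m) {ρ = ρ} A = decides-⇔ (mk⇔ (λ h B (u , u∉A , pk) → h u u∉A B pk) λ h u u∉A B pk → h B (u , u∉A , pk))
      (decides-all λ u → triple-cond (λ b σ → Knows (κ [ X ]≔ just A) σ × Reflects (u ∊ A) b)
        (decides-mem (κ [ X ]≔ just A) 0F X (lookup∘update X κ _))
        (triple λ { σ (k , ofʸ p) → k , ofʸ λ ¬p → contradiction p ¬p })
        (triple λ { σ (k , ofⁿ ¬p) → run (extended u ¬p) σ k }))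
      where
      restore : ∀ u {σ} → ¬ u ∊ A → Knows (κ [ X ]≔ just (A [ u ]≔ true)) σ →
                let r = ⟦ putᶜ 0F X false ⟧ (u ∷ ρ) σ in proj₁ r ≡ true × Knows (κ [ X ]≔ just A) (proj₂ r)
      restore u {σ} u∉A k =
        let eq , k′ = run (does-put {ρ = u ∷ ρ} κ 0F X false) σ k in
        eq , subst (λ B → Knows (κ [ X ]≔ just B) _) (remove-insert {A = A} u∉A) k′

      extended : ∀ u → ¬ u ∊ A →
        Decides (Knows (κ [ X ]≔ just A)) (Knows (κ [ X ]≔ just A))
          (putᶜ 0F X true ∧ᶜ condᶜ (pick m X c) (putᶜ 0F X false) (putᶜ 0F X false ∧ᶜ retᶜ false)) (u ∷ ρ)
          (¬ u ∊ A → ∀ B → Pick m (A [ u ]≔ true) B → P B)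
      extended u u∉A = does-then (does-put {ρ = u ∷ ρ} κ 0F X true)
        (triple-cond _ (decides-pick m (A [ u ]≔ true))
          (triple λ { σ (k , ofʸ h) → proj₂ (restore u u∉A k) , ofʸ λ _ → h })
          (does-then {F′ = λ σ → Knows (κ [ X ]≔ just A) σ × ¬ (∀ B → Pick m (A [ u ]≔ true) B → P B)}
            (triple λ { σ (k , ofⁿ ¬h) → let eq , k′ = restore u u∉A k in eq , k′ , ¬h })
            (triple λ σ (k , ¬h) → k , ofⁿ λ h → ¬h (h u∉A))))

    decides-exactly : ∀ m {d} {ρ : Vec (Fin n) d} →
                      Decides (Knows (κ [ X ]≔ just ∅)) (Knows (κ [ X ]≔ just ∅)) (pick m X c) ρ (∀ B → ∣ B ∣ ≡ m → P B)
    decides-exactly m = decides-⇔ (mk⇔ (λ h B eq → h B (Equivalence.from (pick-∅ m) eq)) λ h B pk → h B (Equivalence.to (pick-∅ m) pk))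
      (decides-pick m ∅)

    decides-within : ∀ m {d} {ρ : Vec (Fin n) d} →
                     Decides (Knows (κ [ X ]≔ just ∅)) (Knows (κ [ X ]≔ just ∅)) (within m X c) ρ (∀ B → ∣ B ∣ ≤ m → P B)
    decides-within zero    = decides-⇔ (mk⇔ (λ h B le → h B (n≤0⇒n≡0 le)) λ h B eq → h B (≤-reflexive eq)) (decides-exactly 0)
    decides-within (suc m) = decides-⇔ (mk⇔ to′ λ h → (λ B le → h B (≤-trans le (n≤1+n m))) , λ B eq → h B (≤-reflexive eq))
      (decides-∧ id (decides-within m) λ _ → decides-exactly (suc m))
      where
      to′ : (∀ B → ∣ B ∣ ≤ m → P B) × (∀ B → ∣ B ∣ ≡ suc m → P B) → ∀ B → ∣ B ∣ ≤ suc m → P B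
      to′ (h , h′) B le with m≤n⇒m<n∨m≡n le
      ... | inj₁ (s≤s lt) = h B lt
      ... | inj₂ eq       = h′ B eq

  decides-good : ∀ {d} {ρ : Vec (Fin n) d} {F} i j → Decides F F (goodᶜ i j) ρ (Good G (lookup ρ i) (lookup ρ j))
  decides-good i j = decides-∧ id (decides-adj i j) λ _ → decides-all λ a → decides-all λ b →
    decides-⇒ id (decides-∧ id (decides-adj _ _) λ _ → decides-adj _ _) λ _ → decides-adj 1F 0F

-- Comparing sizes and two-colouring

size-empty : ∀ {n} {A : Subset n} → (∀ u → ¬ u ∊ A) → ∣ A ∣ ≡ 0
size-empty {n} {A} none = n≤0⇒n≡0 (≤-trans (size-mono {A = A} {∅} λ u p → contradiction p (none u)) (≤-reflexive (∣⊥∣≡0 n)))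

empty-size : ∀ {n} {A : Subset n} → ∣ A ∣ ≡ 0 → ∀ u → ¬ u ∊ A
empty-size {A = A} eq u p = contradiction (trans (sym (size-remove {A = A} p)) eq) λ ()

full-size : ∀ {n} {A : Subset n} → (∀ u → u ∊ A) → n ≤ ∣ A ∣
full-size {n} {A} full = ≤-trans (≤-reflexive (sym (∣⊤∣≡n n))) (size-mono {A = full-set} {A} λ u _ → full u)

Colourable : ∀ {n} → (Fin n → Fin n → Set) → Set
Colourable {n} E = Σ (Fin n → Bool) λ f → ∀ u v → E u v → f u ≢ f v

module _ (G : Graph) where
  open Graph G using (Adj; adj-sym; adj-irrefl) renaming (order to n; adj to adjacent)
  open Logic {7} G

  module _ (i t s k c d : Maybe (Subset n)) where

    private
      κ : Maybe (Subset n) → Maybe (Subset n) → Known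
      κ A B = i ∷ t ∷ s ∷ k ∷ A ∷ B ∷ c ∷ d ∷ []

    -- Removing one vertex from each set preserves |A′| + |B| = |B′| + |A|, so the sizes agree
    -- exactly when both sets run empty together.
    decides-balance : ∀ {m} {ρ : Vec (Fin n) m} A B →
      Decides (Knows (κ (just A) (just B))) (Knows (κ nothing nothing)) (balance 4F 5F) ρ (∣ A ∣ ≡ ∣ B ∣)
    decides-balance {ρ = ρ} A B = triple-cond (λ b → if b then Drained else Failed)
      (triple-all Inv (λ k → A , B , k , +-comm (∣ A ∣) (∣ B ∣) , λ _ ()) step finish)
      (triple-∃ λ B′ → triple-× λ eq → decides-post (knows-forget (κ nothing (just B′)) 5F)
        (decides-⇔ (mk⇔ (λ none → sym (trans eq (cong (_+ ∣ A ∣) (size-empty {A = B′} none))))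
            λ same → empty-size {A = B′} (+-cancelʳ-≡ (∣ A ∣) (∣ B′ ∣) 0 (trans (sym eq) (sym same))))
          (decides-all λ u → decides-not (decides-mem (κ nothing (just B′)) 0F 5F refl))))
      (triple λ σ (k , differ) → k , ofⁿ differ)
      where
      Drained Failed : Assertion
      Drained σ = ∃[ B′ ] Knows (κ nothing (just B′)) σ × ∣ B ∣ ≡ ∣ B′ ∣ + ∣ A ∣
      Failed σ  = Knows (κ nothing nothing) σ × ∣ A ∣ ≢ ∣ B ∣
      Inv : ℕ → Assertion
      Inv m σ = ∃[ A′ ] ∃[ B′ ] Knows (κ (just A′) (just B′)) σ × ∣ A′ ∣ + ∣ B ∣ ≡ ∣ B′ ∣ + ∣ A ∣ × ∀ u → toℕ u < m → ¬ u ∊ A′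
      finish : ∀ {σ} → Inv n σ → Drained σ
      finish (A′ , B′ , k , eq , none) = B′ , knows-forget (κ (just A′) (just B′)) 4F k ,
        trans (cong (_+ ∣ B ∣) (sym (size-empty {A = A′} λ u → none u (toℕ<n u)))) eq
      popped : ∀ u A′ B′ → ∣ A′ ∣ + ∣ B ∣ ≡ ∣ B′ ∣ + ∣ A ∣ → (∀ v → toℕ v < toℕ u → ¬ v ∊ A′) → u ∊ A′ →
               ∀ b {σ} → (if b then (∃[ w ] w ∊ B′ × Knows (κ (just (A′ [ u ]≔ false)) (just (B′ [ w ]≔ false))) σ)
                          else (Knows (κ (just (A′ [ u ]≔ false)) (just B′)) σ × ∀ w → ¬ w ∊ B′)) →
               if b then Inv (suc (toℕ u)) σ else Failed σ
      popped u A′ B′ eq none u∊A′ true (w , w∊B′ , k) = A′ [ u ]≔ false , B′ [ w ]≔ false , k ,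
        sucℕ-injective (trans (cong (_+ ∣ B ∣) (sym (size-remove {A = A′} u∊A′))) (trans eq (cong (_+ ∣ A ∣) (size-remove {A = B′} w∊B′)))) ,
        below-suc u (λ v lt p → none v lt (proj₂ (remove-∊ {A = A′} p))) λ p → proj₁ (remove-∊ {A = A′} p) refl
      popped u A′ B′ eq none u∊A′ false (k , empty) =
        knows-forget (κ nothing (just B′)) 5F (knows-forget (κ (just (A′ [ u ]≔ false)) (just B′)) 4F k) ,
        λ same → contradiction
          (≤-trans (≤-trans (s≤s (m≤n+m (∣ B ∣) (∣ A′ [ u ]≔ false ∣))) (≤-reflexive (trans (cong (_+ ∣ B ∣) (sym (size-remove {A = A′} u∊A′)))
            (trans eq (cong (_+ ∣ A ∣) (size-empty {A = B′} empty)))))) (≤-reflexive same))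
          (<-irrefl refl)
      step : ∀ u → Triple (Inv (toℕ u)) (condᶜ (memᶜ 0F 4F) (putᶜ 0F 4F false ∧ᶜ pop 5F) (retᶜ true)) (u ∷ ρ)
             λ b σ → if b then Inv (suc (toℕ u)) σ else Failed σ
      step u = triple-∃ λ A′ → triple-∃ λ B′ → triple-× λ (eq , none) →
        triple-cond _ (decides-mem (κ (just A′) (just B′)) 0F 4F refl)
          (triple λ { σ (k , ofʸ p) → run (drain A′ B′ eq none p) σ k })
          (triple λ { σ (k , ofⁿ ¬p) → A′ , B′ , k , eq , below-suc u none ¬p })
        where
        drain : ∀ A′ B′ → ∣ A′ ∣ + ∣ B ∣ ≡ ∣ B′ ∣ + ∣ A ∣ → (∀ v → toℕ v < toℕ u → ¬ v ∊ A′) → u ∊ A′ →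
                Triple (Knows (κ (just A′) (just B′))) (putᶜ 0F 4F false ∧ᶜ pop 5F) (u ∷ ρ) λ b σ → if b then Inv (suc (toℕ u)) σ else Failed σ
        drain A′ B′ eq none p = does-then (does-put (κ (just A′) (just B′)) 0F 4F false)
          (triple λ σ k → popped u A′ B′ eq none p _ (run (triple-pop G {ρ = u ∷ ρ} (κ (just (A′ [ u ]≔ false)) (just B′)) 5F) σ k))

  module _ (i t s k j y : Maybe (Subset n)) where

    private
      κ : Maybe (Subset n) → Maybe (Subset n) → Known
      κ C D = i ∷ t ∷ s ∷ k ∷ j ∷ y ∷ C ∷ D ∷ []

    module _ {e : ∀ {d} → Fin d → Fin d → Cmd 7 d} {E : Fin n → Fin n → Set} (E-sym : ∀ {u v} → E u v → E v u)
             (de : ∀ C D {d} (ρ : Vec (Fin n) d) i j →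
                   Decides (Knows (κ C D)) (Knows (κ C D)) (e i j) ρ (E (lookup ρ i) (lookup ρ j))) where

      private
        Proper : (Fin n → Bool) → Set
        Proper f = ∀ u v → E u v → f u ≢ f v

        -- Any proper colouring can be changed into one that agrees with D on C.
        Faithful : Subset n → Subset n → Set
        Faithful C D = ∀ f → Proper f → ∃[ g ] Proper g × ∀ u → u ∊ C → g u ≡ lookup D u

        Painted : ℕ → Assertion
        Painted m σ = ∃[ C ] ∃[ D ] Knows (κ (just C) (just D)) σ × m ≤ ∣ C ∣ × Faithful C D

        Frontier : Subset n → Fin n → Fin n → Set
        Frontier C u v = E u v × u ∊ C × ¬ v ∊ C

        -- The colour of v is forced by its coloured neighbour u.
        faithful-paint : ∀ {C D u v} → Faithful C D → Frontier C u v →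
                         Faithful (C [ v ]≔ true) (D [ v ]≔ not (lookup D u))
        faithful-paint {C} {D} {u} {v} fa (uv , u∊C , v∉C) f pf = let g , pg , agree = fa f pf in g , pg , agree′ g pg agree
          where
          agree′ : ∀ g → Proper g → (∀ w → w ∊ C → g w ≡ lookup D w) →
                   ∀ w → w ∊ C [ v ]≔ true → g w ≡ lookup (D [ v ]≔ not (lookup D u)) w
          agree′ g pg agree w mem with w ≟ v | insert-∊ {A = C} mem
          ... | yes refl | _        =
            trans (trans (¬-not (λ eq → pg u v uv (sym eq))) (cong not (agree u u∊C))) (sym (lookup∘update v D _))
          ... | no w≢v   | inj₁ eq  = contradiction eq w≢v
          ... | no w≢v   | inj₂ w∊C = trans (agree w w∊C) (sym (lookup∘update′ w≢v D _))

        -- If g disagrees with D at u, flip g on all vertices outside C; since no edge joins C to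
        -- the rest, the colouring stays proper.
        faithful-seed : ∀ {C D u} → Faithful C D → ¬ u ∊ C → (∀ v w → ¬ Frontier C v w) → Faithful (C [ u ]≔ true) D
        faithful-seed {C} {D} {u} fa u∉C closed f pf with fa f pf
        ... | g , pg , agree with g u ≟ᵇ lookup D u
        ...   | yes eq = g , pg , λ w mem → Sum.[ (λ { refl → eq }) , agree w ] (insert-∊ {A = C} mem)
        ...   | no ≢   = g′ , pg′ , agree′
          where
          flip-outside : Fin n → Bool → Bool
          flip-outside w b = if b then g w else not (g w)
          g′ : Fin n → Bool
          g′ w = flip-outside w (lookup C w)
          not-injective : ∀ {a b} → not a ≡ not b → a ≡ b
          not-injective {true}  {true}  _ = refl
          not-injective {false} {false} _ = refl
          pg′ : Proper g′
          pg′ v w vw eq with lookup C v in p | lookup C w in q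
          ... | true  | true  = pg v w vw eq
          ... | false | false = pg v w vw (not-injective eq)
          ... | true  | false = closed v w (vw , p , λ t → contradiction (trans (sym q) t) λ ())
          ... | false | true  = closed w v (E-sym vw , q , λ t → contradiction (trans (sym p) t) λ ())
          agree′ : ∀ w → w ∊ C [ u ]≔ true → g′ w ≡ lookup D w
          agree′ w mem with insert-∊ {A = C} mem
          ... | inj₂ w∊C  = trans (cong (flip-outside w) w∊C) (agree w w∊C)
          ... | inj₁ refl = trans (cong (flip-outside w) (¬-not u∉C)) (sym (¬-not (λ eq → ≢ (sym eq))))

        does-round : ∀ {d} {ρ : Vec (Fin n) d} m → m < n → Does (Painted m) (round e 6F 7F) ρ (Painted (suc m))
        does-round {ρ = ρ} m lt = triple-∃ λ C → triple-∃ λ D → triple-× λ (le , fa) →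
          triple-cond (λ b σ → if b then Knows (κ (just C) (just D)) σ × (∀ u v → ¬ Frontier C u v) else Painted (suc m) σ)
            (triple-each λ u → triple-each λ v → triple-cond _ (frontier-spec C D u v)
              (triple λ { σ (k , ofʸ fr) → settle (run (paint-spec C D le fa u v fr {ρ = ρ}) σ k) })
              (triple λ { σ (k , ofⁿ ¬fr) → k , ¬fr }))
            (triple-× λ closed → triple-cond (λ b σ → if b then Knows (κ (just C) (just D)) σ × (∀ u → u ∊ C) else Painted (suc m) σ)
              (triple-each λ u → triple-cond _ (decides-mem (κ (just C) (just D)) 0F 6F refl)
                (triple λ { σ (k , ofʸ p) → k , p })
                (triple λ { σ (k , ofⁿ ¬p) → proj₂ (run (seed-spec C D le fa closed u ¬p {ρ = ρ}) σ k) }))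
              -- With all vertices coloured the round adds nothing, but |C| = n already exceeds m.
              (triple λ σ (k , full) → refl , C , D , k , ≤-trans lt (full-size {A = C} full) , fa)
              (triple λ σ p → refl , p))
            (triple λ σ p → refl , p)
          where
          settle : ∀ {b} {A E : Set} → b ≡ false × E → if b then A else E
          settle (refl , e) = e
          frontier-spec : ∀ C D u v {d} {ρ : Vec (Fin n) d} →
            Decides (Knows (κ (just C) (just D))) (Knows (κ (just C) (just D))) (frontier e 6F 7F) (v ∷ u ∷ ρ) (Frontier C u v)
          frontier-spec C D u v = decides-∧ id (de (just C) (just D) (v ∷ u ∷ _) 1F 0F) λ _ →
            decides-∧ id (decides-mem (κ (just C) (just D)) 1F 6F refl) λ _ → decides-not (decides-mem (κ (just C) (just D)) 0F 6F refl)
          paint-spec : ∀ C D → m ≤ ∣ C ∣ → Faithful C D → ∀ u v → Frontier C u v → ∀ {d} {ρ : Vec (Fin n) d} →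
            Triple (Knows (κ (just C) (just D))) (paint e 6F 7F) (v ∷ u ∷ ρ) λ b σ → b ≡ false × Painted (suc m) σ
          paint-spec C D le fa u v fr {ρ = ρ} =
            does-then {F′ = Knows (κ (just C) (just (D [ v ]≔ not (lookup D u))))}
              (triple-cond _ (decides-mem (κ (just C) (just D)) 1F 7F refl)
                (triple λ { σ (k , ofʸ p) → recolour σ {ρ = u ∷ ρ} k p })
                (triple λ { σ (k , ofⁿ ¬p) → recolour σ {ρ = u ∷ ρ} k (¬-not ¬p) }))
              (does-then (does-put (κ (just C) (just (D [ v ]≔ not (lookup D u)))) 0F 6F true)
                (triple λ σ k → refl , _ , _ , k , ≤-trans (s≤s le) (≤-reflexive (sym (size-insert {A = C} (proj₂ (proj₂ fr))))) , faithful-paint {C} {D} fa fr))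
            where
            recolour : ∀ σ {b} {d} {ρ : Vec (Fin n) d} → Knows (κ (just C) (just D)) σ → lookup D u ≡ b →
                       let r = ⟦ putᶜ 0F 7F (not b) ⟧ (v ∷ ρ) σ in proj₁ r ≡ true × Knows (κ (just C) (just (D [ v ]≔ not (lookup D u)))) (proj₂ r)
            recolour σ {ρ = ρ} k refl = run (does-put {ρ = v ∷ ρ} (κ (just C) (just D)) 0F 7F (not (lookup D u))) σ k
          seed-spec : ∀ C D → m ≤ ∣ C ∣ → Faithful C D → (∀ u v → ¬ Frontier C u v) → ∀ u → ¬ u ∊ C →
            ∀ {d} {ρ : Vec (Fin n) d} →
            Triple (Knows (κ (just C) (just D))) (putᶜ 0F 6F true ∧ᶜ retᶜ false) (u ∷ ρ) λ b σ → b ≡ false × Painted (suc m) σ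
          seed-spec C D le fa closed u u∉C = does-then (does-put (κ (just C) (just D)) 0F 6F true)
            (triple λ σ k → refl , _ , _ , k , ≤-trans (s≤s le) (≤-reflexive (sym (size-insert {A = C} u∉C))) , faithful-seed {C} {D} fa u∉C closed)

      -- After n rounds C contains every vertex, so faithfulness turns any proper colouring into D
      -- itself; testing D is therefore conclusive.
      decides-colourable : ∀ C D {d} {ρ : Vec (Fin n) d} →
        Decides (Knows (κ C D)) (Knows (κ nothing nothing)) (colourableᶜ e 6F 7F) ρ (Colourable E)
      decides-colourable C D {ρ = ρ} =
        does-then (does-assign G (κ C D) 6F {A = ∅} λ B u → triple λ σ k → k , ofⁿ (∉∅ u))
        (does-then (does-all {F = Knows (κ (just ∅) D)} Painted
            (λ {σ} k → ∅ , lookup σ 7F , knows-learn (κ (just ∅) D) 7F k , z≤n , λ f pf → f , pf , λ u p → contradiction p (∉∅ u))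
            (λ u → does-round (toℕ u) (toℕ<n u)) id)
          (triple-∃ λ C → triple-∃ λ D → triple-× λ (le , fa) →
            decides-post (λ k → knows-forget (κ nothing (just D)) 7F (knows-forget (κ (just C) (just D)) 6F k))
              (decides-⇔ (mk⇔ (λ proper → lookup D , proper) λ (f , pf) → let g , pg , agree = fa f pf in
                  λ u v uv eq → pg u v uv (trans (agree u (size-full {A = C} le u)) (trans eq (sym (agree v (size-full {A = C} le v))))))
                (decides-all λ u → decides-all λ v → decides-⇒ id (de (just C) (just D) (v ∷ u ∷ ρ) 1F 0F) λ _ → differ C D u v))))
        where
        differ : ∀ C D u v →
          Decides (Knows (κ (just C) (just D))) (Knows (κ (just C) (just D))) (condᶜ (memᶜ 1F 7F) (notᶜ (memᶜ 0F 7F)) (memᶜ 0F 7F)) (v ∷ u ∷ ρ) (lookup D u ≢ lookup D v)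
        differ C D u v = triple-cond _ (decides-mem (κ (just C) (just D)) 1F 7F refl)
          (triple λ { σ (k , ofʸ p) → run (decides-⇔ {ρ = v ∷ u ∷ ρ} (mk⇔ (λ ¬q eq → ¬q (trans (sym eq) p)) λ ≢ q → ≢ (trans p (sym q)))
             (decides-not {ρ = v ∷ u ∷ ρ} (decides-mem (κ (just C) (just D)) 0F 7F refl))) σ k })
          (triple λ { σ (k , ofⁿ ¬p) → run (decides-⇔ {ρ = v ∷ u ∷ ρ} (mk⇔ (λ q eq → ¬p (trans eq q)) λ ≢ → ¬-not-true λ ¬q → ≢ (trans (¬-not ¬p) (sym (¬-not ¬q))))
             (decides-mem {ρ = v ∷ u ∷ ρ} (κ (just C) (just D)) 0F 7F refl)) σ k })
          where
          ¬-not-true : ∀ {b} → ¬ ¬ b ≡ true → b ≡ true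
          ¬-not-true {true}  _ = refl
          ¬-not-true {false} h = contradiction (λ ()) h

-- The search and the bipartite test as commands

sparseᶜ checkᶜ : ℕ → ∀ {d} → Cmd 7 d
sparseᶜ ℓ = pick (suc ℓ) 3F (notᶜ (indepᶜ 3F ∧ᶜ allᶜ (memᶜ 0F 3F ⇒ᶜ notᶜ (memᶜ 0F 2F))))
checkᶜ ℓ  = within ℓ 3F
  (assign 4F (memᶜ 0F 3F ∨ᶜ memᶜ 0F 2F ∧ᶜ allᶜ (memᶜ 0F 3F ⇒ᶜ notᶜ (adjᶜ 0F 1F)))
   ∧ᶜ (maxIndᶜ 4F ⇒ᶜ assign 5F (memᶜ 0F 0F) ∧ᶜ balance 4F 5F))

-- The set variables 0 to 5 hold a maximal independent set I, a small set T,
-- the candidate I ⊖ T for the independent part, a small set K, its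
-- completion, and a copy of I.
searchᶜ : ℕ → (∀ {d} → Cmd 7 d) → Cmd 7 0
searchᶜ ℓ cover = greedy 0F ∧ᶜ notᶜ (within (ℓ + ℓ) 1F
  (notᶜ (assign 2F (condᶜ (memᶜ 0F 0F) (notᶜ (memᶜ 0F 1F)) (memᶜ 0F 1F))
         ∧ᶜ indepᶜ 2F ∧ᶜ sparseᶜ ℓ ∧ᶜ cover ∧ᶜ checkᶜ ℓ)))

matchedᶜ : ∀ {d} → Cmd 7 d
matchedᶜ = allᶜ (anyᶜ (adjᶜ 1F 0F) ⇒ᶜ anyᶜ (goodᶜ 1F 0F))
           ∧ᶜ allᶜ (allᶜ (goodᶜ 1F 0F ⇒ᶜ assign 4F (goodᶜ 2F 0F) ∧ᶜ assign 5F (goodᶜ 1F 0F) ∧ᶜ balance 4F 5F))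

bipartiteᶜ : Cmd 7 0
bipartiteᶜ = colourableᶜ adjᶜ 6F 7F ∧ᶜ matchedᶜ

-- The edges of the complement graph outside S. Splitting the vertices outside S into cliques means
-- colouring this graph, so two-colouring settles ℓ = 2.
apartᶜ : ∀ {d} → Fin d → Fin d → Cmd 7 d
apartᶜ i j = notᶜ (memᶜ i 2F) ∧ᶜ notᶜ (memᶜ j 2F) ∧ᶜ notᶜ (sameᶜ i j) ∧ᶜ notᶜ (adjᶜ i j)

rootᶜ cliquesᶜ : ℕ → ∀ {d} → Cmd 7 d
rootᶜ zero        = allᶜ (notᶜ (memᶜ 0F 2F))
rootᶜ (suc _)     = retᶜ true
cliquesᶜ zero       = allᶜ (memᶜ 0F 2F)
cliquesᶜ (suc zero) = allᶜ (allᶜ (notᶜ (apartᶜ 1F 0F)))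
cliquesᶜ _          = colourableᶜ apartᶜ 6F 7F

-- Correctness of the search and of the bipartite test

reflects-true : ∀ {P : Set} {b} → Reflects P b → b ≡ true ⇔ P
reflects-true (ofʸ p)  = mk⇔ (const p) (const refl)
reflects-true (ofⁿ ¬p) = mk⇔ (λ ()) λ p → contradiction p ¬p

module _ (G : Graph) where
  open Graph G using (Adj; adj-sym; adj-irrefl) renaming (order to n; adj to adjacent)
  open Logic {7} G

  -- A verified command evaluated on some admissible store is also a decision procedure inside the
  -- proof.
  decided : ∀ {d} {ρ : Vec (Fin n) d} {c F F′ P} → Decides F F′ c ρ P → ∀ σ → F σ → Dec P
  decided dc σ f = _ because proj₂ (run dc σ f)

  -- The independent part of a partition whose independent parts are labelled
  -- by Fin r and whose cliques are labelled by Fin ℓ.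
  record Cover (r ℓ : ℕ) (S : Subset n) : Set where
    field
      root        : ∀ v → v ∊ S → Fin r
      clique      : ∀ v → ¬ v ∊ S → Fin ℓ
      clique-edge : ∀ {u v} p q → clique u p ≡ clique v q → u ≢ v → Adj u v

  -- An independent set has at most one vertex in each clique.
  cover⇒sparse : ∀ {r ℓ S} → Cover r ℓ S → Sparse G ℓ S
  cover⇒sparse {ℓ = ℓ} cov B size (ind , dis) = contradiction
    (≤-trans (≤-reflexive (sym size)) (size-injection B (λ u p → clique u (dis u p)) inj)) (<-irrefl refl)
    where
    open Cover cov
    inj : ∀ {u v} p q → clique u (dis u p) ≡ clique v (dis v q) → u ≡ v
    inj {u} {v} p q eq with u ≟ v
    ... | yes u≡v = u≡v
    ... | no u≢v  = contradiction (clique-edge (dis u p) (dis v q) eq u≢v) (ind u v p q)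

  module _ {r ℓ : ℕ} (unique : (i j : Fin r) → i ≡ j) where

    -- `unique` expresses r ≤ 1: the independent parts together are the one independent set S.
    cover⇒partition : ∀ {S} → Indep G S → Cover r ℓ S → Partition G r ℓ
    cover⇒partition {S} ind cov = record
      { part              = λ v → part v (v ∊? S)
      ; independent-parts = λ i {u} {v} p q → ind u v (in-S (u ∊? S) p) (in-S (v ∊? S) q)
      ; clique-parts      = λ j {u} {v} p q → edge (u ∊? S) (v ∊? S) (trans p (sym q)) p
      }
      where
      open Cover cov
      part : ∀ v → Dec (v ∊ S) → Fin r ⊎ Fin ℓ
      part v (yes p) = inj₁ (root v p)
      part v (no p)  = inj₂ (clique v p)
      in-S : ∀ {v i} d → part v d ≡ inj₁ i → v ∊ S
      in-S (yes p) _ = p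
      edge : ∀ {u v j} d d′ → part u d ≡ part v d′ → part u d ≡ inj₂ j → u ≢ v → Adj u v
      edge (no p) (no q) eq _ = clique-edge p q (inj₂-injective eq)

    partition⇒cover : Partition G r ℓ → ∃[ S ] Indep G S × Cover r ℓ S
    partition⇒cover π = S , indep , record
      { root        = λ v p → root (part v) (trans (sym (lookup∘tabulate (rooted ∘ part) v)) p)
      ; clique      = λ v p → clique (part v) (p ∘ trans (lookup∘tabulate (rooted ∘ part) v))
      ; clique-edge = λ {u} {v} p q eq → clique-parts _ (clique-of (part u) _) (trans (clique-of (part v) _) (cong inj₂ (sym eq)))
      }
      where
      open Partition π
      rooted : Fin r ⊎ Fin ℓ → Bool
      rooted (inj₁ _) = true
      rooted (inj₂ _) = false
      S = tabulate (rooted ∘ part)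
      root : ∀ x → rooted x ≡ true → Fin r
      root (inj₁ i) _ = i
      clique : ∀ x → ¬ rooted x ≡ true → Fin ℓ
      clique (inj₁ _) ¬p = contradiction refl ¬p
      clique (inj₂ j) _  = j
      clique-of : ∀ x p → x ≡ inj₂ (clique x p)
      clique-of (inj₁ _) ¬p = contradiction refl ¬p
      clique-of (inj₂ j) _  = refl
      root-of : ∀ x p → x ≡ inj₁ (root x p)
      root-of (inj₁ i) _ = refl
      indep : Indep G S
      indep u v p q = independent-parts _ (root-of (part u) p′) (trans (root-of (part v) q′) (cong inj₁ (unique _ _)))
        where
        p′ = trans (sym (lookup∘tabulate (rooted ∘ part) u)) p
        q′ = trans (sym (lookup∘tabulate (rooted ∘ part) v)) q

  known : Subset n → Subset n → Subset n → Known
  known I T S = just I ∷ just T ∷ just S ∷ just ∅ ∷ nothing ∷ nothing ∷ nothing ∷ nothing ∷ []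

  module _ (I T S : Subset n) where

    private
      κ = known I T S

    decides-sparse : ∀ ℓ {d} {ρ : Vec (Fin n) d} → Decides (Knows κ) (Knows κ) (sparseᶜ ℓ) ρ (Sparse G ℓ S)
    decides-sparse ℓ = decides-exactly G κ 3F (λ ρ B → decides-not
      (decides-∧ id (decides-indep G (κ [ 3F ]≔ just B) 3F refl) λ _ → decides-all λ u →
        decides-⇒ id (decides-mem (κ [ 3F ]≔ just B) 0F 3F refl) λ _ → decides-not (decides-mem (κ [ 3F ]≔ just B) 0F 2F refl)))
      (suc ℓ)

    decides-checked : ∀ ℓ {d} {ρ : Vec (Fin n) d} → Decides (Knows κ) (Knows κ) (checkᶜ ℓ) ρ (Checked G ℓ I S)
    decides-checked ℓ = decides-within G κ 3F (λ ρ K →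
      does-then (does-assign G (κ [ 3F ]≔ just K) 4F {A = completion G S K} λ B u → let κ′ = (κ [ 3F ]≔ just K) [ 4F ]≔ just B in
        decides-⇔ (mk⇔ (∊-comprehension (completion? G S K)) (comprehension-∊ (completion? G S K)))
          (decides-∨ (decides-mem κ′ 0F 3F refl) (decides-∧ id (decides-mem κ′ 0F 2F refl) λ _ →
            decides-all λ w → decides-⇒ id (decides-mem κ′ 0F 3F refl) λ _ → decides-not (decides-adj 0F 1F))))
        (let κ′ = (κ [ 3F ]≔ just K) [ 4F ]≔ just (completion G S K) in
         decides-⇒ {F′ = Knows κ′} (λ {σ} → knows-forget κ′ {σ} 4F) (decides-maxInd G κ′ 4F refl) λ _ →
           does-then (does-assign G κ′ 5F {A = I} λ B u → decides-mem (κ′ [ 5F ]≔ just B) 0F 0F refl)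
             (decides-balance G (just I) (just T) (just S) (just K) nothing nothing (completion G S K) I)))
      ℓ

  Cover? : (Subset n → Set) → (∀ {d} → Cmd 7 d) → Set
  Cover? Q cover = ∀ I T S {d} {ρ : Vec (Fin n) d} → Decides (Knows (known I T S)) (Knows (known I T S)) cover ρ (Q S)

  module _ (ℓ : ℕ) (Q : Subset n → Set) (cover : ∀ {d} → Cmd 7 d) (decides-cover : Cover? Q cover) where

    private
      Fits : Subset n → Subset n → Set
      Fits I S = Indep G S × Sparse G ℓ S × Q S × Checked G ℓ I S

      κ₀ : Subset n → Known
      κ₀ I = just I ∷ just ∅ ∷ nothing ∷ just ∅ ∷ nothing ∷ nothing ∷ nothing ∷ nothing ∷ []

      fits : ∀ {d} → Cmd 7 d
      fits = assign 2F (condᶜ (memᶜ 0F 0F) (notᶜ (memᶜ 0F 1F)) (memᶜ 0F 1F)) ∧ᶜ indepᶜ 2F ∧ᶜ sparseᶜ ℓ ∧ᶜ cover ∧ᶜ checkᶜ ℓ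

      decides-fits : ∀ I T {d} {ρ : Vec (Fin n) d} →
        Decides (Knows (κ₀ I [ 1F ]≔ just T)) (Knows (κ₀ I [ 1F ]≔ just T)) fits ρ (Fits I (I ⊖ T))
      decides-fits I T {ρ = ρ} =
        does-then (does-assign G (κ₀ I [ 1F ]≔ just T) 2F {A = I ⊖ T} λ B u →
            subst (Decides _ _ _ (u ∷ ρ)) (cong (_≡ true) (sym (lookup∘tabulate _ u))) (differ B u))
          (decides-post (λ {σ} → knows-forget (known I T (I ⊖ T)) {σ} 2F)
            (decides-∧ id (decides-indep G (known I T (I ⊖ T)) 2F refl) λ _ →
             decides-∧ id (decides-sparse I T (I ⊖ T) ℓ) λ _ →
             decides-∧ id (decides-cover I T (I ⊖ T)) λ _ →
             decides-checked I T (I ⊖ T) ℓ))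
        where
        differ : ∀ B u → Decides (Knows (known I T B)) (Knows (known I T B)) (condᶜ (memᶜ 0F 0F) (notᶜ (memᶜ 0F 1F)) (memᶜ 0F 1F))
                           (u ∷ ρ) ((lookup I u xor lookup T u) ≡ true)
        differ B u = triple-cond _ (decides-mem (known I T B) 0F 0F refl)
          (triple λ { σ (k , ofʸ p) → run (decides-⇔ {ρ = u ∷ ρ} (xor-true p) (decides-not {ρ = u ∷ ρ} (decides-mem (known I T B) 0F 1F refl))) σ k })
          (triple λ { σ (k , ofⁿ ¬p) → run (decides-⇔ {ρ = u ∷ ρ} (xor-false (¬-not ¬p)) (decides-mem {ρ = u ∷ ρ} (known I T B) 0F 1F refl)) σ k })
          where
          xor-true : ∀ {a b} → a ≡ true → (¬ b ≡ true) ⇔ ((a xor b) ≡ true)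
          xor-true {b = true}  refl = mk⇔ (λ ¬p → contradiction refl ¬p) λ ()
          xor-true {b = false} refl = mk⇔ (λ _ → refl) λ _ ()
          xor-false : ∀ {a b} → a ≡ false → (b ≡ true) ⇔ ((a xor b) ≡ true)
          xor-false refl = mk⇔ id id

    decides-search : Decides (Knows (just ∅ ∷ just ∅ ∷ nothing ∷ just ∅ ∷ nothing ∷ nothing ∷ nothing ∷ nothing ∷ [])) (λ _ → ⊤)
      (searchᶜ ℓ cover) [] ((∃[ S ] Indep G S × Q S × Sparse G ℓ S) × Uniform G)
    decides-search =
      does-then (does-greedy G (κ₀ ∅) 0F)
      (triple-∃ λ I → triple-× λ maxI → decides-post (λ _ → tt)
        (decides-⇔ (mk⇔ (found I) (refuted I maxI)) (decides-not (decides-within G (κ₀ I) 1F (λ ρ T → decides-not (decides-fits I T)) (ℓ + ℓ)))))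
      where
      found : ∀ I → ¬ (∀ T → ∣ T ∣ ≤ ℓ + ℓ → ¬ Fits I (I ⊖ T)) → (∃[ S ] Indep G S × Q S × Sparse G ℓ S) × Uniform G
      -- A loop that fails yields only the negation of a universal statement; as `Fits` is
      -- decidable, a search over all subsets within the proof recovers a witness.
      found I h = witness (anySubset? λ T → (∣ T ∣ ≤? ℓ + ℓ) ×-dec fits? T)
        where
        fits? : ∀ T → Dec (Fits I (I ⊖ T))
        fits? T = decided (decides-fits I T {ρ = []}) (I ∷ T ∷ ∅ ∷ ∅ ∷ ∅ ∷ ∅ ∷ ∅ ∷ ∅ ∷ []) (refl , refl , refl , tt)
        witness : Dec (∃[ T ] ∣ T ∣ ≤ ℓ + ℓ × Fits I (I ⊖ T)) → (∃[ S ] Indep G S × Q S × Sparse G ℓ S) × Uniform G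
        witness (yes (T , _ , ind , sp , q , ch)) = (I ⊖ T , ind , q , sp) , checked⇒uniform G {ℓ} {I} {I ⊖ T} ind sp ch
        witness (no none)                         = contradiction (λ T le ft → none (T , le , ft)) h
      refuted : ∀ I → MaxInd G I → (∃[ S ] Indep G S × Q S × Sparse G ℓ S) × Uniform G → ¬ (∀ T → ∣ T ∣ ≤ ℓ + ℓ → ¬ Fits I (I ⊖ T))
      refuted I maxI ((S , ind , q , sp) , un) h =
        -- The small set to try is I ⊖ S, since I ⊖ (I ⊖ S) = S.
        h (I ⊖ S) (uniform⇒near G {ℓ} {I} {S} un maxI ind sp)
          (subst (Fits I) (sym (⊖-cancel I S)) (ind , sp , q , λ K _ maxC → un (completion G S K) I maxC maxI))

  unknown : Known
  unknown = nothing ∷ nothing ∷ nothing ∷ nothing ∷ nothing ∷ nothing ∷ nothing ∷ nothing ∷ []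

  decides-matched : ∀ {d} {ρ : Vec (Fin n) d} → Decides (Knows unknown) (Knows unknown) matchedᶜ ρ (Covered G × Balanced G)
  decides-matched = decides-∧ id
    (decides-all λ x → decides-⇒ id (decides-any λ y → decides-adj 1F 0F) λ _ → decides-any λ y → decides-good G 1F 0F)
    λ _ → decides-all λ x → decides-all λ y → decides-⇒ id (decides-good G 1F 0F) λ _ →
      does-then (does-assign G unknown 4F {A = partners G x} λ B z → in-partners x (decides-good G 2F 0F))
      (does-then (does-assign G (unknown [ 4F ]≔ just (partners G x)) 5F {A = partners G y} λ B z → in-partners y (decides-good G 1F 0F))
        (decides-balance G nothing nothing nothing nothing nothing nothing (partners G x) (partners G y)))
    where
    in-partners : ∀ x {z d} {ρ : Vec (Fin n) d} {F c} → Decides F F c ρ (Good G x z) → Decides F F c ρ (z ∊ partners G x)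
    in-partners x = decides-⇔ (mk⇔ (∊-comprehension (good? G x)) (comprehension-∊ (good? G x)))

  Apart : Subset n → Fin n → Fin n → Set
  Apart S u v = ¬ u ∊ S × ¬ v ∊ S × u ≢ v × ¬ Adj u v

  decides-apart : ∀ I T S C D {d} (ρ : Vec (Fin n) d) i j →
    let κ = just I ∷ just T ∷ just S ∷ just ∅ ∷ nothing ∷ nothing ∷ C ∷ D ∷ [] in
    Decides (Knows κ) (Knows κ) (apartᶜ i j) ρ (Apart S (lookup ρ i) (lookup ρ j))
  decides-apart I T S C D ρ i j =
    decides-∧ id (decides-not (decides-mem κ i 2F refl)) λ _ → decides-∧ id (decides-not (decides-mem κ j 2F refl)) λ _ →
    decides-∧ id (decides-not (decides-same i j)) λ _ → decides-not (decides-adj i j)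
    where κ = just I ∷ just T ∷ just S ∷ just ∅ ∷ nothing ∷ nothing ∷ C ∷ D ∷ []

  Cliques : ℕ → Subset n → Set
  Cliques ℓ S = Σ (∀ v → ¬ v ∊ S → Fin ℓ) λ f → ∀ {u v} p q → f u p ≡ f v q → u ≢ v → Adj u v

  decides-root : ∀ r → Cover? (λ S → ∀ v → v ∊ S → Fin r) (rootᶜ r)
  decides-root zero    I T S = decides-⇔ (mk⇔ (λ h v p → contradiction p (h v)) λ h v p → contradiction (h v p) λ ())
    (decides-all λ v → decides-not (decides-mem (known I T S) 0F 2F refl))
  decides-root (suc r) I T S = triple λ σ k → k , ofʸ λ _ _ → 0F

  decides-cliques : ∀ ℓ → ℓ ≤ 2 → Cover? (Cliques ℓ) (cliquesᶜ ℓ)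
  decides-cliques zero _ I T S = decides-⇔ (mk⇔ none every-in)
    (decides-all λ v → decides-mem (known I T S) 0F 2F refl)
    where
    none : (∀ v → v ∊ S) → Cliques 0 S
    none h = (λ v p → contradiction (h v) p) , λ {u} {_} p _ _ _ → contradiction (h u) p
    every-in : Cliques 0 S → ∀ v → v ∊ S
    every-in (f , _) v with v ∊? S
    ... | yes p = p
    ... | no ¬p = contradiction (f v ¬p) λ ()
  decides-cliques (suc zero) _ I T S = decides-⇔ (mk⇔ one (λ (f , h) u v (p , q , u≢v , ¬uv) → ¬uv (h p q (unique (f u p) (f v q)) u≢v)))
    (decides-all λ u → decides-all λ v → decides-not (decides-apart I T S nothing nothing (v ∷ u ∷ _) 1F 0F))
    where
    unique : (i j : Fin 1) → i ≡ j
    unique 0F 0F = refl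
    one : (∀ u v → ¬ Apart S u v) → Cliques 1 S
    one h = (λ _ _ → 0F) , edge
      where
      edge : ∀ {u v} → ¬ u ∊ S → ¬ v ∊ S → 0F ≡ 0F → u ≢ v → Adj u v
      edge {u} {v} p q _ u≢v with adj? G u v
      ... | yes uv = uv
      ... | no ¬uv = contradiction (p , q , u≢v , ¬uv) (h u v)
  decides-cliques (suc (suc zero)) _ I T S = decides-⇔ (mk⇔ two colours)
    (decides-colourable G (just I) (just T) (just S) (just ∅) nothing nothing {E = Apart S}
      (λ (p , q , u≢v , ¬uv) → q , p , (λ eq → u≢v (sym eq)) , λ vu → ¬uv (adj-sym vu))
      (decides-apart I T S) nothing nothing)
    where
    code : Bool → Fin 2
    code true  = 0F
    code false = 1F
    two : Colourable (Apart S) → Cliques 2 S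
    two (f , proper) = (λ v _ → code (f v)) , edge
      where
      code-injective : ∀ a b → code a ≡ code b → a ≡ b
      code-injective true  true  _ = refl
      code-injective false false _ = refl
      edge : ∀ {u v} → ¬ u ∊ S → ¬ v ∊ S → code (f u) ≡ code (f v) → u ≢ v → Adj u v
      edge {u} {v} p q eq u≢v with adj? G u v
      ... | yes uv = uv
      ... | no ¬uv = contradiction (code-injective (f u) (f v) eq) (proper u v (p , q , u≢v , ¬uv))
    colours : Cliques 2 S → Colourable (Apart S)
    colours (f , h) = (λ v → colour v (v ∊? S)) , λ u v → proper u v (u ∊? S) (v ∊? S)
      where
      is-zero : Fin 2 → Bool
      is-zero 0F = true
      is-zero 1F = false
      is-zero-injective : ∀ i j → is-zero i ≡ is-zero j → i ≡ j
      is-zero-injective 0F 0F _ = refl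
      is-zero-injective 0F 1F ()
      is-zero-injective 1F 0F ()
      is-zero-injective 1F 1F _ = refl
      colour : ∀ v → Dec (v ∊ S) → Bool
      -- No `Apart` edge meets S, so any colour works there.
      colour v (yes _) = true
      colour v (no p)  = is-zero (f v p)
      proper : ∀ u v d d′ → Apart S u v → colour u d ≢ colour v d′
      proper u v (yes p) _       (¬p , _)               _  = ¬p p
      proper u v (no _)  (yes q) (_ , ¬q , _)           _  = ¬q q
      proper u v (no p)  (no q)  (_ , _ , u≢v , ¬uv)    eq = ¬uv (h p q (is-zero-injective _ _ eq) u≢v)
  decides-cliques (suc (suc (suc _))) (s≤s (s≤s ()))

  decides-cover : ∀ r ℓ → ℓ ≤ 2 → Cover? (Cover r ℓ) (rootᶜ r ∧ᶜ cliquesᶜ ℓ)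
  decides-cover r ℓ le I T S = decides-⇔ (mk⇔ (λ (rt , f , h) → record { root = rt ; clique = f ; clique-edge = λ {u} {v} → h {u} {v} })
      λ cov → Cover.root cov , Cover.clique cov , λ {u} {v} → Cover.clique-edge cov {u} {v})
    (decides-∧ id (decides-root r I T S) λ _ → decides-cliques ℓ le I T S)

  bipartite⇔colourable : Partition G 2 0 ⇔ Colourable Adj
  bipartite⇔colourable = mk⇔ (λ π → colouring π) λ (f , proper) → record
    { part              = λ v → inj₁ (label (f v))
    ; independent-parts = λ i {u} {v} p q uv → proper u v uv (label-injective (f u) (f v) (inj₁-injective (trans p (sym q))))
    ; clique-parts      = λ ()
    }
    where
    label : Bool → Fin 2
    label true  = 0F
    label false = 1F
    label-injective : ∀ a b → label a ≡ label b → a ≡ b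
    label-injective true  true  _ = refl
    label-injective false false _ = refl
    colouring : Partition G 2 0 → Colourable Adj
    colouring π = (colour ∘ part) , λ u v uv eq → independent-parts _ (side-of (part u)) (trans (side-of (part v)) (cong inj₁ (colour-injective (part v) (part u) (sym eq)))) uv
      where
      open Partition π
      side : Fin 2 ⊎ Fin 0 → Fin 2
      side (inj₁ i) = i
      colour : Fin 2 ⊎ Fin 0 → Bool
      colour (inj₁ 0F) = true
      colour (inj₁ 1F) = false
      side-of : ∀ x → x ≡ inj₁ (side x)
      side-of (inj₁ i) = refl
      colour-injective : ∀ x y → colour x ≡ colour y → side x ≡ side y
      colour-injective (inj₁ 0F) (inj₁ 0F) _ = refl
      colour-injective (inj₁ 0F) (inj₁ 1F) ()
      colour-injective (inj₁ 1F) (inj₁ 0F) ()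
      colour-injective (inj₁ 1F) (inj₁ 1F) _ = refl

  matched⇔uniform : Colourable Adj → (Covered G × Balanced G) ⇔ Uniform G
  matched⇔uniform (f , proper) = mk⇔ (λ (cov , bal) → covered∧balanced⇒uniform G cov bal)
    λ un → uniform⇒covered G f (λ {u} {v} → proper u v) un , uniform⇒balanced G f (λ {u} {v} → proper u v) un

  outcome-true : ∀ {c : Cmd 7 0} {F F′ P} → Decides F F′ c [] P → F (Vec.replicate 8 ∅) → outcome c G ≡ true ⇔ P
  outcome-true dc f = reflects-true (proj₂ (run dc _ f))

  search-correct : ∀ {r ℓ} → ((i j : Fin r) → i ≡ j) → ℓ ≤ 2 →
    outcome (searchᶜ ℓ (rootᶜ r ∧ᶜ cliquesᶜ ℓ)) G ≡ true ⇔ (Partition G r ℓ × WellCovered G)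
  search-correct {r} {ℓ} unique le = mk⇔
    (λ eq → let (S , ind , cov , _) , un = Equivalence.to found eq in
      cover⇒partition unique ind cov , Equivalence.to (uniform⇔well-covered G) un)
    λ (π , wc) → let S , ind , cov = partition⇒cover unique π in
      Equivalence.from found ((S , ind , cov , cover⇒sparse cov) , Equivalence.from (uniform⇔well-covered G) wc)
    where
    found = outcome-true (decides-search ℓ (Cover r ℓ) (rootᶜ r ∧ᶜ cliquesᶜ ℓ) (decides-cover r ℓ le)) (refl , refl , refl , tt)

  -- The promised partition supplies an independent sparse S, which is all that completeness of the
  -- search asks for when no cover has to be found; hence ℓ is arbitrary.
  promise-correct : ∀ {r ℓ} → ((i j : Fin r) → i ≡ j) → Partition G r ℓ →
    outcome (searchᶜ ℓ (retᶜ true)) G ≡ true ⇔ WellCovered G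
  promise-correct {r} {ℓ} unique π = mk⇔
    (λ eq → Equivalence.to (uniform⇔well-covered G) (proj₂ (Equivalence.to found eq)))
    λ wc → let S , ind , cov = partition⇒cover unique π in
      Equivalence.from found ((S , ind , tt , cover⇒sparse cov) , Equivalence.from (uniform⇔well-covered G) wc)
    where
    found = outcome-true (decides-search ℓ (const ⊤) (retᶜ true) λ I T S → triple λ σ k → k , ofʸ tt) (refl , refl , refl , tt)

  bipartite-correct : outcome bipartiteᶜ G ≡ true ⇔ (Partition G 2 0 × WellCovered G)
  bipartite-correct = mk⇔
    (λ eq → let col , matched = Equivalence.to found eq in Equivalence.from bipartite⇔colourable col ,
      Equivalence.to (uniform⇔well-covered G) (Equivalence.to (matched⇔uniform col) matched))
    λ (π , wc) → let col = Equivalence.to bipartite⇔colourable π in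
      Equivalence.from found (col , Equivalence.from (matched⇔uniform col) (Equivalence.from (uniform⇔well-covered G) wc))
    where
    decides-both : Decides (Knows unknown) (Knows unknown) bipartiteᶜ [] (Colourable Adj × (Covered G × Balanced G))
    decides-both = decides-∧ id
      (decides-colourable G nothing nothing nothing nothing nothing nothing {adjᶜ} {Adj} adj-sym (λ C D ρ i j → decides-adj i j) nothing nothing)
      λ _ → decides-matched
    found = outcome-true decides-both tt

  bipartite-promise-correct : Partition G 2 0 → outcome matchedᶜ G ≡ true ⇔ WellCovered G
  bipartite-promise-correct π =
    uniform⇔well-covered G ⇔-∘ (matched⇔uniform (Equivalence.to bipartite⇔colourable π) ⇔-∘ outcome-true decides-matched tt)

Fin0-unique : (i j : Fin 0) → i ≡ j
Fin0-unique ()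

Fin1-unique : (i j : Fin 1) → i ≡ j
Fin1-unique 0F 0F = refl

recognise : ∀ r ℓ → ((i j : Fin r) → i ≡ j) → ℓ ≤ 2 → PolynomialTime [ r , ℓ ]WC-G
recognise r ℓ unique le = polynomial-time [ r , ℓ ]WC-G id (const []) (λ G → sym (++-identityʳ (encodeGraph G)))
  (searchᶜ ℓ (rootᶜ r ∧ᶜ cliquesᶜ ℓ)) λ G → search-correct G unique le

test-promise : ∀ r ℓ → ((i j : Fin r) → i ≡ j) → PolynomialTime WC-[ r , ℓ ]G
test-promise r ℓ unique = polynomial-time WC-[ r , ℓ ]G proj₁ (λ (_ , π) → encodePartition π) (λ _ → refl)
  (searchᶜ ℓ (retᶜ true)) λ (G , π) → promise-correct G unique π

theorem3 : (∀ (r ℓ : ℕ) →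
    (r , ℓ) ∈ ((0 , 1) ∷ (0 , 2) ∷ (1 , 0) ∷ (1 , 1) ∷ (1 , 2) ∷ (2 , 0) ∷ []) →
    PolynomialTime [ r , ℓ ]WC-G)
    × (∀ (r ℓ : ℕ) → (r ≡ 0 ⊎ r ≡ 1) ⊎ (r , ℓ) ≡ (2 , 0) →
    PolynomialTime WC-[ r , ℓ ]G)
theorem3 = recognition , promise
  where
  recognition : ∀ r ℓ → (r , ℓ) ∈ ((0 , 1) ∷ (0 , 2) ∷ (1 , 0) ∷ (1 , 1) ∷ (1 , 2) ∷ (2 , 0) ∷ []) → PolynomialTime [ r , ℓ ]WC-G
  recognition _ _ (here refl)                                 = recognise 0 1 Fin0-unique (s≤s z≤n)
  recognition _ _ (there (here refl))                         = recognise 0 2 Fin0-unique (s≤s (s≤s z≤n))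
  recognition _ _ (there (there (here refl)))                 = recognise 1 0 Fin1-unique z≤n
  recognition _ _ (there (there (there (here refl))))         = recognise 1 1 Fin1-unique (s≤s z≤n)
  recognition _ _ (there (there (there (there (here refl))))) = recognise 1 2 Fin1-unique (s≤s (s≤s z≤n))
  recognition _ _ (there (there (there (there (there (here refl)))))) =
    polynomial-time [ 2 , 0 ]WC-G id (const []) (λ G → sym (++-identityʳ (encodeGraph G)))
      bipartiteᶜ bipartite-correct
  promise : ∀ r ℓ → (r ≡ 0 ⊎ r ≡ 1) ⊎ (r , ℓ) ≡ (2 , 0) → PolynomialTime WC-[ r , ℓ ]G
  promise _ ℓ (inj₁ (inj₁ refl)) = test-promise 0 ℓ Fin0-unique
  promise _ ℓ (inj₁ (inj₂ refl)) = test-promise 1 ℓ Fin1-unique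
  promise _ _ (inj₂ refl)        =
    polynomial-time WC-[ 2 , 0 ]G proj₁ (λ (_ , π) → encodePartition π) (λ _ → refl)
      matchedᶜ λ (G , π) → bipartite-promise-correct G π
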